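{- Let $A \in \mathbb{F}_4[x]$ be a monic polynomial that does not split over $\mathbb{F}_4$, that has at most four distinct monic irreducible factors, and such that the (positive) exponents in its factorization into monic irreducible polynomials are not all odd. Then $A$ is bi-unitary perfect if and only if $A$ can be written as $A = P^aQ^bR^cS^d$ with $P,Q,R,S$ pairwise distinct monic irreducible polynomials in $\mathbb{F}_4[x]$ and $a,b,c,d \in \mathbb{N}$ such that one of the following conditions holds: i) $a=b=c=d=2$, $P,R \in \Omega_1$, $Q=P+1$ and $S=R+1$; ii) $a=b=2$, $c=d=2^n-1$ for some $n \in \mathbb{N}$, $P,R \in \Omega_1$, $Q=P+1$ and $S=R+1$; iii) $a=b=2^n-1$ for some $n \in \mathbb{N}$, $c=d=2$, $P,R \in \Omega_1$, $Q=P+1$ and $S=R+1$; iv) $P \in \Omega_2$, $Q=P+1$, $R,S \in \{P^3+P+1,\ P^3+P^2+1\}$ and $(a,b,c,d) \in \{(7,13,2,2),(13,7,2,2),(14,14,2,2)\}$.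
   Context: $\mathbb{F}_4=\{0,1,\alpha,\alpha+1\}$ with $\alpha^2+\alpha+1=0$ is the field with four elements; $\mathbb{N}$ is the set of nonnegative integers. All polynomials (including all divisors) are monic. A polynomial splits over $\mathbb{F}_4$ if it is a product of polynomials of degree $1$ over $\mathbb{F}_4$ (the constant $1$ splits). For a nonzero polynomial $S\in\mathbb{F}_4[x]$, a divisor $D$ of $S$ is unitary if $\gcd(D,S/D)=1$. For nonzero polynomials $S,T$, $\gcd_u(S,T)$ denotes the greatest common unitary divisor of $S$ and $T$, i.e. the monic polynomial of largest degree that is a unitary divisor of both $S$ and $T$. A divisor $D$ of $S$ is bi-unitary if $\gcd_u(D,S/D)=1$. $\sigma^{**}(S)$ denotes the sum of all monic bi-unitary divisors of $S$, and $S$ is bi-unitary perfect (b.u.p.) if $\sigma^{**}(S)=S$. $\Omega_1$ is the set of monic $P\in\mathbb{F}_4[x]$ such that $P$ and $P+1$ are both irreducible. $\Omega_2$ is the set of monic $P\in\mathbb{F}_4[x]$ such that $P$, $P+1$, $P^3+P+1$ and $P^3+P^2+1$ are all irreducible. -}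

module Defs where

open import Algebra.Bundles.Raw using (RawSemiring)
import Algebra.Definitions.RawSemiring as RawSemiringDefinitions
open import Data.List.Base using (List; []; _∷_; foldr; last; length; map)
open import Data.List.Membership.Propositional using (_∈_)
open import Data.List.Relation.Unary.All using (All)
open import Data.List.Relation.Unary.Unique.Propositional using (Unique)
open import Data.Maybe.Base using (just)
open import Data.Nat.Base using (ℕ; _∸_; _≤_; _<_; _%_)
open import Data.Product.Base using (_×_; ∃-syntax)
open import Function.Bundles using (_⇔_)
open import Level using (0ℓ)
open import Relation.Binary.PropositionalEquality.Core using (_≡_; _≢_)

infixl 6 _⊕_ _+ᶜ_ _+_
infixl 7 _⊗_ _*ᶜ_ _*_

data 𝔽₄ : Set where
  0₄ 1₄ α α+1 : 𝔽₄

_⊕_ : 𝔽₄ → 𝔽₄ → 𝔽₄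
0₄  ⊕ y   = y
1₄  ⊕ 0₄  = 1₄
1₄  ⊕ 1₄  = 0₄
1₄  ⊕ α   = α+1
1₄  ⊕ α+1 = α
α   ⊕ 0₄  = α
α   ⊕ 1₄  = α+1
α   ⊕ α   = 0₄
α   ⊕ α+1 = 1₄
α+1 ⊕ 0₄  = α+1
α+1 ⊕ 1₄  = α
α+1 ⊕ α   = 1₄
α+1 ⊕ α+1 = 0₄

-- Multiplication is determined by α² = α + 1.
_⊗_ : 𝔽₄ → 𝔽₄ → 𝔽₄
0₄  ⊗ y   = 0₄
1₄  ⊗ y   = y
α   ⊗ 0₄  = 0₄
α   ⊗ 1₄  = α
α   ⊗ α   = α+1
α   ⊗ α+1 = 1₄
α+1 ⊗ 0₄  = 0₄
α+1 ⊗ 1₄  = α+1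
α+1 ⊗ α   = 1₄
α+1 ⊗ α+1 = α

-- Polynomials over 𝔽₄ are coefficient lists, constant coefficient first,
-- whose last entry (the leading coefficient) is nonzero; the zero polynomial
-- is the empty list.  As the side condition is irrelevant, _≡_ is equality
-- of polynomials.
record Poly : Set where
  constructor poly
  field
    coeffs  : List 𝔽₄
    .normal : last coeffs ≢ just 0₄

open Poly public

trim : List 𝔽₄ → List 𝔽₄
trim []       = []
trim (c ∷ cs) with trim cs
... | d ∷ ds  = c ∷ d ∷ ds
... | []      with c
...   | 0₄    = []
...   | 1₄    = 1₄ ∷ []
...   | α     = α ∷ []
...   | α+1   = α+1 ∷ []

trim-normal : ∀ cs → last (trim cs) ≢ just 0₄
trim-normal []       = λ ()
trim-normal (c ∷ cs) with trim cs | trim-normal cs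
... | d ∷ ds  | ih = ih
... | []      | _  with c
...   | 0₄    = λ ()
...   | 1₄    = λ ()
...   | α     = λ ()
...   | α+1   = λ ()

fromCoeffs : List 𝔽₄ → Poly
fromCoeffs cs = poly (trim cs) (trim-normal cs)

_+ᶜ_ : List 𝔽₄ → List 𝔽₄ → List 𝔽₄
[]       +ᶜ ds       = ds
(c ∷ cs) +ᶜ []       = c ∷ cs
(c ∷ cs) +ᶜ (d ∷ ds) = c ⊕ d ∷ cs +ᶜ ds

_*ᶜ_ : List 𝔽₄ → List 𝔽₄ → List 𝔽₄
[]       *ᶜ ds = []
(c ∷ cs) *ᶜ ds = map (c ⊗_) ds +ᶜ (0₄ ∷ cs *ᶜ ds)

0ᴾ 1ᴾ : Poly
0ᴾ = fromCoeffs []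
1ᴾ = fromCoeffs (1₄ ∷ [])

_+_ _*_ : Poly → Poly → Poly
p + q = fromCoeffs (coeffs p +ᶜ coeffs q)
p * q = fromCoeffs (coeffs p *ᶜ coeffs q)

Poly-rawSemiring : RawSemiring 0ℓ 0ℓ
Poly-rawSemiring = record
  { Carrier = Poly
  ; _≈_     = _≡_
  ; _+_     = _+_
  ; _*_     = _*_
  ; 0#      = 0ᴾ
  ; 1#      = 1ᴾ
  }

open RawSemiringDefinitions Poly-rawSemiring public
  using (_∣_; _∤_; _^_; Coprime; Irreducible)

sumᴾ productᴾ : List Poly → Poly
sumᴾ     = foldr _+_ 0ᴾ
productᴾ = foldr _*_ 1ᴾ

-- The zero polynomial gets degree 0 here; deg is only applied to monic
-- polynomials below.
deg : Poly → ℕ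
deg p = length (coeffs p) ∸ 1

Monic : Poly → Set
Monic p = last (coeffs p) ≡ just 1₄

MonicIrreducible : Poly → Set
MonicIrreducible P = Monic P × Irreducible P

Splits : Poly → Set
Splits A = ∃[ ls ] All (λ L → Monic L × deg L ≡ 1) ls × productᴾ ls ≡ A

AtMostFourIrreducibleFactors : Poly → Set
AtMostFourIrreducibleFactors A =
  ∀ (Ps : List Poly) → Unique Ps →
  All (λ P → MonicIrreducible P × P ∣ A) Ps → length Ps ≤ 4

-- For irreducible P and nonzero A: the exponent of P in the factorization
-- of A is k.
HasExponent : (P A : Poly) → ℕ → Set
HasExponent P A k = ∃[ B ] P ^ k * B ≡ A × P ∤ B

AllExponentsOdd : Poly → Set
AllExponentsOdd A =
  ∀ P k → MonicIrreducible P → HasExponent P A k → 0 < k → k % 2 ≡ 1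

-- The cofactor E is the quotient S / D.
IsUnitaryDivisor : (D S : Poly) → Set
IsUnitaryDivisor D S = Monic D × ∃[ E ] D * E ≡ S × Coprime D E

record IsGcdᵤ (S T G : Poly) : Set where
  field
    divides₁ : IsUnitaryDivisor G S
    divides₂ : IsUnitaryDivisor G T
    greatest : ∀ {D} → IsUnitaryDivisor D S → IsUnitaryDivisor D T →
               deg D ≤ deg G

IsBiUnitaryDivisor : (D S : Poly) → Set
IsBiUnitaryDivisor D S = Monic D × ∃[ E ] D * E ≡ S × IsGcdᵤ D E 1ᴾ

-- σ**(S) = T.  The duplicate-free list Ds enumerates the finite set of
-- bi-unitary divisors of S; their sum does not depend on its order.
σ**[_]≡_ : (S T : Poly) → Set
σ**[ S ]≡ T =
  ∃[ Ds ] Unique Ds × (∀ D → D ∈ Ds ⇔ IsBiUnitaryDivisor D S) × sumᴾ Ds ≡ T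

BiUnitaryPerfect : Poly → Set
BiUnitaryPerfect S = σ**[ S ]≡ S

Ω₁ : Poly → Set
Ω₁ P = Monic P × Irreducible P × Irreducible (P + 1ᴾ)

Ω₂ : Poly → Set
Ω₂ P = Monic P × Irreducible P × Irreducible (P + 1ᴾ) ×
       Irreducible (P ^ 3 + P + 1ᴾ) × Irreducible (P ^ 3 + P ^ 2 + 1ᴾ)

{-# OPTIONS --safe #-}
-- Write G X n = 1 + X + ⋯ + X ^ (n - 1).  For irreducible X and a ≥ 1,
-- σ** (X ^ a) = (X + 1) G X m G X n with m + n = a + 1 and m - n ∈ {0, 1},
-- and G X (2ˢ u) = (X + 1) ^ (2ˢ - 1) (G X u) ^ 2ˢ; so A involves only the
-- numbers a and the factorizations of G X u for odd u > 1.  If 3 ∣ u, then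
-- X, X + 1, X + ω, X + ω + 1 all have their prime factors in A, which gives
-- A all four linear factors and a fifth, nonlinear one.  A prime power Yᵉ
-- dividing G X u for odd u satisfies Yᵉ⁻¹ ∣ X′; this bounds e, and shows
-- that u = 1 for the primes X of largest degree.
--
-- Let P be a prime factor of least degree.  Then Q = P + 1 is prime too.
-- If the other two primes are R and R + 1, comparing exponents leaves u = 1
-- throughout: σ** (X ^ a) = (X + 1) ^ a and a is 2 or 2ⁿ - 1.  Otherwise
-- R + 1 = Pⁱ Qʲ and S + 1 = Pᵏ Qˡ Rᵗ.  No G X u is a prime of A: its successor
-- X (X + 1) (G X ((u - 1) / 2))² would force u = 2ᵗ + 1, in which case G X u
-- is a product of two conjugates over 𝔽₄.  So G P u = R S for a single u.
-- Comparing exponents gives c = d = 2 and t = 0, and differentiating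
-- Q (Pⁱ Qʲ + 1) (Pᵏ Qˡ + 1) = P ^ u + 1 leaves only u = 7.
module Submission where

open import Algebra.Bundles using (CommutativeRing; RawRing; Semiring)
open import Algebra.Structures using (IsCommutativeRing)
open import Data.Empty.Irrelevant using (⊥-elim)
open import Data.List.Base using (List; []; _∷_; _++_; cartesianProductWith; concat; foldr; last; length; map)
open import Data.List.Membership.Propositional using (_∈_; find; lose)
open import Data.List.Membership.Propositional.Properties using (∈-++⁺ˡ; ∈-++⁺ʳ; ∈-++⁻; ∈-cartesianProductWith⁺; ∈-concat⁺′; ∈-concat⁻′; ∈-map⁺; ∈-map⁻)
open import Data.List.Properties using (map-++)
open import Data.List.Relation.Unary.All as All using (All; []; _∷_)
import Data.List.Relation.Unary.All.Properties as All
open import Data.List.Relation.Unary.AllPairs as AllPairs using ([]; _∷_)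
import Data.List.Relation.Unary.AllPairs.Properties as AllPairs
open import Data.List.Relation.Unary.Any using (any?; here; there)
open import Data.List.Relation.Unary.Unique.Propositional using (Unique)
import Data.List.Relation.Unary.Unique.Propositional.Properties as Unique
open import Data.Maybe.Base using (Maybe; just; nothing)
open import Data.Nat.Base as ℕ using (ℕ; zero; suc; z≤n; s≤s; _≤_; _<_; _∸_; _%_; _⊔_; ⌊_/2⌋)
open import Data.Nat.DivMod using ([m+kn]%n≡m%n)
open import Data.Nat.Induction using (<-wellFounded)
import Data.Nat.Properties as ℕ
open import Data.Nat.Solver using (module +-*-Solver)
open import Data.Product.Base using (_×_; _,_; ∃-syntax; proj₁; proj₂)
open import Data.Sum.Base using (_⊎_; inj₁; inj₂; [_,_]′)
open import Defs using (𝔽₄; 0₄; 1₄)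
open import Function.Base using (_∘_; id)
open import Induction.WellFounded using (Acc; acc)
open import Level using (0ℓ)
open import Relation.Binary.Definitions using (DecidableEquality; tri<; tri≈; tri>)
open import Relation.Binary.PropositionalEquality
open import Relation.Nullary.Decidable using (Dec; yes; no; from-yes; map′)
open import Relation.Nullary.Negation using (¬_; contradiction)

-- Perfection is used only as the identity ∏ σ** (X ^ a) = ∏ X ^ a, read in two ways: every factor
-- of a σ** (X ^ a) has its primes in A, and both sides have the same exponent at each prime. Since
-- X + 1 divides σ** (X ^ a), a prime factor of P + 1 lies in A; by minimality of deg P it is all of
-- P + 1.
--
-- The obstacle is that G P u could involve R and S to any powers, for several u at once. The
-- derivative bound makes it squarefree in R and S, the successor argument leaves only R S, and the
-- degrees of R and S, which are multiples of deg P, then fix u.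
--
-- The last equation has three monomials in P and Q. In characteristic 2, with P + Q = 1, the
-- derivative of such a monomial is 0 or a single monomial times P′, so parities alone decide which
-- terms survive. The answer 7 comes from G P 7 = (P³ + P + 1)(P³ + P² + 1), whose factors P ↦ P + 1
-- exchanges.
--
-- Two pairs of primes with all exponents of the form 2ⁿ - 1 are perfect as well; the hypothesis on
-- odd exponents removes exactly these.

-- Arithmetic of the field with four elements.

module FieldLaws where

  open import Defs using (α; α+1; _⊕_; _⊗_)

  elements : List 𝔽₄
  elements = 0₄ ∷ 1₄ ∷ α ∷ α+1 ∷ []

  ∈-elements : ∀ c → c ∈ elements
  ∈-elements 0₄  = here refl
  ∈-elements 1₄  = there (here refl)
  ∈-elements α   = there (there (here refl))
  ∈-elements α+1 = there (there (there (here refl)))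

  -- With four elements every law of the field is decidable and can be settled by evaluation.
  ∀? : {P : 𝔽₄ → Set} → (∀ c → Dec (P c)) → Dec (∀ c → P c)
  ∀? P? = map′ (λ ps c → All.lookup ps (∈-elements c)) (λ f → All.universal f elements)
    (All.all? P? elements)

  _≟₄_ : DecidableEquality 𝔽₄
  0₄  ≟₄ 0₄  = yes refl
  0₄  ≟₄ 1₄  = no λ ()
  0₄  ≟₄ α   = no λ ()
  0₄  ≟₄ α+1 = no λ ()
  1₄  ≟₄ 0₄  = no λ ()
  1₄  ≟₄ 1₄  = yes refl
  1₄  ≟₄ α   = no λ ()
  1₄  ≟₄ α+1 = no λ ()
  α   ≟₄ 0₄  = no λ ()
  α   ≟₄ 1₄  = no λ ()
  α   ≟₄ α   = yes refl
  α   ≟₄ α+1 = no λ ()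
  α+1 ≟₄ 0₄  = no λ ()
  α+1 ≟₄ 1₄  = no λ ()
  α+1 ≟₄ α   = no λ ()
  α+1 ≟₄ α+1 = yes refl

  ⊕-assoc : ∀ a b c → (a ⊕ b) ⊕ c ≡ a ⊕ (b ⊕ c)
  ⊕-assoc = from-yes (∀? λ a → ∀? λ b → ∀? λ c → ((a ⊕ b) ⊕ c) ≟₄ (a ⊕ (b ⊕ c)))

  ⊕-comm : ∀ a b → a ⊕ b ≡ b ⊕ a
  ⊕-comm = from-yes (∀? λ a → ∀? λ b → (a ⊕ b) ≟₄ (b ⊕ a))

  ⊕-identityʳ : ∀ a → a ⊕ 0₄ ≡ a
  ⊕-identityʳ = from-yes (∀? λ a → (a ⊕ 0₄) ≟₄ a)

  ⊕-self : ∀ a → a ⊕ a ≡ 0₄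
  ⊕-self = from-yes (∀? λ a → (a ⊕ a) ≟₄ 0₄)

  ⊗-assoc : ∀ a b c → (a ⊗ b) ⊗ c ≡ a ⊗ (b ⊗ c)
  ⊗-assoc = from-yes (∀? λ a → ∀? λ b → ∀? λ c → ((a ⊗ b) ⊗ c) ≟₄ (a ⊗ (b ⊗ c)))

  ⊗-comm : ∀ a b → a ⊗ b ≡ b ⊗ a
  ⊗-comm = from-yes (∀? λ a → ∀? λ b → (a ⊗ b) ≟₄ (b ⊗ a))

  ⊗-identityʳ : ∀ a → a ⊗ 1₄ ≡ a
  ⊗-identityʳ = from-yes (∀? λ a → (a ⊗ 1₄) ≟₄ a)

  ⊗-zeroʳ : ∀ a → a ⊗ 0₄ ≡ 0₄
  ⊗-zeroʳ = from-yes (∀? λ a → (a ⊗ 0₄) ≟₄ 0₄)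

  ⊗-distribˡ : ∀ a b c → a ⊗ (b ⊕ c) ≡ a ⊗ b ⊕ a ⊗ c
  ⊗-distribˡ = from-yes (∀? λ a → ∀? λ b → ∀? λ c → (a ⊗ (b ⊕ c)) ≟₄ (a ⊗ b ⊕ a ⊗ c))

  ⊗-distribʳ : ∀ a b c → (b ⊕ c) ⊗ a ≡ b ⊗ a ⊕ c ⊗ a
  ⊗-distribʳ = from-yes (∀? λ a → ∀? λ b → ∀? λ c → ((b ⊕ c) ⊗ a) ≟₄ (b ⊗ a ⊕ c ⊗ a))

  ⊕-isCommutativeRing : IsCommutativeRing _≡_ _⊕_ _⊗_ id 0₄ 1₄
  ⊕-isCommutativeRing = record
    { isRing = record
      { +-isAbelianGroup = record
        { isGroup = record
          { isMonoid = record
            { isSemigroup = record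
              { isMagma = record { isEquivalence = isEquivalence ; ∙-cong = cong₂ _⊕_ }
              ; assoc = ⊕-assoc }
            ; identity = (λ _ → refl) , ⊕-identityʳ }
          ; inverse = ⊕-self , ⊕-self
          ; ⁻¹-cong = id }
        ; comm = ⊕-comm }
      ; *-cong = cong₂ _⊗_
      ; *-assoc = ⊗-assoc
      ; *-identity = (λ _ → refl) , ⊗-identityʳ
      ; distrib = ⊗-distribˡ , ⊗-distribʳ }
    ; *-comm = ⊗-comm }

  ⊗-nonzero : ∀ a b → a ≢ 0₄ → b ≢ 0₄ → a ⊗ b ≢ 0₄
  ⊗-nonzero 0₄  b   a≢0 b≢0 _ = a≢0 refl
  ⊗-nonzero 1₄  b   a≢0 b≢0 p = b≢0 p
  ⊗-nonzero α   0₄  a≢0 b≢0 _ = b≢0 refl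
  ⊗-nonzero α+1 0₄  a≢0 b≢0 _ = b≢0 refl

  inverse : ∀ a → a ≢ 0₄ → ∃[ b ] b ⊗ a ≡ 1₄
  inverse 0₄  a≢0 = contradiction refl a≢0
  inverse 1₄  _   = 1₄ , refl
  inverse α   _   = α+1 , refl
  inverse α+1 _   = α , refl

-- Solving polynomial identities over 𝔽₄-algebras.

module CharTwo
  {K : Set} {_+_ _*_ : K → K → K} {0# 1# : K}
  (isCommutativeRing : IsCommutativeRing _≡_ _+_ _*_ id 0# 1#)
  (ω : K) (ω² : ω * ω ≡ ω + 1#)
  where

  open import Defs using (α; α+1; _⊕_; _⊗_)
  open FieldLaws using (_≟₄_)
  open import Algebra.Solver.Ring.AlmostCommutativeRing using (fromCommutativeRing; _-Raw-AlmostCommutative⟶_)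
  import Algebra.Solver.Ring as Solver

  commutativeRing : CommutativeRing 0ℓ 0ℓ
  commutativeRing = record { isCommutativeRing = isCommutativeRing }

  open CommutativeRing commutativeRing
    using (+-identityˡ; +-identityʳ; zeroˡ; zeroʳ; *-identityˡ; *-identityʳ; -‿inverseʳ; +-assoc; +-comm; *-comm; distribˡ; distribʳ)

  𝔽₄-rawRing : RawRing 0ℓ 0ℓ
  𝔽₄-rawRing = record { _≈_ = _≡_ ; _+_ = _⊕_ ; _*_ = _⊗_ ; -_ = id ; 0# = 0₄ ; 1# = 1₄ }

  embed : 𝔽₄ → K
  embed 0₄  = 0#
  embed 1₄  = 1#
  embed α   = ω
  embed α+1 = ω + 1#

  private
    cancel : ∀ x y → x + (x + y) ≡ y
    cancel x y = trans (sym (+-assoc x x y)) (trans (cong (_+ y) (-‿inverseʳ x)) (+-identityˡ y))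

    swap : ∀ x y → x + (y + x) ≡ y
    swap x y = trans (cong (x +_) (+-comm y x)) (cancel x y)

    ω*ω+1 : ω * (ω + 1#) ≡ 1#
    ω*ω+1 = trans (distribˡ ω ω 1#) (trans (cong₂ _+_ ω² (*-identityʳ ω)) (trans (+-comm _ ω) (cancel ω 1#)))

  embed-⊕ : ∀ a b → embed (a ⊕ b) ≡ embed a + embed b
  embed-⊕ 0₄  b   = sym (+-identityˡ _)
  embed-⊕ 1₄  0₄  = sym (+-identityʳ _)
  embed-⊕ 1₄  1₄  = sym (-‿inverseʳ _)
  embed-⊕ 1₄  α   = +-comm ω 1#
  embed-⊕ 1₄  α+1 = sym (swap 1# ω)
  embed-⊕ α   0₄  = sym (+-identityʳ _)
  embed-⊕ α   1₄  = refl
  embed-⊕ α   α   = sym (-‿inverseʳ _)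
  embed-⊕ α   α+1 = sym (cancel ω 1#)
  embed-⊕ α+1 0₄  = sym (+-identityʳ _)
  embed-⊕ α+1 1₄  = trans (sym (swap 1# ω)) (+-comm 1# _)
  embed-⊕ α+1 α   = trans (sym (cancel ω 1#)) (+-comm ω _)
  embed-⊕ α+1 α+1 = sym (-‿inverseʳ _)

  embed-⊗ : ∀ a b → embed (a ⊗ b) ≡ embed a * embed b
  embed-⊗ 0₄  b   = sym (zeroˡ _)
  embed-⊗ 1₄  b   = sym (*-identityˡ _)
  embed-⊗ α   0₄  = sym (zeroʳ _)
  embed-⊗ α   1₄  = sym (*-identityʳ _)
  embed-⊗ α   α   = sym ω²
  embed-⊗ α   α+1 = sym ω*ω+1
  embed-⊗ α+1 0₄  = sym (zeroʳ _)
  embed-⊗ α+1 1₄  = sym (*-identityʳ _)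
  embed-⊗ α+1 α   = sym (trans (*-comm _ ω) ω*ω+1)
  embed-⊗ α+1 α+1 = sym (trans (distribʳ (ω + 1#) ω 1#) (trans (cong₂ _+_ ω*ω+1 (*-identityˡ _)) (swap 1# ω)))

  -- With coefficients taken from 𝔽₄ the solver knows `x + x = 0` and `ω * ω = ω + 1`, on which most
  -- identities below depend.
  embedding : 𝔽₄-rawRing -Raw-AlmostCommutative⟶ fromCommutativeRing commutativeRing
  embedding = record
    { ⟦_⟧ = embed ; +-homo = embed-⊕ ; *-homo = embed-⊗ ; -‿homo = λ _ → refl
    ; 0-homo = refl ; 1-homo = refl }

  embed≟ : ∀ a b → Maybe (embed a ≡ embed b)
  embed≟ a b with a ≟₄ b
  ... | yes e = just (cong embed e)
  ... | no  _ = nothing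

  open Solver 𝔽₄-rawRing (fromCommutativeRing commutativeRing) embedding embed≟ public
    using (solve; con; _:+_; _:*_; _:=_; _:^_)

-- Abstracts 𝔽₄[x].  The size is the degree plus one, and 0 at 0#; as the
-- characteristic is 2, negation is the identity.
record PolynomialRing : Set₁ where
  infixl 6 _+_
  infixl 7 _*_
  field
    Carrier           : Set
    _+_ _*_           : Carrier → Carrier → Carrier
    0# 1# ω           : Carrier
    isCommutativeRing : IsCommutativeRing _≡_ _+_ _*_ id 0# 1#
    ω²                : ω * ω ≡ ω + 1#

    size          : Carrier → ℕ
    size-0        : size 0# ≡ 0
    size-1        : size 1# ≡ 1
    size≡0⇒≡0     : ∀ p → size p ≡ 0 → p ≡ 0#
    size-+        : ∀ p q → size (p + q) ≤ size p ⊔ size q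
    size-*        : ∀ p q → p ≢ 0# → q ≢ 0# → suc (size (p * q)) ≡ size p ℕ.+ size q
    divMod        : ∀ p q → q ≢ 0# → ∃[ s ] ∃[ r ] p ≡ s * q + r × size r < size q
    below         : ℕ → List Carrier
    ∈-below       : ∀ n p → size p ≤ n → p ∈ below n

    Monic         : Carrier → Set
    monic-1       : Monic 1#
    monic≢0       : ∀ {p} → Monic p → p ≢ 0#
    monic-*       : ∀ p q → Monic p → Monic q → Monic (p * q)
    monic-+       : ∀ p q → Monic p → size q < size p → Monic (p + q)
    monic-cancelˡ : ∀ p q → Monic p → Monic (p * q) → Monic q
    monic-size1   : ∀ p → Monic p → size p ≡ 1 → p ≡ 1#
    normalise     : ∀ p → p ≢ 0# → ∃[ b ] ∃[ c ] ∃[ q ] c * b ≡ 1# × p ≡ b * q × Monic q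

    D             : Carrier → Carrier
    D-+           : ∀ p q → D (p + q) ≡ D p + D q
    D-*           : ∀ p q → D (p * q) ≡ D p * q + p * D q
    size-D        : ∀ p → p ≢ 0# → size (D p) < size p
    D≡0⇒square    : ∀ p → D p ≡ 0# → ∃[ q ] p ≡ q * q

    linear            : 𝔽₄ → Carrier
    monic-linear      : ∀ c → Monic (linear c)
    size-linear       : ∀ c → size (linear c) ≡ 2
    linear-injective  : ∀ {b c} → linear b ≡ linear c → b ≡ c
    linear-1          : linear 0₄ + 1# ≡ linear 1₄
    root-shift        : ∀ c p → ∃[ s ] (s * linear c ≡ p ⊎ s * linear c ≡ p + 1# ⊎
                                        s * linear c ≡ p + ω ⊎ s * linear c ≡ p + (ω + 1#))

-- Construction of 𝔽₄[x] from coefficient sequences.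

module Coefficients where

  open import Defs
  open FieldLaws

  open ≡-Reasoning

  -- Infinite sequences forget lengths and trimming, so ring laws can be checked coefficientwise and
  -- brought back by `coeff-injective`.
  Seq : Set
  Seq = ℕ → 𝔽₄

  infix 4 _≈_
  _≈_ : Seq → Seq → Set
  f ≈ g = ∀ n → f n ≡ g n

  nth : List 𝔽₄ → Seq
  nth []       _       = 0₄
  nth (c ∷ cs) zero    = c
  nth (c ∷ cs) (suc n) = nth cs n

  trim-nth : ∀ cs → nth (trim cs) ≈ nth cs
  trim-nth []       n = refl
  trim-nth (c ∷ cs) n with trim cs | trim-nth cs
  trim-nth (c ∷ cs) zero    | d ∷ ds | ih = refl
  trim-nth (c ∷ cs) (suc n) | d ∷ ds | ih = ih n
  trim-nth (0₄  ∷ cs) zero    | [] | ih = refl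
  trim-nth (0₄  ∷ cs) (suc n) | [] | ih = ih n
  trim-nth (1₄  ∷ cs) zero    | [] | ih = refl
  trim-nth (1₄  ∷ cs) (suc n) | [] | ih = ih n
  trim-nth (α   ∷ cs) zero    | [] | ih = refl
  trim-nth (α   ∷ cs) (suc n) | [] | ih = ih n
  trim-nth (α+1 ∷ cs) zero    | [] | ih = refl
  trim-nth (α+1 ∷ cs) (suc n) | [] | ih = ih n

  last-zero : ∀ c cs → nth (c ∷ cs) ≈ (λ _ → 0₄) → last (c ∷ cs) ≡ just 0₄
  last-zero c []       z = cong just (z 0)
  last-zero c (d ∷ cs) z = last-zero d cs (z ∘ suc)

  Normal : List 𝔽₄ → Set
  Normal cs = last cs ≢ just 0₄

  normal-tail : ∀ c cs → Normal (c ∷ cs) → Normal cs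
  normal-tail c []       _ ()
  normal-tail c (_ ∷ _) nc = nc

  -- When one list ends first, the other has only zeros left; its last entry is then zero, against
  -- normality.
  normal-unique : ∀ cs ds → .(Normal cs) → .(Normal ds) → nth cs ≈ nth ds → cs ≡ ds
  normal-unique []       []       _  _  _ = refl
  normal-unique []       (d ∷ ds) _  nd e = ⊥-elim (nd (last-zero d ds (sym ∘ e)))
  normal-unique (c ∷ cs) []       nc _  e = ⊥-elim (nc (last-zero c cs e))
  normal-unique (c ∷ cs) (d ∷ ds) nc nd e =
    cong₂ _∷_ (e 0) (normal-unique cs ds (normal-tail c cs nc) (normal-tail d ds nd) (e ∘ suc))

  coeff : Poly → Seq
  coeff p = nth (coeffs p)

  coeff-injective : ∀ p q → coeff p ≈ coeff q → p ≡ q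
  coeff-injective (poly cs nc) (poly ds nd) e with normal-unique cs ds nc nd e
  ... | refl = refl

  coeff-fromCoeffs : ∀ cs → coeff (fromCoeffs cs) ≈ nth cs
  coeff-fromCoeffs = trim-nth

  nth-+ : ∀ cs ds n → nth (cs +ᶜ ds) n ≡ nth cs n ⊕ nth ds n
  nth-+ []       ds       n       = refl
  nth-+ (c ∷ cs) []       n       = sym (⊕-identityʳ _)
  nth-+ (c ∷ cs) (d ∷ ds) zero    = refl
  nth-+ (c ∷ cs) (d ∷ ds) (suc n) = nth-+ cs ds n

  nth-map : ∀ c ds n → nth (map (c ⊗_) ds) n ≡ c ⊗ nth ds n
  nth-map c []       n       = sym (⊗-zeroʳ c)
  nth-map c (d ∷ ds) zero    = refl
  nth-map c (d ∷ ds) (suc n) = nth-map c ds n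

  -- The Cauchy product, expanded along the first coefficient of `f` to match the recursion of
  -- `_*ᶜ_`.
  conv : Seq → Seq → Seq
  conv f g zero    = f 0 ⊗ g 0
  conv f g (suc n) = f 0 ⊗ g (suc n) ⊕ conv (f ∘ suc) g n

  conv-zeroˡ : ∀ f g → f ≈ (λ _ → 0₄) → conv f g ≈ (λ _ → 0₄)
  conv-zeroˡ f g z zero    = cong (_⊗ g 0) (z 0)
  conv-zeroˡ f g z (suc n) rewrite z 0 = conv-zeroˡ (f ∘ suc) g (z ∘ suc) n

  conv-cong : ∀ {f f′ g g′} → f ≈ f′ → g ≈ g′ → conv f g ≈ conv f′ g′
  conv-cong ef eg zero    = cong₂ _⊗_ (ef 0) (eg 0)
  conv-cong ef eg (suc n) = cong₂ _⊕_ (cong₂ _⊗_ (ef 0) (eg (suc n))) (conv-cong (ef ∘ suc) eg n)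

  nth-* : ∀ cs ds → nth (cs *ᶜ ds) ≈ conv (nth cs) (nth ds)
  nth-* []       ds n = sym (conv-zeroˡ (nth []) (nth ds) (λ _ → refl) n)
  nth-* (c ∷ cs) ds zero = begin
    nth (map (c ⊗_) ds +ᶜ (0₄ ∷ cs *ᶜ ds)) 0  ≡⟨ nth-+ (map (c ⊗_) ds) _ 0 ⟩
    nth (map (c ⊗_) ds) 0 ⊕ 0₄  ≡⟨ ⊕-identityʳ _ ⟩
    nth (map (c ⊗_) ds) 0  ≡⟨ nth-map c ds 0 ⟩
    c ⊗ nth ds 0                             ∎
  nth-* (c ∷ cs) ds (suc n) = begin
    nth (map (c ⊗_) ds +ᶜ (0₄ ∷ cs *ᶜ ds)) (suc n)  ≡⟨ nth-+ (map (c ⊗_) ds) _ (suc n) ⟩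
    nth (map (c ⊗_) ds) (suc n) ⊕ nth (cs *ᶜ ds) n  ≡⟨ cong₂ _⊕_ (nth-map c ds (suc n)) (nth-* cs ds n) ⟩
    c ⊗ nth ds (suc n) ⊕ conv (nth cs) (nth ds) n        ∎

  module S₄ = CharTwo ⊕-isCommutativeRing α refl

  conv-distribʳ : ∀ f g h → conv (λ n → f n ⊕ g n) h ≈ (λ n → conv f h n ⊕ conv g h n)
  conv-distribʳ f g h zero    = ⊗-distribʳ (h 0) (f 0) (g 0)
  conv-distribʳ f g h (suc n) = begin
    (f 0 ⊕ g 0) ⊗ h (suc n) ⊕ conv (λ m → f (suc m) ⊕ g (suc m)) h n
      ≡⟨ cong ((f 0 ⊕ g 0) ⊗ h (suc n) ⊕_) (conv-distribʳ (f ∘ suc) (g ∘ suc) h n) ⟩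
    (f 0 ⊕ g 0) ⊗ h (suc n) ⊕ (conv (f ∘ suc) h n ⊕ conv (g ∘ suc) h n)
      ≡⟨ solve 5 (λ a b c d e → (a :+ b) :* c :+ (d :+ e) := (a :* c :+ d) :+ (b :* c :+ e)) refl
           (f 0) (g 0) (h (suc n)) (conv (f ∘ suc) h n) (conv (g ∘ suc) h n) ⟩
    (f 0 ⊗ h (suc n) ⊕ conv (f ∘ suc) h n) ⊕ (g 0 ⊗ h (suc n) ⊕ conv (g ∘ suc) h n) ∎
    where open S₄

  conv-scaleˡ : ∀ c f g → conv (λ n → c ⊗ f n) g ≈ (λ n → c ⊗ conv f g n)
  conv-scaleˡ c f g zero    = ⊗-assoc c (f 0) (g 0)
  conv-scaleˡ c f g (suc n) = begin
    (c ⊗ f 0) ⊗ g (suc n) ⊕ conv (λ m → c ⊗ f (suc m)) g n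
      ≡⟨ cong₂ _⊕_ (⊗-assoc c _ _) (conv-scaleˡ c (f ∘ suc) g n) ⟩
    c ⊗ (f 0 ⊗ g (suc n)) ⊕ c ⊗ conv (f ∘ suc) g n
      ≡⟨ ⊗-distribˡ c _ _ ⟨
    c ⊗ (f 0 ⊗ g (suc n) ⊕ conv (f ∘ suc) g n) ∎

  -- The mirror image of the defining recursion: the term with `g 0` is split off instead of the one
  -- with `f 0`. Commutativity rests on having both.
  conv-sucʳ : ∀ f g n → conv f g (suc n) ≡ conv f (g ∘ suc) n ⊕ f (suc n) ⊗ g 0
  conv-sucʳ f g zero    = refl
  conv-sucʳ f g (suc n) = trans (cong (f 0 ⊗ g (suc (suc n)) ⊕_) (conv-sucʳ (f ∘ suc) g n))
    (sym (⊕-assoc (f 0 ⊗ g (suc (suc n))) _ _))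

  conv-comm : ∀ f g → conv f g ≈ conv g f
  conv-comm f g zero    = ⊗-comm (f 0) (g 0)
  conv-comm f g (suc n) = begin
    conv f g (suc n)  ≡⟨ conv-sucʳ f g n ⟩
    conv f (g ∘ suc) n ⊕ f (suc n) ⊗ g 0  ≡⟨ cong₂ _⊕_ (conv-comm f (g ∘ suc) n) (⊗-comm (f (suc n)) (g 0)) ⟩
    conv (g ∘ suc) f n ⊕ g 0 ⊗ f (suc n)  ≡⟨ ⊕-comm (conv (g ∘ suc) f n) _ ⟩
    g 0 ⊗ f (suc n) ⊕ conv (g ∘ suc) f n   ∎

  conv-assoc : ∀ f g h → conv (conv f g) h ≈ conv f (conv g h)
  conv-assoc f g h zero    = ⊗-assoc (f 0) (g 0) (h 0)
  conv-assoc f g h (suc n) = begin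
    (f 0 ⊗ g 0) ⊗ h (suc n) ⊕ conv (λ m → f 0 ⊗ g (suc m) ⊕ conv (f ∘ suc) g m) h n
      ≡⟨ cong ((f 0 ⊗ g 0) ⊗ h (suc n) ⊕_) (conv-distribʳ (λ m → f 0 ⊗ g (suc m)) (conv (f ∘ suc) g) h n) ⟩
    (f 0 ⊗ g 0) ⊗ h (suc n) ⊕ (conv (λ m → f 0 ⊗ g (suc m)) h n ⊕ conv (conv (f ∘ suc) g) h n)
      ≡⟨ cong ((f 0 ⊗ g 0) ⊗ h (suc n) ⊕_)
           (cong₂ _⊕_ (conv-scaleˡ (f 0) (g ∘ suc) h n) (conv-assoc (f ∘ suc) g h n)) ⟩
    (f 0 ⊗ g 0) ⊗ h (suc n) ⊕ (f 0 ⊗ conv (g ∘ suc) h n ⊕ conv (f ∘ suc) (conv g h) n)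
      ≡⟨ solve 5 (λ a b c d e → (a :* b) :* c :+ (a :* d :+ e) := a :* (b :* c :+ d) :+ e) refl
           (f 0) (g 0) (h (suc n)) (conv (g ∘ suc) h n) (conv (f ∘ suc) (conv g h) n) ⟩
    f 0 ⊗ (g 0 ⊗ h (suc n) ⊕ conv (g ∘ suc) h n) ⊕ conv (f ∘ suc) (conv g h) n ∎
    where open S₄

  coeff-+ : ∀ p q n → coeff (p + q) n ≡ coeff p n ⊕ coeff q n
  coeff-+ p q n = trans (coeff-fromCoeffs (coeffs p +ᶜ coeffs q) n) (nth-+ (coeffs p) (coeffs q) n)

  coeff-* : ∀ p q → coeff (p * q) ≈ conv (coeff p) (coeff q)
  coeff-* p q n = trans (coeff-fromCoeffs (coeffs p *ᶜ coeffs q) n) (nth-* (coeffs p) (coeffs q) n)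

  +-assoc : ∀ p q r → (p + q) + r ≡ p + (q + r)
  +-assoc p q r = coeff-injective _ _ λ n → begin
    coeff ((p + q) + r) n  ≡⟨ coeff-+ (p + q) r n ⟩
    coeff (p + q) n ⊕ coeff r n  ≡⟨ cong (_⊕ coeff r n) (coeff-+ p q n) ⟩
    (coeff p n ⊕ coeff q n) ⊕ coeff r n  ≡⟨ ⊕-assoc (coeff p n) _ _ ⟩
    coeff p n ⊕ (coeff q n ⊕ coeff r n)  ≡⟨ cong (coeff p n ⊕_) (coeff-+ q r n) ⟨
    coeff p n ⊕ coeff (q + r) n  ≡⟨ coeff-+ p (q + r) n ⟨
    coeff (p + (q + r)) n                 ∎

  +-comm : ∀ p q → p + q ≡ q + p
  +-comm p q = coeff-injective _ _ λ n → begin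
    coeff (p + q) n  ≡⟨ coeff-+ p q n ⟩
    coeff p n ⊕ coeff q n  ≡⟨ ⊕-comm (coeff p n) _ ⟩
    coeff q n ⊕ coeff p n  ≡⟨ coeff-+ q p n ⟨
    coeff (q + p) n         ∎

  +-identityˡ : ∀ p → 0ᴾ + p ≡ p
  +-identityˡ p = coeff-injective _ _ (coeff-+ 0ᴾ p)

  +-self : ∀ p → p + p ≡ 0ᴾ
  +-self p = coeff-injective _ _ λ n → trans (coeff-+ p p n) (⊕-self (coeff p n))

  *-assoc : ∀ p q r → (p * q) * r ≡ p * (q * r)
  *-assoc p q r = coeff-injective _ _ λ n → begin
    coeff ((p * q) * r) n  ≡⟨ coeff-* (p * q) r n ⟩
    conv (coeff (p * q)) (coeff r) n  ≡⟨ conv-cong (coeff-* p q) (λ _ → refl) n ⟩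
    conv (conv (coeff p) (coeff q)) (coeff r) n  ≡⟨ conv-assoc (coeff p) (coeff q) (coeff r) n ⟩
    conv (coeff p) (conv (coeff q) (coeff r)) n  ≡⟨ conv-cong {f = coeff p} (λ _ → refl) (coeff-* q r) n ⟨
    conv (coeff p) (coeff (q * r)) n  ≡⟨ coeff-* p (q * r) n ⟨
    coeff (p * (q * r)) n                          ∎

  *-comm : ∀ p q → p * q ≡ q * p
  *-comm p q = coeff-injective _ _ λ n → begin
    coeff (p * q) n  ≡⟨ coeff-* p q n ⟩
    conv (coeff p) (coeff q) n ≡⟨ conv-comm (coeff p) (coeff q) n ⟩
    conv (coeff q) (coeff p) n ≡⟨ coeff-* q p n ⟨
    coeff (q * p) n            ∎

  *-distribʳ : ∀ r p q → (p + q) * r ≡ p * r + q * r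
  *-distribʳ r p q = coeff-injective _ _ λ n → begin
    coeff ((p + q) * r) n  ≡⟨ coeff-* (p + q) r n ⟩
    conv (coeff (p + q)) (coeff r) n  ≡⟨ conv-cong (coeff-+ p q) (λ _ → refl) n ⟩
    conv (λ m → coeff p m ⊕ coeff q m) (coeff r) n  ≡⟨ conv-distribʳ (coeff p) (coeff q) (coeff r) n ⟩
    conv (coeff p) (coeff r) n ⊕ conv (coeff q) (coeff r) n  ≡⟨ cong₂ _⊕_ (coeff-* p r n) (coeff-* q r n) ⟨
    coeff (p * r) n ⊕ coeff (q * r) n  ≡⟨ coeff-+ (p * r) (q * r) n ⟨
    coeff (p * r + q * r) n                                     ∎

  const : 𝔽₄ → Poly
  const c = fromCoeffs (c ∷ [])

  coeff-const* : ∀ c p n → coeff (const c * p) n ≡ c ⊗ coeff p n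
  coeff-const* c p n = trans (coeff-* (const c) p n)
    (trans (conv-cong {g = coeff p} (coeff-fromCoeffs (c ∷ [])) (λ _ → refl) n) (conv-const n))
    where
    conv-const : ∀ n → conv (nth (c ∷ [])) (coeff p) n ≡ c ⊗ coeff p n
    conv-const zero    = refl
    conv-const (suc n) = trans (cong (c ⊗ coeff p (suc n) ⊕_) (conv-zeroˡ (nth []) (coeff p) (λ _ → refl) n)) (⊕-identityʳ _)

  *-identityˡ : ∀ p → 1ᴾ * p ≡ p
  *-identityˡ p = coeff-injective _ _ (coeff-const* 1₄ p)

  Poly-isCommutativeRing : IsCommutativeRing _≡_ _+_ _*_ id 0ᴾ 1ᴾ
  Poly-isCommutativeRing = record
    { isRing = record
      { +-isAbelianGroup = record
        { isGroup = record
          { isMonoid = record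
            { isSemigroup = record
              { isMagma = record { isEquivalence = isEquivalence ; ∙-cong = cong₂ _+_ }
              ; assoc = +-assoc }
            ; identity = +-identityˡ , λ p → trans (+-comm p 0ᴾ) (+-identityˡ p) }
          ; inverse = +-self , +-self
          ; ⁻¹-cong = id }
        ; comm = +-comm }
      ; *-cong = cong₂ _*_
      ; *-assoc = *-assoc
      ; *-identity = *-identityˡ , λ p → trans (*-comm p 1ᴾ) (*-identityˡ p)
      ; distrib = (λ p q r → trans (*-comm p (q + r)) (trans (*-distribʳ p q r) (cong₂ _+_ (*-comm q p) (*-comm r p))))
                , *-distribʳ }
    ; *-comm = *-comm }

  X : Poly
  X = fromCoeffs (0₄ ∷ 1₄ ∷ [])

  coeff-X*-zero : ∀ p → coeff (X * p) 0 ≡ 0₄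
  coeff-X*-zero p = trans (coeff-* X p 0)
    (conv-cong {g = coeff p} (coeff-fromCoeffs (0₄ ∷ 1₄ ∷ [])) (λ _ → refl) 0)

  conv-constˡ : ∀ f g → f ∘ suc ≈ (λ _ → 0₄) → conv f g ≈ (λ n → f 0 ⊗ g n)
  conv-constˡ f g z zero    = refl
  conv-constˡ f g z (suc n) =
    trans (cong (f 0 ⊗ g (suc n) ⊕_) (conv-zeroˡ (f ∘ suc) g z n)) (⊕-identityʳ _)

  coeff-X*-suc : ∀ p n → coeff (X * p) (suc n) ≡ coeff p n
  coeff-X*-suc p n = trans (coeff-* X p (suc n))
    (trans (conv-cong {g = coeff p} (coeff-fromCoeffs (0₄ ∷ 1₄ ∷ [])) (λ _ → refl) (suc n))
           (conv-constˡ (nth (1₄ ∷ [])) (coeff p) (λ _ → refl) n))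

  size : Poly → ℕ
  size p = length (coeffs p)

  Vanishes : ℕ → Seq → Set
  Vanishes n f = ∀ k → n ≤ k → f k ≡ 0₄

  nth-vanishes : ∀ cs → Vanishes (length cs) (nth cs)
  nth-vanishes []       k       _         = refl
  nth-vanishes (c ∷ cs) (suc k) (s≤s len≤) = nth-vanishes cs k len≤

  last-nth : ∀ c cs → last (c ∷ cs) ≡ just (nth (c ∷ cs) (length cs))
  last-nth c []       = refl
  last-nth c (d ∷ ds) = last-nth d ds

  vanishes⇒length≤ : ∀ n cs → .(Normal cs) → Vanishes n (nth cs) → length cs ≤ n
  vanishes⇒length≤ n []       nc v = z≤n
  vanishes⇒length≤ n (c ∷ cs) nc v with suc (length cs) ℕ.≤? n
  ... | yes le = le
  ... | no ¬le = ⊥-elim (nc (trans (last-nth c cs) (cong just (v (length cs) (ℕ.≤-pred (ℕ.≰⇒> ¬le))))))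

  vanishes⇒size≤ : ∀ n p → Vanishes n (coeff p) → size p ≤ n
  vanishes⇒size≤ n (poly cs nc) = vanishes⇒length≤ n cs nc

  size-vanishes : ∀ p → Vanishes (size p) (coeff p)
  size-vanishes p = nth-vanishes (coeffs p)

  size≡0⇒≡0 : ∀ p → size p ≡ 0 → p ≡ 0ᴾ
  size≡0⇒≡0 (poly [] _) _ = refl

  size-+ : ∀ p q → size (p + q) ≤ size p ℕ.⊔ size q
  size-+ p q = vanishes⇒size≤ _ (p + q) λ k le → trans (coeff-+ p q k)
    (cong₂ _⊕_ (size-vanishes p k (ℕ.≤-trans (ℕ.m≤m⊔n _ _) le))
               (size-vanishes q k (ℕ.≤-trans (ℕ.m≤n⊔m (size p) _) le)))

  record Lead (p : Poly) (n : ℕ) (c : 𝔽₄) : Set where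
    constructor lead
    field
      top     : coeff p n ≡ c
      nonzero : c ≢ 0₄
      above   : Vanishes (suc n) (coeff p)
      size≡   : size p ≡ suc n

  mkLead : ∀ {p n c} → coeff p n ≡ c → c ≢ 0₄ → Vanishes (suc n) (coeff p) → Lead p n c
  mkLead {p} {n} {c} e c≢0 v = lead e c≢0 v (ℕ.≤-antisym (vanishes⇒size≤ (suc n) p v) n<size)
    where
    n<size : suc n ≤ size p
    n<size with suc n ℕ.≤? size p
    ... | yes le = le
    ... | no ¬le = contradiction (trans (sym e) (size-vanishes p n (ℕ.≤-pred (ℕ.≰⇒> ¬le)))) c≢0

  leading : ∀ p → p ≢ 0ᴾ → ∃[ n ] ∃[ c ] Lead p n c
  leading (poly [] _)        p≢0 = contradiction refl p≢0
  leading p@(poly (c ∷ cs) nc) _ = length cs , nth (c ∷ cs) (length cs) ,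
    lead refl (λ e → ⊥-elim (nc (trans (last-nth c cs) (cong just e)))) (size-vanishes p) refl

  monic⇒lead : ∀ p → Monic p → ∃[ n ] Lead p n 1₄
  monic⇒lead p@(poly (c ∷ cs) nc) m with trans (sym (last-nth c cs)) m
  ... | e = length cs , lead (just-injective e) (λ ()) (size-vanishes p) refl
    where open import Data.Maybe.Properties using (just-injective)

  lead⇒monic : ∀ p n → Lead p n 1₄ → Monic p
  lead⇒monic p@(poly (c ∷ cs) nc) n l with ℕ.suc-injective (Lead.size≡ l)
  ... | refl = trans (last-nth c cs) (cong just (Lead.top l))

  -- At each step the term with `f 0` meets `g` beyond its degree and vanishes, so the first
  -- coefficient of `f` can be discarded.
  conv-top : ∀ m n f g → Vanishes (suc m) f → Vanishes (suc n) g →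
    conv f g (m ℕ.+ n) ≡ f m ⊗ g n × Vanishes (suc (m ℕ.+ n)) (conv f g)
  conv-top zero n f g vf vg = conv-f n , λ k le → trans (conv-f k)
    (trans (cong (f 0 ⊗_) (vg k le)) (⊗-zeroʳ (f 0)))
    where
    conv-f : conv f g ≈ (λ k → f 0 ⊗ g k)
    conv-f = conv-constˡ f g (λ k → vf (suc k) (s≤s z≤n))
  conv-top (suc m) n f g vf vg = trans (step (m ℕ.+ n) (ℕ.m≤n+m n m)) (proj₁ ih) , above
    where
    ih = conv-top m n (f ∘ suc) g (λ k le → vf (suc k) (s≤s le)) vg
    step : ∀ k → n ≤ k → conv f g (suc k) ≡ conv (f ∘ suc) g k
    step k le = cong (_⊕ conv (f ∘ suc) g k) (trans (cong (f 0 ⊗_) (vg (suc k) (s≤s le))) (⊗-zeroʳ (f 0)))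
    above : Vanishes (suc (suc m ℕ.+ n)) (conv f g)
    above (suc k) (s≤s le) = trans (step k (ℕ.≤-trans (ℕ.m≤n+m n m) (ℕ.<⇒≤ le))) (proj₂ ih k le)

  lead-* : ∀ {p q m n c d} → Lead p m c → Lead q n d → Lead (p * q) (m ℕ.+ n) (c ⊗ d)
  lead-* {p} {q} {m} {n} (lead tp np vp _) (lead tq nq vq _)
    with conv-top m n (coeff p) (coeff q) vp vq
  ... | t , v = mkLead (trans (coeff-* p q _) (trans t (cong₂ _⊗_ tp tq))) (⊗-nonzero _ _ np nq)
      (λ k le → trans (coeff-* p q k) (v k le))

  size-* : ∀ p q → p ≢ 0ᴾ → q ≢ 0ᴾ → suc (size (p * q)) ≡ size p ℕ.+ size q
  size-* p q p≢0 q≢0 with leading p p≢0 | leading q q≢0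
  ... | m , c , lp | n , d , lq = begin
    suc (size (p * q))  ≡⟨ cong suc (Lead.size≡ (lead-* lp lq)) ⟩
    suc (suc (m ℕ.+ n))  ≡⟨ ℕ.+-suc (suc m) n ⟨
    suc m ℕ.+ suc n  ≡⟨ cong₂ ℕ._+_ (Lead.size≡ lp) (Lead.size≡ lq) ⟨
    size p ℕ.+ size q     ∎

  monic≢0 : ∀ {p} → Monic p → p ≢ 0ᴾ
  monic≢0 {poly [] _} () refl

  monic-1 : Monic 1ᴾ
  monic-1 = refl

  monic-* : ∀ p q → Monic p → Monic q → Monic (p * q)
  monic-* p q mp mq with monic⇒lead p mp | monic⇒lead q mq
  ... | m , lp | n , lq = lead⇒monic (p * q) (m ℕ.+ n) (lead-* lp lq)

  *-zeroʳ : ∀ p → p * 0ᴾ ≡ 0ᴾ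
  *-zeroʳ p = *-comm p 0ᴾ

  monic-cancelˡ : ∀ p q → Monic p → Monic (p * q) → Monic q
  monic-cancelˡ p q mp mpq with monic⇒lead p mp | monic⇒lead (p * q) mpq
  ... | m , lp | k , lpq with leading q (λ { refl → monic≢0 mpq (*-zeroʳ p) })
  ... | n , d , lq = lead⇒monic q n (subst (Lead q n) d≡1 lq)
    where
    lpq′ = lead-* lp lq
    k≡ : k ≡ m ℕ.+ n
    k≡ = ℕ.suc-injective (trans (sym (Lead.size≡ lpq)) (Lead.size≡ lpq′))
    d≡1 : d ≡ 1₄
    d≡1 = trans (sym (Lead.top lpq′)) (trans (cong (coeff (p * q)) (sym k≡)) (Lead.top lpq))

  monic-+ : ∀ p q → Monic p → size q < size p → Monic (p + q)
  monic-+ p q mp lt with monic⇒lead p mp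
  ... | n , lead t _ v s = lead⇒monic (p + q) n (mkLead
    (trans (coeff-+ p q n) (cong₂ _⊕_ t (size-vanishes q n (ℕ.≤-pred (subst (size q <_) s lt)))))
    (λ ()) λ k le → trans (coeff-+ p q k)
      (cong₂ _⊕_ (v k le) (size-vanishes q k (ℕ.≤-trans (ℕ.<⇒≤ (subst (size q <_) s lt)) le))))

  monic-size1 : ∀ p → Monic p → size p ≡ 1 → p ≡ 1ᴾ
  monic-size1 (poly (c ∷ []) _) refl _ = refl

  const-lead : ∀ c → c ≢ 0₄ → Lead (const c) 0 c
  const-lead c c≢0 = mkLead (coeff-fromCoeffs (c ∷ []) 0) c≢0 λ { (suc k) _ → coeff-fromCoeffs (c ∷ []) (suc k) }

  const-* : ∀ b c → const b * const c ≡ const (b ⊗ c)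
  const-* b c = coeff-injective _ _ λ n → trans (coeff-const* b (const c) n) (eq n)
    where
    eq : ∀ n → b ⊗ coeff (const c) n ≡ coeff (const (b ⊗ c)) n
    eq zero    = trans (cong (b ⊗_) (coeff-fromCoeffs (c ∷ []) 0)) (sym (coeff-fromCoeffs (b ⊗ c ∷ []) 0))
    eq (suc n) = trans (cong (b ⊗_) (coeff-fromCoeffs (c ∷ []) (suc n)))
      (trans (⊗-zeroʳ b) (sym (coeff-fromCoeffs (b ⊗ c ∷ []) (suc n))))

  normalise : ∀ p → p ≢ 0ᴾ → ∃[ b ] ∃[ c ] ∃[ q ] c * b ≡ 1ᴾ × p ≡ b * q × Monic q
  normalise p p≢0 with leading p p≢0
  ... | n , c , lp with inverse c (Lead.nonzero lp)
  ... | d , dc≡1 = const c , const d , const d * p , trans (const-* d c) (cong const dc≡1) , eq ,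
      lead⇒monic _ n (subst (Lead (const d * p) n) dc≡1 (lead-* (const-lead d d≢0) lp))
    where
    d≢0 : d ≢ 0₄
    d≢0 refl = contradiction dc≡1 λ ()
    eq : p ≡ const c * (const d * p)
    eq = sym (trans (sym (*-assoc (const c) (const d) p))
      (trans (cong (_* p) (trans (const-* c d) (cong const (trans (⊗-comm c d) dc≡1)))) (*-identityˡ p)))

  tabulate : ℕ → Seq → List 𝔽₄
  tabulate zero    f = []
  tabulate (suc n) f = f 0 ∷ tabulate n (f ∘ suc)

  nth-tabulate : ∀ n f → Vanishes n f → nth (tabulate n f) ≈ f
  nth-tabulate zero    f v k       = sym (v k z≤n)
  nth-tabulate (suc n) f v zero    = refl
  nth-tabulate (suc n) f v (suc k) = nth-tabulate n (f ∘ suc) (λ k le → v (suc k) (s≤s le)) k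

  fromSeq : ℕ → Seq → Poly
  fromSeq n f = fromCoeffs (tabulate n f)

  coeff-fromSeq : ∀ n f → Vanishes n f → coeff (fromSeq n f) ≈ f
  coeff-fromSeq n f v k = trans (coeff-fromCoeffs (tabulate n f) k) (nth-tabulate n f v k)

  lists : ℕ → List (List 𝔽₄)
  lists zero    = [] ∷ []
  lists (suc n) = cartesianProductWith _∷_ elements (lists n)

  tabulate∈lists : ∀ n f → tabulate n f ∈ lists n
  tabulate∈lists zero    f = here refl
  tabulate∈lists (suc n) f = ∈-cartesianProductWith⁺ _∷_ (∈-elements (f 0)) (tabulate∈lists n (f ∘ suc))

  -- A finite list of candidates makes the search for a proper divisor decidable.
  below : ℕ → List Poly
  below n = map fromCoeffs (lists n)

  ∈-below : ∀ n p → size p ≤ n → p ∈ below n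
  ∈-below n p le = subst (_∈ below n)
    (sym (coeff-injective p _ λ k → sym (coeff-fromSeq n (coeff p) v k)))
    (∈-map⁺ fromCoeffs (tabulate∈lists n (coeff p)))
    where
    v : Vanishes n (coeff p)
    v k n≤k = size-vanishes p k (ℕ.≤-trans le n≤k)

  -- The formal derivative, by the rule (f₀ + x g)′ = g + x g′, in which no integer multiples
  -- appear.
  ∂ : Seq → Seq
  ∂ f zero    = f 1
  ∂ f (suc n) = f (suc (suc n)) ⊕ ∂ (f ∘ suc) n

  ∂-cong : ∀ {f g} → f ≈ g → ∂ f ≈ ∂ g
  ∂-cong e zero    = e 1
  ∂-cong e (suc n) = cong₂ _⊕_ (e (suc (suc n))) (∂-cong (e ∘ suc) n)

  ∂-+ : ∀ f g → ∂ (λ n → f n ⊕ g n) ≈ (λ n → ∂ f n ⊕ ∂ g n)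
  ∂-+ f g zero    = refl
  ∂-+ f g (suc n) = trans (cong (f (suc (suc n)) ⊕ g (suc (suc n)) ⊕_) (∂-+ (f ∘ suc) (g ∘ suc) n))
    (solve 4 (λ a b c d → (a :+ b) :+ (c :+ d) := (a :+ c) :+ (b :+ d)) refl
      (f (suc (suc n))) (g (suc (suc n))) (∂ (f ∘ suc) n) (∂ (g ∘ suc) n))
    where open S₄

  ∂-scale : ∀ c f → ∂ (λ n → c ⊗ f n) ≈ (λ n → c ⊗ ∂ f n)
  ∂-scale c f zero    = refl
  ∂-scale c f (suc n) = trans (cong (c ⊗ f (suc (suc n)) ⊕_) (∂-scale c (f ∘ suc) n)) (sym (⊗-distribˡ c _ _))

  ∂-conv : ∀ f g → ∂ (conv f g) ≈ (λ n → conv (∂ f) g n ⊕ conv f (∂ g) n)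
  ∂-conv f g zero    = ⊕-comm (f 0 ⊗ g 1) _
  ∂-conv f g (suc n) = begin
    (f 0 ⊗ g (2 ℕ.+ n) ⊕ conv f′ g (suc n)) ⊕ ∂ (λ m → f 0 ⊗ g′ m ⊕ conv f′ g m) n
      ≡⟨ cong ((f 0 ⊗ g (2 ℕ.+ n) ⊕ conv f′ g (suc n)) ⊕_)
           (trans (∂-+ (λ m → f 0 ⊗ g′ m) (conv f′ g) n)
                  (cong₂ _⊕_ (∂-scale (f 0) g′ n) (∂-conv f′ g n))) ⟩
    (f 0 ⊗ g (2 ℕ.+ n) ⊕ (f 1 ⊗ g (suc n) ⊕ conv (f′ ∘ suc) g n)) ⊕ (f 0 ⊗ ∂ g′ n ⊕ (conv (∂ f′) g n ⊕ conv f′ (∂ g) n))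
      ≡⟨ solve 8 (λ f₀ g₂ f₁ g₁ a b c d →
           (f₀ :* g₂ :+ (f₁ :* g₁ :+ a)) :+ (f₀ :* b :+ (c :+ d)) :=
           (f₁ :* g₁ :+ (a :+ c)) :+ (f₀ :* (g₂ :+ b) :+ d)) refl
           (f 0) (g (2 ℕ.+ n)) (f 1) (g (suc n)) (conv (f′ ∘ suc) g n) (∂ g′ n) (conv (∂ f′) g n) (conv f′ (∂ g) n) ⟩
    (f 1 ⊗ g (suc n) ⊕ (conv (f′ ∘ suc) g n ⊕ conv (∂ f′) g n)) ⊕ (f 0 ⊗ (g (2 ℕ.+ n) ⊕ ∂ g′ n) ⊕ conv f′ (∂ g) n)
      ≡⟨ cong (λ z → (f 1 ⊗ g (suc n) ⊕ z) ⊕ conv f (∂ g) (suc n)) (conv-distribʳ (f′ ∘ suc) (∂ f′) g n) ⟨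
    conv (∂ f) g (suc n) ⊕ conv f (∂ g) (suc n) ∎
    where
    open S₄
    f′ = f ∘ suc
    g′ = g ∘ suc

  ∂-vanishes : ∀ n f → Vanishes (suc n) f → Vanishes n (∂ f)
  ∂-vanishes n f v zero    le = v 1 (s≤s le)
  ∂-vanishes zero f v (suc k) le rewrite v (suc (suc k)) (s≤s z≤n) =
    ∂-vanishes zero (f ∘ suc) (λ k le → v (suc k) (ℕ.m≤n⇒m≤1+n le)) k z≤n
  ∂-vanishes (suc n) f v (suc k) (s≤s le) rewrite v (suc (suc k)) (s≤s (s≤s le)) =
    ∂-vanishes n (f ∘ suc) (λ k le → v (suc k) (s≤s le)) k le

  D : Poly → Poly
  D p = fromSeq (size p) (∂ (coeff p))

  coeff-D : ∀ p → coeff (D p) ≈ ∂ (coeff p)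
  coeff-D p = coeff-fromSeq (size p) (∂ (coeff p))
    (∂-vanishes (size p) (coeff p) λ k le → size-vanishes p k (ℕ.<⇒≤ le))

  size-D : ∀ p → p ≢ 0ᴾ → size (D p) < size p
  size-D p p≢0 with leading p p≢0
  ... | n , c , lead _ _ v s = subst (size (D p) <_) (sym s) (s≤s (vanishes⇒size≤ n (D p) λ k le →
    trans (coeff-D p k) (∂-vanishes n (coeff p) v k le)))

  D-+ : ∀ p q → D (p + q) ≡ D p + D q
  D-+ p q = coeff-injective _ _ λ n → begin
    coeff (D (p + q)) n  ≡⟨ coeff-D (p + q) n ⟩
    ∂ (coeff (p + q)) n  ≡⟨ ∂-cong (coeff-+ p q) n ⟩
    ∂ (λ m → coeff p m ⊕ coeff q m) n ≡⟨ ∂-+ (coeff p) (coeff q) n ⟩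
    ∂ (coeff p) n ⊕ ∂ (coeff q) n  ≡⟨ cong₂ _⊕_ (coeff-D p n) (coeff-D q n) ⟨
    coeff (D p) n ⊕ coeff (D q) n  ≡⟨ coeff-+ (D p) (D q) n ⟨
    coeff (D p + D q) n               ∎

  D-* : ∀ p q → D (p * q) ≡ D p * q + p * D q
  D-* p q = coeff-injective _ _ λ n → begin
    coeff (D (p * q)) n  ≡⟨ coeff-D (p * q) n ⟩
    ∂ (coeff (p * q)) n  ≡⟨ ∂-cong (coeff-* p q) n ⟩
    ∂ (conv (coeff p) (coeff q)) n  ≡⟨ ∂-conv (coeff p) (coeff q) n ⟩
    conv (∂ (coeff p)) (coeff q) n ⊕ conv (coeff p) (∂ (coeff q)) n
      ≡⟨ cong₂ _⊕_ (conv-cong {g = coeff q} (coeff-D p) (λ _ → refl) n) (conv-cong {f = coeff p} (λ _ → refl) (coeff-D q) n) ⟨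
    conv (coeff (D p)) (coeff q) n ⊕ conv (coeff p) (coeff (D q)) n  ≡⟨ cong₂ _⊕_ (coeff-* (D p) q n) (coeff-* p (D q) n) ⟨
    coeff (D p * q) n ⊕ coeff (p * D q) n  ≡⟨ coeff-+ (D p * q) (p * D q) n ⟨
    coeff (D p * q + p * D q) n                                             ∎

  -- Coefficient `n` is the square of coefficient `2n` of `f`: squaring is an involution of 𝔽₄, so
  -- this is its square root.
  √ : Seq → Seq
  √ f zero    = f 0 ⊗ f 0
  √ f (suc n) = √ (f ∘ suc ∘ suc) n

  ⊗-frobenius² : ∀ a → (a ⊗ a) ⊗ (a ⊗ a) ≡ a
  ⊗-frobenius² = from-yes (∀? λ a → ((a ⊗ a) ⊗ (a ⊗ a)) ≟₄ a)

  ∂-suc-suc : ∀ f n → ∂ f (suc (suc n)) ≡ ∂ (f ∘ suc ∘ suc) n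
  ∂-suc-suc f n = solve 2 (λ a b → a :+ (a :+ b) := b) refl (f (3 ℕ.+ n)) (∂ (f ∘ suc ∘ suc) n)
    where open S₄

  -- A zero derivative means that the odd coefficients vanish. In the square, cross terms cancel in
  -- pairs and only squares of coefficients remain, at the even places.
  √-square : ∀ f → ∂ f ≈ (λ _ → 0₄) → conv (√ f) (√ f) ≈ f
  √-square f z zero          = ⊗-frobenius² (f 0)
  √-square f z (suc zero)    = trans
    (solve 2 (λ a b → a :* b :+ b :* a := con 0₄) refl (√ f 0) (√ f 1)) (sym (z 0))
    where open S₄
  √-square f z (suc (suc n)) = begin
    a ⊗ √ f (2 ℕ.+ n) ⊕ conv (√ f ∘ suc) (√ f) (suc n)
      ≡⟨ cong (a ⊗ √ f (2 ℕ.+ n) ⊕_) (conv-sucʳ (√ f ∘ suc) (√ f) n) ⟩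
    a ⊗ √ f (2 ℕ.+ n) ⊕ (conv (√ f ∘ suc) (√ f ∘ suc) n ⊕ √ f (2 ℕ.+ n) ⊗ a)
      ≡⟨ solve 3 (λ a b c → a :* b :+ (c :+ b :* a) := c) refl a (√ f (2 ℕ.+ n)) _ ⟩
    conv (√ (f ∘ suc ∘ suc)) (√ (f ∘ suc ∘ suc)) n
      ≡⟨ √-square (f ∘ suc ∘ suc) (λ k → trans (sym (∂-suc-suc f k)) (z (suc (suc k)))) n ⟩
    f (suc (suc n)) ∎
    where
    open S₄
    a = √ f 0

  √-vanishes : ∀ n f → Vanishes n f → Vanishes n (√ f)
  √-vanishes n f v zero le rewrite v 0 le = refl
  √-vanishes n f v (suc k) le = √-vanishes (ℕ.pred n) (f ∘ suc ∘ suc)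
    (λ j le′ → v (suc (suc j)) (shift n j le′)) k (ℕ.pred-mono-≤ le)
    where
    shift : ∀ n j → ℕ.pred n ≤ j → n ≤ suc (suc j)
    shift zero    j _  = z≤n
    shift (suc n) j le = s≤s (ℕ.m≤n⇒m≤1+n le)

  D≡0⇒square : ∀ p → D p ≡ 0ᴾ → ∃[ q ] p ≡ q * q
  D≡0⇒square p Dp≡0 = q , coeff-injective _ _ λ n → sym (begin
    coeff (q * q) n  ≡⟨ coeff-* q q n ⟩
    conv (coeff q) (coeff q) n  ≡⟨ conv-cong coeff-q coeff-q n ⟩
    conv (√ (coeff p)) (√ (coeff p)) n  ≡⟨ √-square (coeff p) (λ k → trans (sym (coeff-D p k)) (cong (λ r → coeff r k) Dp≡0)) n ⟩
    coeff p n                                 ∎)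
    where
    q = fromSeq (size p) (√ (coeff p))
    coeff-q : coeff q ≈ √ (coeff p)
    coeff-q = coeff-fromSeq (size p) _ (√-vanishes (size p) (coeff p) (size-vanishes p))

  const-α² : const α * const α ≡ const α + 1ᴾ
  const-α² = refl

  module P = CharTwo Poly-isCommutativeRing (const α) const-α²

  coeff-shift-zero : ∀ c p → coeff (const c + X * p) 0 ≡ c
  coeff-shift-zero c p = trans (coeff-+ (const c) (X * p) 0)
    (trans (cong₂ _⊕_ (coeff-fromCoeffs (c ∷ []) 0) (coeff-X*-zero p)) (⊕-identityʳ c))

  coeff-shift-suc : ∀ c p n → coeff (const c + X * p) (suc n) ≡ coeff p n
  coeff-shift-suc c p n = trans (coeff-+ (const c) (X * p) (suc n))
    (cong₂ _⊕_ (coeff-fromCoeffs (c ∷ []) (suc n)) (coeff-X*-suc p n))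

  fromCoeffs-∷ : ∀ c cs → fromCoeffs (c ∷ cs) ≡ const c + X * fromCoeffs cs
  fromCoeffs-∷ c cs = coeff-injective _ _ eq
    where
    eq : coeff (fromCoeffs (c ∷ cs)) ≈ coeff (const c + X * fromCoeffs cs)
    eq zero    = trans (coeff-fromCoeffs (c ∷ cs) 0) (sym (coeff-shift-zero c (fromCoeffs cs)))
    eq (suc n) = trans (coeff-fromCoeffs (c ∷ cs) (suc n))
      (trans (sym (coeff-fromCoeffs cs n)) (sym (coeff-shift-suc c (fromCoeffs cs) n)))

  private
    -- Horner's scheme, with `n` the degree of `q`: the remainder of the tail has degree below `n`,
    -- so after multiplication by `X` and addition of `c` one multiple of `q` restores this.
    divMod-list : ∀ cs q n d → Lead q n d →
      ∃[ s ] ∃[ r ] fromCoeffs cs ≡ s * q + r × Vanishes n (coeff r)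
    divMod-list []       q n d _  = 0ᴾ , 0ᴾ , refl , λ _ _ → refl
    divMod-list (c ∷ cs) q n d lq with divMod-list cs q n d lq
    ... | s , r , eq , v with inverse d (Lead.nonzero lq)
    ... | e , ed≡1 = X * s + const l , (const c + X * r) + const l * q ,
      trans (fromCoeffs-∷ c cs) (trans (cong (λ z → const c + X * z) eq) rearrange) , v′
      where
      r₁ = const c + X * r
      -- `e` inverts the leading coefficient of `q`, so adding `const l * q` clears coefficient `n`.
      l = coeff r₁ n ⊗ e
      rearrange : const c + X * (s * q + r) ≡ (X * s + const l) * q + (r₁ + const l * q)
      rearrange = solve 6 (λ c x s q r l →
        c :+ x :* (s :* q :+ r) := (x :* s :+ l) :* q :+ ((c :+ x :* r) :+ l :* q)) refl
        (const c) X s q r (const l)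
        where open P
      v₁ : Vanishes (suc n) (coeff r₁)
      v₁ (suc k) (s≤s le) = trans (coeff-shift-suc c r k) (v k le)
      v′ : Vanishes n (coeff (r₁ + const l * q))
      v′ k le with n ℕ.≟ k
      ... | yes refl = begin
        coeff (r₁ + const l * q) n  ≡⟨ coeff-+ r₁ (const l * q) n ⟩
        coeff r₁ n ⊕ coeff (const l * q) n  ≡⟨ cong (coeff r₁ n ⊕_) (trans (coeff-const* l q n) (cong (l ⊗_) (Lead.top lq))) ⟩
        coeff r₁ n ⊕ (coeff r₁ n ⊗ e) ⊗ d  ≡⟨ cong (coeff r₁ n ⊕_) (trans (⊗-assoc (coeff r₁ n) e d) (cong (coeff r₁ n ⊗_) ed≡1)) ⟩
        coeff r₁ n ⊕ coeff r₁ n ⊗ 1₄  ≡⟨ cong (coeff r₁ n ⊕_) (⊗-identityʳ _) ⟩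
        coeff r₁ n ⊕ coeff r₁ n  ≡⟨ ⊕-self (coeff r₁ n) ⟩
        0₄                                      ∎
      ... | no n≢k = trans (coeff-+ r₁ (const l * q) k) (cong₂ _⊕_ (v₁ k lt)
        (trans (coeff-const* l q k) (trans (cong (l ⊗_) (Lead.above lq k lt)) (⊗-zeroʳ l))))
        where lt = ℕ.≤∧≢⇒< le n≢k

  divMod : ∀ p q → q ≢ 0ᴾ → ∃[ s ] ∃[ r ] p ≡ s * q + r × size r < size q
  divMod p q q≢0 with leading q q≢0
  ... | n , d , lq with divMod-list (coeffs p) q n d lq
  ... | s , r , eq , v = s , r ,
    trans (coeff-injective _ _ (sym ∘ coeff-fromCoeffs (coeffs p))) eq ,
    subst (size r <_) (sym (Lead.size≡ lq)) (s≤s (vanishes⇒size≤ n r v))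

  X+_ : 𝔽₄ → Poly
  X+ c = fromCoeffs (c ∷ 1₄ ∷ [])

  size-const : ∀ p → size p < 2 → ∃[ c ] p ≡ const c
  size-const p lt = coeff p 0 , coeff-injective _ _ eq
    where
    eq : coeff p ≈ coeff (const (coeff p 0))
    eq zero    = sym (coeff-fromCoeffs (coeff p 0 ∷ []) 0)
    eq (suc n) = trans (size-vanishes p (suc n) (ℕ.≤-trans (ℕ.≤-pred lt) (s≤s z≤n)))
      (sym (coeff-fromCoeffs (coeff p 0 ∷ []) (suc n)))

  monic-X+ : ∀ c → Monic (X+ c)
  monic-X+ 0₄  = refl
  monic-X+ 1₄  = refl
  monic-X+ α   = refl
  monic-X+ α+1 = refl

  size-X+ : ∀ c → size (X+ c) ≡ 2
  size-X+ 0₄  = refl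
  size-X+ 1₄  = refl
  size-X+ α   = refl
  size-X+ α+1 = refl

  X+-injective : ∀ {b c} → X+ b ≡ X+ c → b ≡ c
  X+-injective {b} {c} e = trans (sym (coeff-fromCoeffs (b ∷ 1₄ ∷ []) 0)) (trans (cong (λ p → coeff p 0) e) (coeff-fromCoeffs (c ∷ 1₄ ∷ []) 0))

  -- Division by `X + c` leaves a constant remainder, the value of `p` at the point `c`, which is
  -- one of four elements.
  root-shift : ∀ c p → ∃[ s ] (s * (X+ c) ≡ p ⊎ s * (X+ c) ≡ p + 1ᴾ ⊎ s * (X+ c) ≡ p + const α ⊎ s * (X+ c) ≡ p + (const α + 1ᴾ))
  root-shift c p with divMod p (X+ c) (monic≢0 (monic-X+ c))
  ... | s , r , eq , lt with size-const r (subst (size r <_) (size-X+ c) lt)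
  ... | e , refl = s , cases e shifted
    where
    open P
    shifted : s * (X+ c) ≡ p + const e
    shifted = trans (solve 2 (λ a b → a := (a :+ b) :+ b) refl (s * (X+ c)) (const e)) (cong (_+ const e) (sym eq))
    cases : ∀ e → s * (X+ c) ≡ p + const e →
      s * (X+ c) ≡ p ⊎ s * (X+ c) ≡ p + 1ᴾ ⊎ s * (X+ c) ≡ p + const α ⊎ s * (X+ c) ≡ p + (const α + 1ᴾ)
    cases 0₄  h = inj₁ (trans h (trans (+-comm p 0ᴾ) (+-identityˡ p)))
    cases 1₄  h = inj₂ (inj₁ h)
    cases α   h = inj₂ (inj₂ (inj₁ h))
    cases α+1 h = inj₂ (inj₂ (inj₂ h))

  𝔽₄[x] : PolynomialRing
  𝔽₄[x] = record
    { Carrier = Poly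
    ; _+_ = _+_
    ; _*_ = _*_
    ; 0# = 0ᴾ
    ; 1# = 1ᴾ
    ; ω = const α
    ; isCommutativeRing = Poly-isCommutativeRing
    ; ω² = const-α²
    ; size = size
    ; size-0 = refl
    ; size-1 = refl
    ; size≡0⇒≡0 = size≡0⇒≡0
    ; size-+ = size-+
    ; size-* = size-*
    ; divMod = divMod
    ; below = below
    ; ∈-below = ∈-below
    ; Monic = Monic
    ; monic-1 = monic-1
    ; monic≢0 = λ {p} → monic≢0 {p}
    ; monic-* = monic-*
    ; monic-+ = monic-+
    ; monic-cancelˡ = monic-cancelˡ
    ; monic-size1 = monic-size1
    ; normalise = normalise
    ; D = D
    ; D-+ = D-+
    ; D-* = D-*
    ; size-D = size-D
    ; D≡0⇒square = D≡0⇒square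
    ; linear = X+_
    ; monic-linear = monic-X+
    ; size-linear = size-X+
    ; linear-injective = X+-injective
    ; linear-1 = refl
    ; root-shift = root-shift
    }

-- Divisibility, prime factors and multiplicities.

module Primes (𝓟 : PolynomialRing) where

  open PolynomialRing 𝓟
  open CharTwo isCommutativeRing ω ω² public
  open CommutativeRing commutativeRing public
    using (+-identityˡ; +-identityʳ; zeroˡ; zeroʳ; *-identityˡ; *-identityʳ; +-assoc; +-comm
          ; *-assoc; *-comm; distribˡ; distribʳ; semiring; commutativeSemiring; *-commutativeSemigroup)
  open import Algebra.Properties.CommutativeSemiring.Exp commutativeSemiring public using (_^_; ^-homo-*; ^-assocʳ; ^-distrib-*)
  open import Algebra.Properties.Semiring.Divisibility semiring public using (_∣_; _∤_; _,_; _∣0) renaming (∣ʳ-refl to ∣-refl; ∣ʳ-trans to ∣-trans; x∣ʳy⇒x∣ʳzy to ∣-*ˡ; x∣ʳyx to ∣-factorʳ; xy≈z⇒y∣ʳz to factorʳ)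
  open import Algebra.Properties.CommutativeSemigroup.Divisibility *-commutativeSemigroup public using () renaming (x∣xy to ∣-factorˡ; xy≈z⇒x∣z to factorˡ; ∙-cong-∣ to *-cong-∣; x∣y⇒zx∣zy to *-monoʳ-∣)
  open import Algebra.Definitions.RawSemiring (Semiring.rawSemiring semiring) public using (Irreducible; mkIrred; Coprime)

  open ≡-Reasoning

  private
    variable
      p q x y z : Carrier

  +-self : ∀ x → x + x ≡ 0#
  +-self = CommutativeRing.-‿inverseʳ commutativeRing

  +-cancelʳ : ∀ x y → (x + y) + y ≡ x
  +-cancelʳ = solve 2 (λ x y → (x :+ y) :+ y := x) refl

  +≡0⇒≡ : ∀ x y → x + y ≡ 0# → x ≡ y
  +≡0⇒≡ x y e = trans (sym (+-cancelʳ x y)) (trans (cong (_+ y) e) (+-identityˡ y))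

  _≟0 : ∀ x → Dec (x ≡ 0#)
  x ≟0 = map′ (size≡0⇒≡0 x) (λ e → trans (cong size e) size-0) (size x ℕ.≟ 0)

  size>0 : x ≢ 0# → 1 ≤ size x
  size>0 {x} x≢0 = ℕ.n≢0⇒n>0 (x≢0 ∘ size≡0⇒≡0 x)

  size<1⇒≡0 : size x < 1 → x ≡ 0#
  size<1⇒≡0 {x} lt = size≡0⇒≡0 x (ℕ.n<1⇒n≡0 lt)

  1≢0 : 1# ≢ 0#
  1≢0 e = contradiction (trans (sym size-1) (trans (cong size e) size-0)) λ ()

  *-≢0 : x ≢ 0# → y ≢ 0# → x * y ≢ 0#
  *-≢0 {x} {y} x≢0 y≢0 e = contradiction
    (subst₂ _≤_ refl (trans (sym (size-* x y x≢0 y≢0)) (cong suc (trans (cong size e) size-0)))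
      (ℕ.+-mono-≤ (size>0 x≢0) (size>0 y≢0)))
    λ { (s≤s ()) }

  *-cancelˡ : ∀ x y z → x ≢ 0# → x * y ≡ x * z → y ≡ z
  *-cancelˡ x y z x≢0 e with (y + z) ≟0
  ... | yes y+z≡0 = +≡0⇒≡ y z y+z≡0
  ... | no  y+z≢0 = contradiction
    (trans (distribˡ x y z) (trans (cong (_+ x * z) e) (+-self (x * z))))
    (*-≢0 x≢0 y+z≢0)

  ^-≢0 : ∀ n → x ≢ 0# → x ^ n ≢ 0#
  ^-≢0 zero    x≢0 = 1≢0
  ^-≢0 (suc n) x≢0 = *-≢0 x≢0 (^-≢0 n x≢0)

  monic-^ : ∀ n → Monic x → Monic (x ^ n)
  monic-^ zero    mx = monic-1
  monic-^ (suc n) mx = monic-* _ _ mx (monic-^ n mx)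

  deg : Carrier → ℕ
  deg x = size x ∸ 1

  size≡ : x ≢ 0# → size x ≡ suc (deg x)
  size≡ x≢0 = sym (ℕ.m+[n∸m]≡n (size>0 x≢0))

  deg-* : ∀ x y → x ≢ 0# → y ≢ 0# → deg (x * y) ≡ deg x ℕ.+ deg y
  deg-* x y x≢0 y≢0 = ℕ.suc-injective (ℕ.suc-injective (begin
    suc (suc (deg (x * y)))  ≡⟨ cong suc (size≡ (*-≢0 x≢0 y≢0)) ⟨
    suc (size (x * y))  ≡⟨ size-* x y x≢0 y≢0 ⟩
    size x ℕ.+ size y  ≡⟨ cong₂ ℕ._+_ (size≡ x≢0) (size≡ y≢0) ⟩
    suc (deg x) ℕ.+ suc (deg y) ≡⟨ ℕ.+-suc (suc (deg x)) (deg y) ⟩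
    suc (suc (deg x ℕ.+ deg y)) ∎))

  deg-1 : deg 1# ≡ 0
  deg-1 = cong (_∸ 1) size-1

  deg-^ : ∀ x n → x ≢ 0# → deg (x ^ n) ≡ n ℕ.* deg x
  deg-^ x zero    x≢0 = deg-1
  deg-^ x (suc n) x≢0 = trans (deg-* x (x ^ n) x≢0 (^-≢0 n x≢0)) (cong (deg x ℕ.+_) (deg-^ x n x≢0))

  ∣-≢0 : x ∣ y → y ≢ 0# → x ≢ 0#
  ∣-≢0 (h , e) y≢0 refl = y≢0 (trans (sym e) (zeroʳ h))

  ∣-deg : x ∣ y → y ≢ 0# → deg x ≤ deg y
  ∣-deg {x} {y} d@(h , e) y≢0 = subst (deg x ≤_) (trans (sym (deg-* h x h≢0 (∣-≢0 d y≢0))) (cong deg e))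
    (ℕ.m≤n+m (deg x) (deg h))
    where
    h≢0 : h ≢ 0#
    h≢0 refl = y≢0 (trans (sym e) (zeroˡ x))

  deg≡0⇒∣1 : x ≢ 0# → deg x ≡ 0 → x ∣ 1#
  deg≡0⇒∣1 {x} x≢0 d≡0 with divMod 1# x x≢0
  ... | s , r , e , lt = s , trans (sym (+-identityʳ _)) (trans (cong (s * x +_) (sym r≡0)) (sym e))
    where
    r≡0 : r ≡ 0#
    r≡0 = size<1⇒≡0 (subst (size r <_) (trans (size≡ x≢0) (cong suc d≡0)) lt)

  ∣1⇒≢0 : x ∣ 1# → x ≢ 0#
  ∣1⇒≢0 d = ∣-≢0 d 1≢0

  ∣1⇒deg≡0 : x ∣ 1# → deg x ≡ 0
  ∣1⇒deg≡0 d = ℕ.n≤0⇒n≡0 (ℕ.≤-trans (∣-deg d 1≢0) (ℕ.≤-reflexive deg-1))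

  monic-∣1 : Monic x → x ∣ 1# → x ≡ 1#
  monic-∣1 {x} mx d = monic-size1 x mx (trans (size≡ (monic≢0 mx)) (cong suc (∣1⇒deg≡0 d)))

  monic-deg0 : Monic x → deg x ≡ 0 → x ≡ 1#
  monic-deg0 mx e = monic-∣1 mx (deg≡0⇒∣1 (monic≢0 mx) e)

  size-+ʳ : ∀ x y → size y < size x → size (x + y) ≡ size x
  size-+ʳ x y lt = ℕ.≤-antisym
    (ℕ.≤-trans (size-+ x y) (ℕ.≤-reflexive (ℕ.m≥n⇒m⊔n≡m (ℕ.<⇒≤ lt)))) lower
    where
    lower : size x ≤ size (x + y)
    lower with size (x + y) ℕ.<? size x
    ... | no ≮ = ℕ.≮⇒≥ ≮
    ... | yes lt′ = contradiction
      (ℕ.≤-<-trans (ℕ.≤-trans (ℕ.≤-reflexive (cong size (sym (+-cancelʳ x y)))) (size-+ (x + y) y))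
        (ℕ.⊔-pres-<m lt′ lt)) (ℕ.<-irrefl refl)

  deg<⇒size< : x ≢ 0# → deg y < deg x → size y < size x
  deg<⇒size< {x} {y} x≢0 lt = subst (size y <_) (sym (size≡ x≢0))
    (s≤s (ℕ.≤-trans (ℕ.m≤n+m∸n (size y) 1) lt))

  deg-+ʳ : ∀ x y → x ≢ 0# → deg y < deg x → deg (x + y) ≡ deg x
  deg-+ʳ x y x≢0 lt = cong (_∸ 1) (size-+ʳ x y (deg<⇒size< x≢0 lt))

  1<deg : 0 < deg x → deg 1# < deg x
  1<deg {x} = subst (_< deg x) (sym deg-1)

  monic-+1 : Monic x → 0 < deg x → Monic (x + 1#)
  monic-+1 {x} mx d = monic-+ x 1# mx (deg<⇒size< (monic≢0 mx) (1<deg d))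

  deg-+1 : Monic x → 0 < deg x → deg (x + 1#) ≡ deg x
  deg-+1 {x} mx d = deg-+ʳ x 1# (monic≢0 mx) (1<deg d)

  ∣-+ : x ∣ y → x ∣ z → x ∣ y + z
  ∣-+ {x} (h , e) (k , f) = h + k , trans (distribʳ x h k) (cong₂ _+_ e f)

  ∣-+⁻ˡ : x ∣ y + z → x ∣ y → x ∣ z
  ∣-+⁻ˡ {x} {y} {z} d e = subst (x ∣_) (solve 2 (λ y z → (y :+ z) :+ y := z) refl y z) (∣-+ d e)

  ∣-+⁻ʳ : x ∣ y + z → x ∣ z → x ∣ y
  ∣-+⁻ʳ {x} {y} {z} d e = subst (x ∣_) (+-cancelʳ y z) (∣-+ d e)

  ∣-*ʳ : ∀ z → x ∣ y → x ∣ y * z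
  ∣-*ʳ {x} {y} z d = subst (x ∣_) (*-comm z y) (∣-*ˡ z d)

  *-cancel-∣ : ∀ x → x ≢ 0# → x * y ∣ x * z → y ∣ z
  *-cancel-∣ {y} {z} x x≢0 (h , e) = h , *-cancelˡ x (h * y) z x≢0
    (trans (solve 3 (λ x h y → x :* (h :* y) := h :* (x :* y)) refl x h y) e)

  ∣-^ : ∀ n → x ∣ y → x ∣ y ^ suc n
  ∣-^ n d = ∣-*ʳ _ d

  _∣?_ : ∀ p q → p ≢ 0# → Dec (p ∣ q)
  (p ∣? q) p≢0 with divMod q p p≢0
  ... | s , r , e , lt with r ≟0
  ... | yes refl = yes (s , trans (sym (+-identityʳ _)) (sym e))
  ... | no r≢0 = no λ p∣q → contradiction
    (ℕ.≤-trans (ℕ.≤-trans (ℕ.≤-reflexive (size≡ p≢0))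
      (s≤s (∣-deg (∣-+⁻ˡ (subst (p ∣_) e p∣q) (∣-factorʳ p s)) r≢0))) (ℕ.≤-reflexive (sym (size≡ r≢0))))
    (ℕ.<⇒≱ lt)

  private
    bezout-acc : ∀ a b → Acc _<_ (size b) → ∃[ g ] ∃[ s ] ∃[ t ] g ≡ s * a + t * b × g ∣ a × g ∣ b
    bezout-acc a b (acc rec) with b ≟0
    ... | yes refl = a , 1# , 0# , solve 2 (λ a b → a := con 1₄ :* a :+ con 0₄ :* b) refl a b , ∣-refl , a ∣0
    ... | no b≢0 with divMod a b b≢0
    ... | s , r , e , lt with bezout-acc b r (rec lt)
    ... | g , u , v , eq , g∣b , g∣r = g , v , u + v * s , (begin
        g  ≡⟨ eq ⟩
        u * b + v * r  ≡⟨ solve 5 (λ u b v r s → u :* b :+ v :* r := v :* (s :* b :+ r) :+ (u :+ v :* s) :* b) refl u b v r s ⟩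
        v * (s * b + r) + (u + v * s) * b ≡⟨ cong (λ z → v * z + (u + v * s) * b) e ⟨
        v * a + (u + v * s) * b          ∎) ,
        subst (g ∣_) (sym e) (∣-+ (∣-*ˡ s g∣b) g∣r) , g∣b

  bezout : ∀ a b → ∃[ g ] ∃[ s ] ∃[ t ] g ≡ s * a + t * b × g ∣ a × g ∣ b
  bezout a b = bezout-acc a b (<-wellFounded (size b))

  -- Applied to `0 = 0 * 0`, irreducibility would make 0 a unit.
  irreducible≢0 : Irreducible p → p ≢ 0#
  irreducible≢0 {p} (mkIrred p∤1 split) p≡0 with split (trans p≡0 (sym (zeroˡ 0#)))
  ... | inj₁ d = p∤1 (subst (_∣ 1#) (sym p≡0) d)
  ... | inj₂ d = p∤1 (subst (_∣ 1#) (sym p≡0) d)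

  irreducible-deg : Irreducible p → 0 < deg p
  irreducible-deg ip = ℕ.n≢0⇒n>0 λ d≡0 → Irreducible.p∤1 ip (deg≡0⇒∣1 (irreducible≢0 ip) d≡0)

  -- The Bezout combination `g` divides `p`, so it is either associated to `p` or a unit; in the
  -- second case dividing by it gives 1.
  irreducible-∣ : Irreducible p → ∀ a → p ∣ a ⊎ ∃[ s ] ∃[ t ] s * p + t * a ≡ 1#
  irreducible-∣ {p} ip a with bezout p a
  ... | g , s , t , eq , (h , hg≡p) , g∣a with Irreducible.split-∣1 ip (sym hg≡p)
  ... | inj₁ (k , kh≡1) = inj₁ (∣-trans (k , trans (cong (k *_) (sym hg≡p))
          (trans (sym (*-assoc k h g)) (trans (cong (_* g) kh≡1) (*-identityˡ g)))) g∣a)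
  ... | inj₂ (k , kg≡1) = inj₂ (k * s , k * t , trans
          (solve 5 (λ k s p t a → k :* s :* p :+ k :* t :* a := k :* (s :* p :+ t :* a)) refl k s p t a)
          (trans (cong (k *_) (sym eq)) kg≡1))

  euclid : Irreducible p → ∀ a b → p ∣ a * b → p ∣ a ⊎ p ∣ b
  euclid {p} ip a b d with irreducible-∣ ip a
  ... | inj₁ p∣a = inj₁ p∣a
  ... | inj₂ (s , t , e) = inj₂ (subst (p ∣_) (trans
          (solve 5 (λ s p t a b → b :* s :* p :+ t :* (a :* b) := (s :* p :+ t :* a) :* b) refl s p t a b)
          (trans (cong (_* b) e) (*-identityˡ b)))
          (∣-+ (∣-factorʳ p (b * s)) (∣-*ˡ t d)))

  ∤-* : Irreducible p → ∀ a b → p ∤ a → p ∤ b → p ∤ a * b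
  ∤-* ip a b p∤a p∤b d with euclid ip a b d
  ... | inj₁ e = p∤a e
  ... | inj₂ e = p∤b e

  ∤-^ : Irreducible p → ∀ a n → p ∤ a → p ∤ a ^ n
  ∤-^ ip a zero    p∤a = Irreducible.p∤1 ip
  ∤-^ ip a (suc n) p∤a = ∤-* ip a _ p∤a (∤-^ ip a n p∤a)

  MonicIrreducible : Carrier → Set
  MonicIrreducible p = Monic p × Irreducible p

  ∣⇒≡ : MonicIrreducible p → MonicIrreducible q → p ∣ q → p ≡ q
  ∣⇒≡ {p} {q} (mp , ip) (mq , iq) (h , e) with Irreducible.split-∣1 iq (sym e)
  ... | inj₂ d = contradiction d (Irreducible.p∤1 ip)
  ... | inj₁ d = trans (sym (*-identityˡ p)) (trans (cong (_* p) (sym h≡1)) e)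
    where
    h≡1 : h ≡ 1#
    h≡1 = monic-∣1 (monic-cancelˡ p h mp (subst Monic (trans (sym e) (*-comm h p)) mq)) d

  ≢⇒∤ : MonicIrreducible p → MonicIrreducible q → p ≢ q → p ∤ q
  ≢⇒∤ ip iq p≢q = p≢q ∘ ∣⇒≡ ip iq

  irreducible-assoc : ∀ b c q → c * b ≡ 1# → Irreducible (b * q) → Irreducible q
  irreducible-assoc b c q cb≡1 (mkIrred ∤1 split) = mkIrred
    (λ { (h , e) → ∤1 (c * h , trans (solve 4 (λ c h b q → c :* h :* (b :* q) := (c :* b) :* (h :* q)) refl c h b q)
                         (trans (cong₂ _*_ cb≡1 e) (*-identityˡ 1#))) })
    λ {x} {y} e → case (split {b * x} {y} (trans (cong (b *_) e) (sym (*-assoc b x y))))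
    where
    case : ∀ {x y} → b * x ∣ 1# ⊎ y ∣ 1# → x ∣ 1# ⊎ y ∣ 1#
    case (inj₁ d) = inj₁ (∣-trans (∣-factorʳ _ b) d)
    case (inj₂ d) = inj₂ d

  private
    -- Search the finite list for a nonunit divisor of smaller degree and recurse on it; if there is
    -- none, `x` itself is irreducible.
    irreducibleFactor-acc : ∀ x → x ≢ 0# → x ∤ 1# → Acc _<_ (deg x) → ∃[ p ] Irreducible p × p ∣ x
    irreducibleFactor-acc x x≢0 x∤1 (acc rec)
      with any? (λ y → proper? y) (below (size x))
      where
      proper? : ∀ y → Dec (y ≢ 0# × y ∤ 1# × deg y < deg x × y ∣ x)
      proper? y with y ≟0
      ... | yes y≡0 = no λ (y≢0 , _) → y≢0 y≡0
      ... | no y≢0 with (y ∣? 1#) y≢0 | deg y ℕ.<? deg x | (y ∣? x) y≢0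
      ... | yes d | _      | _     = no λ (_ , y∤1 , _) → y∤1 d
      ... | no _  | no ≮   | _     = no λ (_ , _ , lt , _) → ≮ lt
      ... | no _  | yes _  | no ∤  = no λ (_ , _ , _ , d) → ∤ d
      ... | no ∤1 | yes lt | yes d = yes (y≢0 , ∤1 , lt , d)
    ... | yes found with find found
    ... | y , _ , y≢0 , y∤1 , lt , y∣x with irreducibleFactor-acc y y≢0 y∤1 (rec lt)
    ... | p , ip , p∣y = p , ip , ∣-trans p∣y y∣x
    irreducibleFactor-acc x x≢0 x∤1 (acc rec) | no none = x , mkIrred x∤1 split , ∣-refl
      where
      split : ∀ {y z} → x ≡ y * z → y ∣ 1# ⊎ z ∣ 1#
      split {y} {z} e with (y ∣? 1#) y≢0
        where
        y≢0 : y ≢ 0#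
        y≢0 refl = x≢0 (trans e (zeroˡ z))
      ... | yes y∣1 = inj₁ y∣1
      ... | no  y∤1 with (z ∣? 1#) z≢0
        where
        z≢0 : z ≢ 0#
        z≢0 refl = x≢0 (trans e (zeroʳ y))
      ... | yes z∣1 = inj₂ z∣1
      ... | no  z∤1 = contradiction (lose (∈-below (size x) y (ℕ.<⇒≤ (deg<⇒size< x≢0 lt)))
          (y≢0 , y∤1 , lt , factorˡ y z (sym e))) none
        where
        y≢0 : y ≢ 0#
        y≢0 refl = x≢0 (trans e (zeroˡ z))
        z≢0 : z ≢ 0#
        z≢0 refl = x≢0 (trans e (zeroʳ y))
        lt : deg y < deg x
        lt = subst (deg y <_) (trans (sym (deg-* y z y≢0 z≢0)) (cong deg (sym e)))
          (ℕ.m<m+n (deg y) (ℕ.n≢0⇒n>0 (z∤1 ∘ deg≡0⇒∣1 z≢0)))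

  abstract
    irreducibleFactor : ∀ x → x ≢ 0# → x ∤ 1# → ∃[ p ] MonicIrreducible p × p ∣ x
    irreducibleFactor x x≢0 x∤1 with irreducibleFactor-acc x x≢0 x∤1 (<-wellFounded (deg x))
    ... | p , ip , p∣x with normalise p (irreducible≢0 ip)
    ... | b , c , q , cb≡1 , refl , mq = q , (mq , irreducible-assoc b c q cb≡1 ip) , ∣-trans (∣-factorʳ q b) p∣x

  private
    extract-acc : Irreducible p → ∀ x → x ≢ 0# → Acc _<_ (deg x) → ∃[ k ] ∃[ y ] p ^ k * y ≡ x × p ∤ y
    extract-acc {p} ip x x≢0 (acc rec) with (p ∣? x) (irreducible≢0 ip)
    ... | no p∤x = 0 , x , *-identityˡ x , p∤x
    ... | yes (h , e) with extract-acc ip h h≢0 (rec lt)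
      where
      h≢0 : h ≢ 0#
      h≢0 refl = x≢0 (trans (sym e) (zeroˡ p))
      lt : deg h < deg x
      lt = subst (deg h <_) (trans (sym (deg-* h p h≢0 (irreducible≢0 ip))) (cong deg e))
        (ℕ.m<m+n (deg h) (irreducible-deg ip))
    ... | k , y , eq , p∤y = suc k , y ,
      trans (solve 3 (λ p q y → p :* q :* y := (q :* y) :* p) refl p (p ^ k) y) (trans (cong (_* p) eq) e) , p∤y

  abstract
    extract : Irreducible p → ∀ x → x ≢ 0# → ∃[ k ] ∃[ y ] p ^ k * y ≡ x × p ∤ y
    extract ip x x≢0 = extract-acc ip x x≢0 (<-wellFounded (deg x))

  exponent-unique : Irreducible p → ∀ m n x y → p ∤ x → p ∤ y → p ^ m * x ≡ p ^ n * y → m ≡ n × x ≡ y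
  exponent-unique ip zero zero x y _ _ e = refl , trans (sym (*-identityˡ x)) (trans e (*-identityˡ y))
  exponent-unique {p} ip zero (suc n) x y p∤x _ e = contradiction
    (p ^ n * y , trans (solve 3 (λ p q y → q :* y :* p := p :* q :* y) refl p (p ^ n) y) (trans (sym e) (*-identityˡ x))) p∤x
  exponent-unique {p} ip (suc m) zero x y _ p∤y e = contradiction
    (p ^ m * x , trans (solve 3 (λ p q y → q :* y :* p := p :* q :* y) refl p (p ^ m) x) (trans e (*-identityˡ y))) p∤y
  exponent-unique {p} ip (suc m) (suc n) x y p∤x p∤y e
    with exponent-unique ip m n x y p∤x p∤y
      (*-cancelˡ p _ _ (irreducible≢0 ip) (trans (sym (*-assoc p _ x)) (trans e (*-assoc p _ y))))
  ... | m≡n , x≡y = cong suc m≡n , x≡y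

  -- By Euclid each factor `p` divides the cofactor and can be cancelled there. Used repeatedly,
  -- this reduces a divisor of `A` to the few primes it may contain.
  strip : Irreducible p → ∀ z n x → p ∤ z → z ∣ p ^ n * x → z ∣ x
  strip {p} ip z zero x p∤z d = subst (z ∣_) (*-identityˡ x) d
  strip {p} ip z (suc n) x p∤z (h , e) with euclid ip h z (p ^ n * x , trans (*-comm (p ^ n * x) p) (trans (sym (*-assoc p (p ^ n) x)) (sym e)))
  ... | inj₂ p∣z = contradiction p∣z p∤z
  ... | inj₁ (k , kp≡h) = strip ip z n x p∤z (k , *-cancelˡ p _ _ (irreducible≢0 ip)
    (trans (solve 3 (λ p k z → p :* (k :* z) := (k :* p) :* z) refl p k z)
      (trans (cong (_* z) kp≡h) (trans e (*-assoc p (p ^ n) x)))))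

  ∣-^* : MonicIrreducible p → ∀ w n x → w ∣ p ^ n * x →
    ∃[ i ] ∃[ v ] i ≤ n × w ≡ p ^ i * v × v ∣ x
  ∣-^* {p} pp w zero x d = 0 , w , z≤n , sym (*-identityˡ w) , subst (w ∣_) (*-identityˡ x) d
  ∣-^* {p} pp@(mp , ip) w (suc n) x d = cases ((p ∣? w) (monic≢0 mp))
    where
    cases : Dec (p ∣ w) → ∃[ i ] ∃[ v ] i ≤ suc n × w ≡ p ^ i * v × v ∣ x
    cases (no p∤w) = 0 , w , z≤n , sym (*-identityˡ w) , strip ip w (suc n) x p∤w d
    cases (yes (h , hp≡w)) = let
        i , v , i≤n , e , v∣x = ∣-^* pp h n x (*-cancel-∣ p (monic≢0 mp)
          (subst₂ _∣_ (trans (sym hp≡w) (*-comm h p)) (*-assoc p (p ^ n) x) d))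
      in suc i , v , s≤s i≤n ,
         trans (sym hp≡w) (trans (*-comm h p) (trans (cong (p *_) e) (sym (*-assoc p (p ^ i) v)))) , v∣x

  ∣-deg≥⇒≡ : ∀ x y → Monic x → Monic y → y ∣ x → deg x ≤ deg y → y ≡ x
  ∣-deg≥⇒≡ x y mx my (h , e) le = trans (sym (*-identityˡ y)) (trans (cong (_* y) (sym h≡1)) e)
    where
    mh : Monic h
    mh = monic-cancelˡ y h my (subst Monic (trans (sym e) (*-comm h y)) mx)
    h≡1 : h ≡ 1#
    h≡1 = monic-deg0 mh (ℕ.n≤0⇒n≡0 (ℕ.+-cancelʳ-≤ (deg y) _ _
      (ℕ.≤-trans (ℕ.≤-reflexive (trans (sym (deg-* h y (monic≢0 mh) (monic≢0 my))) (cong deg e))) le)))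

-- Geometric sums and the value of σ** at a prime power.

module Geometric (𝓟 : PolynomialRing) where

  open PolynomialRing 𝓟
  open Primes 𝓟

  open ≡-Reasoning

  G : Carrier → ℕ → Carrier
  G x zero    = 0#
  G x (suc n) = 1# + x * G x n

  G-+ : ∀ x m n → G x (m ℕ.+ n) ≡ G x m + x ^ m * G x n
  G-+ x zero    n = solve 1 (λ g → g := con 0₄ :+ con 1₄ :* g) refl (G x n)
  G-+ x (suc m) n = trans (cong (λ z → 1# + x * z) (G-+ x m n))
    (solve 4 (λ x g y h → con 1₄ :+ x :* (g :+ y :* h) := (con 1₄ :+ x :* g) :+ x :* y :* h) refl x (G x m) (x ^ m) (G x n))

  G-telescope : ∀ x n → (x + 1#) * G x n ≡ x ^ n + 1#
  G-telescope x zero    = solve 1 (λ x → (x :+ con 1₄) :* con 0₄ := con 1₄ :+ con 1₄) refl x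
  G-telescope x (suc n) = begin
    (x + 1#) * (1# + x * G x n)  ≡⟨ solve 2 (λ x g → (x :+ con 1₄) :* (con 1₄ :+ x :* g) := (x :+ con 1₄) :+ x :* ((x :+ con 1₄) :* g)) refl x (G x n) ⟩
    (x + 1#) + x * ((x + 1#) * G x n)  ≡⟨ cong (λ z → (x + 1#) + x * z) (G-telescope x n) ⟩
    (x + 1#) + x * (x ^ n + 1#)  ≡⟨ solve 2 (λ x y → (x :+ con 1₄) :+ x :* (y :+ con 1₄) := x :* y :+ con 1₄) refl x (x ^ n) ⟩
    x ^ suc n + 1#                     ∎

  G-double : ∀ x n → G x (n ℕ.+ n) ≡ (x + 1#) * (G x n * G x n)
  G-double x n = begin
    G x (n ℕ.+ n)  ≡⟨ G-+ x n n ⟩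
    G x n + x ^ n * G x n  ≡⟨ solve 2 (λ g y → g :+ y :* g := (y :+ con 1₄) :* g) refl (G x n) (x ^ n) ⟩
    (x ^ n + 1#) * G x n  ≡⟨ cong (_* G x n) (G-telescope x n) ⟨
    (x + 1#) * G x n * G x n  ≡⟨ *-assoc _ _ _ ⟩
    (x + 1#) * (G x n * G x n)     ∎

  -- Two uses: a sum of odd length is 1 modulo `x` and modulo `x + 1`, hence prime to both; and the
  -- successor of such a sum is visible in factored form.
  G-odd : ∀ x n → G x (suc (n ℕ.+ n)) ≡ x * (x + 1#) * (G x n * G x n) + 1#
  G-odd x n = trans (cong (λ z → 1# + x * z) (G-double x n))
    (solve 2 (λ x g → con 1₄ :+ x :* ((x :+ con 1₄) :* (g :* g)) := x :* (x :+ con 1₄) :* (g :* g) :+ con 1₄) refl x (G x n))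

  G-∣ : ∀ x m n → G x n ∣ G x (m ℕ.* n)
  G-∣ x zero    n = G x n ∣0
  G-∣ x (suc m) n = subst (G x n ∣_) (sym (G-+ x n (m ℕ.* n))) (∣-+ ∣-refl (∣-*ˡ (x ^ n) (G-∣ x m n)))

  -- The numbers 2ˢ - 1, by a recursion that avoids truncated subtraction and matches the doubling
  -- step of `G-2^*`.
  mersenne : ℕ → ℕ
  mersenne zero    = 0
  mersenne (suc s) = suc (mersenne s ℕ.+ mersenne s)

  suc-mersenne : ∀ s → suc (mersenne s) ≡ 2 ℕ.^ s
  suc-mersenne zero    = refl
  suc-mersenne (suc s) = begin
    suc (suc (mersenne s ℕ.+ mersenne s)) ≡⟨ ℕ.+-suc (suc (mersenne s)) (mersenne s) ⟨
    suc (mersenne s) ℕ.+ suc (mersenne s) ≡⟨ cong₂ ℕ._+_ (suc-mersenne s) (trans (suc-mersenne s) (sym (ℕ.+-identityʳ _))) ⟩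
    2 ℕ.^ suc s                           ∎

  mersenne≡ : ∀ s → mersenne s ≡ 2 ℕ.^ s ∸ 1
  mersenne≡ s = cong (_∸ 1) (suc-mersenne s)

  2^suc*≡ : ∀ s u → 2 ℕ.^ suc s ℕ.* u ≡ 2 ℕ.^ s ℕ.* u ℕ.+ 2 ℕ.^ s ℕ.* u
  2^suc*≡ s u = trans (cong (λ z → (2 ℕ.^ s ℕ.+ z) ℕ.* u) (ℕ.+-identityʳ (2 ℕ.^ s))) (ℕ.*-distribʳ-+ u (2 ℕ.^ s) (2 ℕ.^ s))

  -- Each doubling of the length squares the sum and adds one factor `x + 1`.
  G-2^* : ∀ x s u → G x (2 ℕ.^ s ℕ.* u) ≡ (x + 1#) ^ mersenne s * G x u ^ (2 ℕ.^ s)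
  G-2^* x zero u = trans (cong (G x) (ℕ.+-identityʳ u))
    (solve 1 (λ g → g := con 1₄ :* (g :* con 1₄)) refl (G x u))
  G-2^* x (suc s) u = begin
    G x (2 ℕ.^ suc s ℕ.* u)  ≡⟨ cong (G x) (2^suc*≡ s u) ⟩
    G x (2 ℕ.^ s ℕ.* u ℕ.+ 2 ℕ.^ s ℕ.* u)  ≡⟨ G-double x (2 ℕ.^ s ℕ.* u) ⟩
    (x + 1#) * (G x (2 ℕ.^ s ℕ.* u) * G x (2 ℕ.^ s ℕ.* u))  ≡⟨ cong (λ z → (x + 1#) * (z * z)) (G-2^* x s u) ⟩
    (x + 1#) * ((a * b) * (a * b))  ≡⟨ solve 3 (λ q a b → q :* ((a :* b) :* (a :* b)) := q :* (a :* a) :* (b :* b)) refl (x + 1#) a b ⟩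
    (x + 1#) * (a * a) * (b * b)  ≡⟨ cong₂ (λ y z → (x + 1#) * y * z) (sym (^-homo-* (x + 1#) (mersenne s) (mersenne s)))
                                                        (trans (sym (^-homo-* (G x u) (2 ℕ.^ s) (2 ℕ.^ s))) (cong (λ k → G x u ^ (2 ℕ.^ s ℕ.+ k)) (sym (ℕ.+-identityʳ (2 ℕ.^ s))))) ⟩
    (x + 1#) ^ mersenne (suc s) * G x u ^ (2 ℕ.^ suc s) ∎
    where
    a = (x + 1#) ^ mersenne s
    b = G x u ^ (2 ℕ.^ s)

  G-1 : ∀ x → G x 1 ≡ 1#
  G-1 = solve 1 (λ x → con 1₄ :+ x :* con 0₄ := con 1₄) refl

  1^ : ∀ n → 1# ^ n ≡ 1#
  1^ zero    = refl
  1^ (suc n) = trans (*-identityˡ _) (1^ n)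

  G-2^ : ∀ x s → G x (2 ℕ.^ s) ≡ (x + 1#) ^ mersenne s
  G-2^ x s = begin
    G x (2 ℕ.^ s)  ≡⟨ cong (G x) (ℕ.*-identityʳ (2 ℕ.^ s)) ⟨
    G x (2 ℕ.^ s ℕ.* 1)  ≡⟨ G-2^* x s 1 ⟩
    (x + 1#) ^ mersenne s * G x 1 ^ (2 ℕ.^ s)  ≡⟨ cong ((x + 1#) ^ mersenne s *_) (trans (cong (_^ (2 ℕ.^ s)) (G-1 x)) (1^ (2 ℕ.^ s))) ⟩
    (x + 1#) ^ mersenne s * 1#  ≡⟨ *-identityʳ _ ⟩
    (x + 1#) ^ mersenne s                          ∎

  monic-deg-G : ∀ {x} → Monic x → 0 < deg x → ∀ n → Monic (G x (suc n)) × deg (G x (suc n)) ≡ n ℕ.* deg x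
  monic-deg-G {x} mx dx zero = subst Monic (sym (G-1 x)) monic-1 , trans (cong deg (G-1 x)) deg-1
  monic-deg-G {x} mx dx (suc n) with monic-deg-G mx dx n
  ... | mg , dg = subst Monic (+-comm _ 1#) (monic-+1 my 0<dy) ,
      trans (cong deg (+-comm 1# y)) (trans (deg-+1 my 0<dy) dy)
    where
    y = x * G x (suc n)
    my : Monic y
    my = monic-* _ _ mx mg
    dy : deg y ≡ deg x ℕ.+ n ℕ.* deg x
    dy = trans (deg-* _ _ (monic≢0 mx) (monic≢0 mg)) (cong (deg x ℕ.+_) dg)
    0<dy : 0 < deg y
    0<dy = subst (0 <_) (sym dy) (ℕ.≤-trans dx (ℕ.m≤m+n _ _))

  -- Zero is kept apart because σ** (X ^ 0) = 1 lacks the factor `X + 1`. For positive exponents the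
  -- indexing gives the sums in `σ**ᴴ` positive lengths.
  data Halved : ℕ → Set where
    zero : Halved 0
    odd  : ∀ m → Halved (suc (m ℕ.+ m))
    even : ∀ m → Halved (suc (suc (m ℕ.+ m)))

  half : ∀ n → Halved n
  half zero    = zero
  half (suc n) with half n
  ... | zero   = odd 0
  ... | odd m  = even m
  ... | even m = subst Halved (cong (suc ∘ suc) (ℕ.+-suc m m)) (odd (suc m))

  range : ℕ → ℕ → List ℕ
  range k zero    = []
  range k (suc n) = k ∷ range (suc k) n

  -- The exponents i of the bi-unitary divisors p ^ i of p ^ a: all i ≤ a
  -- except the middle one, at which p ^ i and its cofactor coincide.
  exponentsᴴ : ∀ {a} → Halved a → List ℕ
  exponentsᴴ zero     = range 0 1
  exponentsᴴ (odd m)  = range 0 (suc (suc (m ℕ.+ m)))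
  exponentsᴴ (even m) = range 0 (suc m) ++ range (suc (suc m)) (suc m)

  exponents : ℕ → List ℕ
  exponents a = exponentsᴴ (half a)

  ∈-range⁺ : ∀ k n {i} → k ≤ i → i < k ℕ.+ n → i ∈ range k n
  ∈-range⁺ k zero    k≤i i<k = contradiction (ℕ.≤-trans i<k (ℕ.≤-reflexive (ℕ.+-identityʳ k))) (ℕ.≤⇒≯ k≤i)
  ∈-range⁺ k (suc n) {i} k≤i i<  with k ℕ.≟ i
  ... | yes refl = here refl
  ... | no  k≢i  = there (∈-range⁺ (suc k) n (ℕ.≤∧≢⇒< k≤i k≢i) (subst (i <_) (ℕ.+-suc k n) i<))

  ∈-range⁻ : ∀ k n {i} → i ∈ range k n → k ≤ i × i < k ℕ.+ n
  ∈-range⁻ k (suc n) (here refl) = ℕ.≤-refl , ℕ.m<m+n k (s≤s z≤n)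
  ∈-range⁻ k (suc n) {i} (there i∈) with ∈-range⁻ (suc k) n i∈
  ... | k<i , i< = ℕ.<⇒≤ k<i , subst (i <_) (sym (ℕ.+-suc k n)) i<

  unique-range : ∀ k n → Unique (range k n)
  unique-range k zero    = []
  unique-range k (suc n) = All.tabulate (λ i∈ → ℕ.<⇒≢ (proj₁ (∈-range⁻ (suc k) n i∈))) ∷ unique-range (suc k) n

  unique-exponentsᴴ : ∀ {a} (h : Halved a) → Unique (exponentsᴴ h)
  unique-exponentsᴴ zero     = unique-range 0 1
  unique-exponentsᴴ (odd m)  = unique-range 0 _
  unique-exponentsᴴ (even m) = Unique.++⁺ (unique-range 0 _) (unique-range _ _)
    λ (i∈ , j∈) → contradiction (proj₂ (∈-range⁻ 0 (suc m) i∈)) (ℕ.≤⇒≯ (ℕ.<⇒≤ (proj₁ (∈-range⁻ (suc (suc m)) (suc m) j∈))))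

  n+n≢suc[m+m] : ∀ n m → n ℕ.+ n ≢ suc (m ℕ.+ m)
  n+n≢suc[m+m] (suc n) zero    e = contradiction (trans (sym (ℕ.+-suc n n)) (ℕ.suc-injective e)) λ ()
  n+n≢suc[m+m] (suc n) (suc m) e = n+n≢suc[m+m] n m (ℕ.suc-injective (begin
    suc (n ℕ.+ n)  ≡⟨ ℕ.+-suc n n ⟨
    n ℕ.+ suc n  ≡⟨ ℕ.suc-injective e ⟩
    suc (m ℕ.+ suc m)  ≡⟨ cong suc (ℕ.+-suc m m) ⟩
    suc (suc (m ℕ.+ m))  ∎))

  n+n-injective : ∀ m n → m ℕ.+ m ≡ n ℕ.+ n → m ≡ n
  n+n-injective zero    zero    _ = refl
  n+n-injective (suc m) (suc n) e = cong suc (n+n-injective m n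
    (ℕ.suc-injective (trans (sym (ℕ.+-suc m m)) (trans (ℕ.suc-injective e) (ℕ.+-suc n n)))))

  -- The condition on `i` and `j` encodes bi-unitarity: p ^ i and p ^ j share a nontrivial unitary
  -- divisor exactly when the exponents are equal and positive.
  ∈-exponentsᴴ⁺ : ∀ {a} (h : Halved a) i j → i ℕ.+ j ≡ a → (i ≡ j → i ≡ 0) → i ∈ exponentsᴴ h
  ∈-exponentsᴴ⁺ zero zero j e _ = here refl
  ∈-exponentsᴴ⁺ (odd m) i j e _ = ∈-range⁺ 0 _ z≤n (s≤s (subst (i ≤_) e (ℕ.m≤m+n i j)))
  ∈-exponentsᴴ⁺ (even m) i j e i≢j with i ℕ.≤? m
  ... | yes i≤m = ∈-++⁺ˡ (∈-range⁺ 0 _ z≤n (s≤s i≤m))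
  ... | no  i≰m = ∈-++⁺ʳ (range 0 (suc m)) (∈-range⁺ _ _ (ℕ.≤∧≢⇒< (ℕ.≰⇒> i≰m) i≢)
      (s≤s (ℕ.≤-trans (ℕ.m≤m+n i j) (ℕ.≤-reflexive (trans e (cong suc (sym (ℕ.+-suc m m))))))))
    where
    i≢ : suc m ≢ i
    i≢ refl = contradiction (i≢j (sym (ℕ.+-cancelˡ-≡ (suc m) j (suc m) (trans e (cong suc (sym (ℕ.+-suc m m))))))) λ ()

  ∈-exponentsᴴ⁻ : ∀ {a} (h : Halved a) i → i ∈ exponentsᴴ h → ∃[ j ] i ℕ.+ j ≡ a × (i ≡ j → i ≡ 0)
  ∈-exponentsᴴ⁻ zero i (here refl) = 0 , refl , λ _ → refl
  ∈-exponentsᴴ⁻ (odd m) i i∈ with ∈-range⁻ 0 _ i∈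
  ... | _ , s≤s i≤ = suc (m ℕ.+ m) ∸ i , ℕ.m+[n∸m]≡n i≤ , λ i≡j →
    contradiction (trans (cong (i ℕ.+_) i≡j) (ℕ.m+[n∸m]≡n i≤)) (n+n≢suc[m+m] i m)
  ∈-exponentsᴴ⁻ (even m) i i∈ with ∈-++⁻ (range 0 (suc m)) i∈
  ... | inj₁ i∈ˡ = 2m+2 ∸ i , ℕ.m+[n∸m]≡n i≤ , λ i≡j → contradiction
      (n+n-injective i (suc m) (trans (trans (cong (i ℕ.+_) i≡j) (ℕ.m+[n∸m]≡n i≤)) (cong suc (sym (ℕ.+-suc m m)))))
      (ℕ.<⇒≢ i<)
    where
    2m+2 = suc (suc (m ℕ.+ m))
    i< : i < suc m
    i< = proj₂ (∈-range⁻ 0 (suc m) i∈ˡ)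
    i≤ : i ≤ 2m+2
    i≤ = ℕ.≤-trans (ℕ.<⇒≤ i<) (s≤s (ℕ.m≤n⇒m≤1+n (ℕ.m≤m+n m m)))
  ... | inj₂ i∈ʳ = 2m+2 ∸ i , ℕ.m+[n∸m]≡n i≤ , λ i≡j → contradiction
      (n+n-injective i (suc m) (trans (trans (cong (i ℕ.+_) i≡j) (ℕ.m+[n∸m]≡n i≤)) (cong suc (sym (ℕ.+-suc m m)))))
      (≢-sym (ℕ.<⇒≢ (proj₁ bounds)))
    where
    2m+2 = suc (suc (m ℕ.+ m))
    bounds : suc (suc m) ≤ i × i < suc (suc m) ℕ.+ suc m
    bounds = ∈-range⁻ _ _ i∈ʳ
    i≤ : i ≤ 2m+2
    i≤ = ℕ.≤-trans (ℕ.≤-pred (proj₂ bounds)) (ℕ.≤-reflexive (cong suc (ℕ.+-suc m m)))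

  ∑ : List Carrier → Carrier
  ∑ = foldr _+_ 0#

  ∑-++ : ∀ xs ys → ∑ (xs ++ ys) ≡ ∑ xs + ∑ ys
  ∑-++ []       ys = sym (+-identityˡ _)
  ∑-++ (x ∷ xs) ys = trans (cong (x +_) (∑-++ xs ys)) (sym (+-assoc x _ _))

  ∑-powers-range : ∀ x k n → ∑ (map (x ^_) (range k n)) ≡ x ^ k * G x n
  ∑-powers-range x k zero    = sym (zeroʳ _)
  ∑-powers-range x k (suc n) = trans (cong (x ^ k +_) (∑-powers-range x (suc k) n))
    (solve 3 (λ x y g → y :+ x :* y :* g := y :* (con 1₄ :+ x :* g)) refl x (x ^ k) (G x n))

  -- σ** (x ^ a) for an irreducible x.
  σ**ᴴ : Carrier → ∀ {a} → Halved a → Carrier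
  σ**ᴴ x zero     = 1#
  σ**ᴴ x (odd m)  = (x + 1#) * (G x (suc m) * G x (suc m))
  σ**ᴴ x (even m) = (x + 1#) * (G x (suc (suc m)) * G x (suc m))

  σ** : Carrier → ℕ → Carrier
  σ** x a = σ**ᴴ x (half a)

  -- For a = 2m + 2 the omitted middle power leaves two blocks of m + 1 powers. The second is x ^ (m
  -- + 2) times the first, and 1 + x ^ (m + 2) telescopes.
  ∑-exponentsᴴ : ∀ x {a} (h : Halved a) → ∑ (map (x ^_) (exponentsᴴ h)) ≡ σ**ᴴ x h
  ∑-exponentsᴴ x zero     = +-identityʳ 1#
  ∑-exponentsᴴ x (odd m)  = begin
    ∑ (map (x ^_) (range 0 (suc (suc (m ℕ.+ m)))))  ≡⟨ ∑-powers-range x 0 (suc (suc (m ℕ.+ m))) ⟩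
    1# * G x (suc (suc (m ℕ.+ m)))  ≡⟨ *-identityˡ _ ⟩
    G x (suc (suc (m ℕ.+ m)))  ≡⟨ cong (λ k → G x (suc k)) (ℕ.+-suc m m) ⟨
    G x (suc m ℕ.+ suc m)  ≡⟨ G-double x (suc m) ⟩
    σ**ᴴ x (odd m)                                  ∎
  ∑-exponentsᴴ x (even m) = begin
    ∑ (map (x ^_) (range 0 (suc m) ++ range (2 ℕ.+ m) (suc m)))
      ≡⟨ cong ∑ (map-++ (x ^_) (range 0 (suc m)) (range (2 ℕ.+ m) (suc m))) ⟩
    ∑ (map (x ^_) (range 0 (suc m)) ++ map (x ^_) (range (2 ℕ.+ m) (suc m)))
      ≡⟨ ∑-++ (map (x ^_) (range 0 (suc m))) _ ⟩
    ∑ (map (x ^_) (range 0 (suc m))) + ∑ (map (x ^_) (range (2 ℕ.+ m) (suc m)))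
      ≡⟨ cong₂ _+_ (∑-powers-range x 0 (suc m)) (∑-powers-range x (2 ℕ.+ m) (suc m)) ⟩
    1# * g + y * g
      ≡⟨ solve 2 (λ g y → con 1₄ :* g :+ y :* g := (y :+ con 1₄) :* g) refl g y ⟩
    (y + 1#) * g
      ≡⟨ cong (_* g) (G-telescope x (2 ℕ.+ m)) ⟨
    (x + 1#) * G x (2 ℕ.+ m) * g
      ≡⟨ *-assoc _ _ _ ⟩
    σ**ᴴ x (even m) ∎
    where
    g = G x (suc m)
    y = x ^ (2 ℕ.+ m)

  ∑-exponents : ∀ x a → ∑ (map (x ^_) (exponents a)) ≡ σ** x a
  ∑-exponents x a = ∑-exponentsᴴ x (half a)

-- Bi-unitary divisors of a factored polynomial.

module BiUnitary (𝓟 : PolynomialRing) where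

  open PolynomialRing 𝓟
  open Primes 𝓟
  open Geometric 𝓟
  open import Data.List.Relation.Binary.Disjoint.Propositional using (Disjoint)

  open ≡-Reasoning

  Unitary : Carrier → Carrier → Set
  Unitary C A = Monic C × ∃[ E ] C * E ≡ A × Coprime C E

  -- Since 1 is a unitary divisor of everything, gcd_u (A, B) = 1 comes down to maximality: every
  -- common unitary divisor is constant.
  BiUnitary : Carrier → Carrier → Set
  BiUnitary A S = Monic A × ∃[ B ] A * B ≡ S × (∀ {C} → Unitary C A → Unitary C B → deg C ≤ 0)

  private
    variable
      p A B C S : Carrier

  biUnitary-1 : BiUnitary 1# 1#
  biUnitary-1 = monic-1 , 1# , *-identityˡ 1# , λ (mC , E , e , _) _ → ℕ.≤-reflexive (∣1⇒deg≡0 (factorˡ _ E e))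

  biUnitary-1⁻ : BiUnitary A 1# → A ≡ 1#
  biUnitary-1⁻ (mA , B , e , _) = monic-∣1 mA (factorˡ _ B e)

  module _ (pp : MonicIrreducible p) where
    private
      mp = proj₁ pp
      ip = proj₂ pp

    coprime-^* : p ∤ C → ∀ n → Coprime C A → Coprime C (p ^ n * A)
    coprime-^* p∤C n cop z∣C z∣pA = cop z∣C (strip ip _ n _ (λ p∣z → p∤C (∣-trans p∣z z∣C)) z∣pA)

    unitary-^* : p ∤ C → ∀ n → Unitary C A → Unitary C (p ^ n * A)
    unitary-^* {C} p∤C n (mC , E , e , cop) = mC , p ^ n * E ,
      trans (solve 3 (λ c q e → c :* (q :* e) := q :* (c :* e)) refl C (p ^ n) E) (cong (p ^ n *_) e) ,
      coprime-^* p∤C n cop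

    unitary-^*⁻ : p ∤ C → ∀ n → Unitary C (p ^ n * A) → Unitary C A
    unitary-^*⁻ {C} {A} p∤C n (mC , E , e , cop) with strip ip C n A p∤C (factorˡ C E e)
    ... | F , FC≡A = mC , F , trans (*-comm C F) FC≡A , λ z∣C z∣F → cop z∣C (subst (_ ∣_) (sym E≡) (∣-*ˡ (p ^ n) z∣F))
      where
      E≡ : E ≡ p ^ n * F
      E≡ = *-cancelˡ C E (p ^ n * F) (monic≢0 mC) (trans e (trans (cong (p ^ n *_) (sym FC≡A))
        (solve 3 (λ c q e → q :* (e :* c) := c :* (q :* e)) refl C (p ^ n) F)))

    unitary-p^ : p ∤ A → ∀ n → Unitary (p ^ n) (p ^ n * A)
    unitary-p^ {A} p∤A n = monic-^ n mp , A , refl , λ {z} z∣pⁿ z∣A →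
      strip ip z n 1# (λ p∣z → p∤A (∣-trans p∣z z∣A)) (subst (z ∣_) (sym (*-identityʳ _)) z∣pⁿ)

    -- If `p` divides a unitary divisor it cannot divide the cofactor as well, so the divisor takes
    -- the whole power of `p`.
    unitary-exponent : p ∤ A → ∀ n → Unitary C (p ^ n * A) → p ∣ C → ∃[ E ] p ^ n * E ≡ C × p ∤ E
    unitary-exponent {A} {C} p∤A n (mC , F , e , cop) p∣C with extract ip C (monic≢0 mC)
    ... | k , E , eq , p∤E with exponent-unique ip k n (E * F) A (∤-* ip E F p∤E p∤F) p∤A
            (trans (sym (*-assoc _ E F)) (trans (cong (_* F) eq) e))
      where
      p∤F : p ∤ F
      p∤F p∣F = Irreducible.p∤1 ip (cop p∣C p∣F)
    ... | refl , _ = E , eq , p∤E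

    -- A common unitary divisor containing `p` would contain `p` exactly `i` times and exactly `j`
    -- times, forcing i = j = 0. One prime to `p` is a common unitary divisor of `A` and `B`.
    biUnitary-^* : ∀ {i j} → p ∤ S → (i ≡ j → i ≡ 0) → BiUnitary A S → BiUnitary (p ^ i * A) (p ^ (i ℕ.+ j) * S)
    biUnitary-^* {S} {A} {i} {j} p∤S i≢j (mA , B , e , gcd) = monic-* _ _ (monic-^ i mp) mA , p ^ j * B ,
      trans (solve 4 (λ q a r b → q :* a :* (r :* b) := q :* r :* (a :* b)) refl (p ^ i) A (p ^ j) B)
        (cong₂ _*_ (sym (^-homo-* p i j)) e) , gcd′
      where
      p∤A : p ∤ A
      p∤A p∣A = p∤S (∣-trans p∣A (factorˡ A B e))
      p∤B : p ∤ B
      p∤B p∣B = p∤S (∣-trans p∣B (factorʳ A B e))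
      gcd′ : ∀ {C} → Unitary C (p ^ i * A) → Unitary C (p ^ j * B) → deg C ≤ 0
      gcd′ {C} uA uB with (p ∣? C) (monic≢0 mp)
      ... | no p∤C = gcd (unitary-^*⁻ p∤C i uA) (unitary-^*⁻ p∤C j uB)
      ... | yes p∣C with unitary-exponent p∤A i uA p∣C | unitary-exponent p∤B j uB p∣C
      ... | E , e₁ , p∤E | F , e₂ , p∤F with exponent-unique ip i j E F p∤E p∤F (trans e₁ (sym e₂))
      ... | i≡j , _ with i≢j i≡j
      ... | refl = contradiction (subst (p ∣_) (trans (sym e₁) (*-identityˡ E)) p∣C) p∤E

    -- For i = j > 0 the power p ^ i itself would be a common unitary divisor of positive degree.
    biUnitary-^*⁻ : ∀ {a} → p ∤ S → BiUnitary A (p ^ a * S) →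
      ∃[ i ] ∃[ j ] ∃[ A′ ] A ≡ p ^ i * A′ × i ℕ.+ j ≡ a × (i ≡ j → i ≡ 0) × BiUnitary A′ S
    biUnitary-^*⁻ {S} {A} {a} p∤S (mA , B , e , gcd) = let
        i , A′ , eA , p∤A′ = extract ip A (monic≢0 mA)
        j , B′ , eB , p∤B′ = extract ip B B≢0
        i+j≡a , e′ = exponent-unique ip (i ℕ.+ j) a (A′ * B′) S (∤-* ip A′ B′ p∤A′ p∤B′) p∤S
          (trans (cong (_* (A′ * B′)) (^-homo-* p i j))
            (trans (interchange (p ^ i) (p ^ j) A′ B′) (trans (cong₂ _*_ eA eB) e)))
      in i , j , A′ , sym eA , i+j≡a , i≢j i j A′ B′ eA eB p∤A′ p∤B′ ,
         monic-cancelˡ (p ^ i) A′ (monic-^ i mp) (subst Monic (sym eA) mA) , B′ , e′ , gcd′ i j A′ B′ eA eB p∤A′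
      where
      open import Algebra.Properties.CommutativeSemigroup *-commutativeSemigroup using (interchange)
      B≢0 : B ≢ 0#
      B≢0 refl = *-≢0 (^-≢0 a (monic≢0 mp)) (λ { refl → p∤S (p ∣0) }) (trans (sym e) (zeroʳ A))
      gcd′ : ∀ i j A′ B′ → p ^ i * A′ ≡ A → p ^ j * B′ ≡ B → p ∤ A′ → ∀ {C} → Unitary C A′ → Unitary C B′ → deg C ≤ 0
      gcd′ i j A′ B′ eA eB p∤A′ {C} uA@(_ , E , e , _) uB =
        gcd (subst (Unitary C) eA (unitary-^* p∤C i uA)) (subst (Unitary C) eB (unitary-^* p∤C j uB))
        where
        p∤C : p ∤ C
        p∤C p∣C = p∤A′ (∣-trans p∣C (factorˡ C E e))
      i≢j : ∀ i j A′ B′ → p ^ i * A′ ≡ A → p ^ j * B′ ≡ B → p ∤ A′ → p ∤ B′ → i ≡ j → i ≡ 0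
      i≢j zero    _ A′ B′ eA eB p∤A′ p∤B′ _    = refl
      i≢j (suc i) _ A′ B′ eA eB p∤A′ p∤B′ refl = contradiction
        (subst (_≤ 0) (deg-^ p (suc i) (monic≢0 mp))
          (gcd (subst (Unitary (p ^ suc i)) eA (unitary-p^ p∤A′ (suc i))) (subst (Unitary (p ^ suc i)) eB (unitary-p^ p∤B′ (suc i)))))
        (ℕ.<⇒≱ (ℕ.≤-trans (irreducible-deg ip) (ℕ.m≤m+n (deg p) (i ℕ.* deg p))))

  Factorization : Set
  Factorization = List (Carrier × ℕ)

  primes : Factorization → List Carrier
  primes = map proj₁

  ∏^ ∏σ** : Factorization → Carrier
  ∏^ []            = 1#
  ∏^ ((p , a) ∷ L) = p ^ a * ∏^ L
  ∏σ** []            = 1#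
  ∏σ** ((p , a) ∷ L) = σ** p a * ∏σ** L

  biUnitaryDivisors : Factorization → List Carrier
  biUnitaryDivisors []            = 1# ∷ []
  biUnitaryDivisors ((p , a) ∷ L) = concat (map (λ i → map (p ^ i *_) (biUnitaryDivisors L)) (exponents a))

  ∤-∏^ : MonicIrreducible p → ∀ L → All MonicIrreducible (primes L) → All (p ≢_) (primes L) → p ∤ ∏^ L
  ∤-∏^ pp []            []        []        = Irreducible.p∤1 (proj₂ pp)
  ∤-∏^ pp ((q , a) ∷ L) (qq ∷ qs) (p≢q ∷ ≢s) =
    ∤-* (proj₂ pp) _ _ (∤-^ (proj₂ pp) q a (≢⇒∤ pp qq p≢q)) (∤-∏^ pp L qs ≢s)

  ∈-products⁺ : ∀ p is xs {i A} → i ∈ is → A ∈ xs → p ^ i * A ∈ concat (map (λ i → map (p ^ i *_) xs) is)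
  ∈-products⁺ p is xs {i} i∈ A∈ = ∈-concat⁺′ (∈-map⁺ (p ^ i *_) A∈) (∈-map⁺ (λ i → map (p ^ i *_) xs) i∈)

  ∈-products⁻ : ∀ p is xs {B} → B ∈ concat (map (λ i → map (p ^ i *_) xs) is) →
    ∃[ i ] ∃[ A ] i ∈ is × A ∈ xs × B ≡ p ^ i * A
  ∈-products⁻ p is xs {B} B∈ with ∈-concat⁻′ (map (λ i → map (p ^ i *_) xs) is) B∈
  ... | ys , B∈′ , ∈ᵢ with ∈-map⁻ (λ i → map (p ^ i *_) xs) ∈ᵢ
  ... | i , i∈ , e with ∈-map⁻ (p ^ i *_) (subst (B ∈_) e B∈′)
  ... | A , A∈ , e′ = i , A , i∈ , A∈ , e′

  ∈-biUnitaryDivisors⁺ : ∀ L → All MonicIrreducible (primes L) → Unique (primes L) →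
    BiUnitary A (∏^ L) → A ∈ biUnitaryDivisors L
  ∈-biUnitaryDivisors⁺ []            _         _        u = here (biUnitary-1⁻ u)
  ∈-biUnitaryDivisors⁺ {A} ((p , a) ∷ L) (pp ∷ ps) (≢s ∷ us) u =
    let i , j , A′ , e , i+j≡a , i≢j , u′ = biUnitary-^*⁻ pp (∤-∏^ pp L ps ≢s) u in
    subst (_∈ biUnitaryDivisors ((p , a) ∷ L)) (sym e)
      (∈-products⁺ p (exponents a) (biUnitaryDivisors L)
        (∈-exponentsᴴ⁺ (half a) i j i+j≡a i≢j) (∈-biUnitaryDivisors⁺ L ps us u′))

  ∈-biUnitaryDivisors⁻ : ∀ L → All MonicIrreducible (primes L) → Unique (primes L) →
    A ∈ biUnitaryDivisors L → BiUnitary A (∏^ L)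
  ∈-biUnitaryDivisors⁻ []            _         _         (here refl) = biUnitary-1
  ∈-biUnitaryDivisors⁻ {A} ((p , a) ∷ L) (pp ∷ ps) (≢s ∷ us) A∈ =
    let i , A′ , i∈ , A′∈ , e = ∈-products⁻ p (exponents a) (biUnitaryDivisors L) A∈
        j , i+j≡a , i≢j = ∈-exponentsᴴ⁻ (half a) i i∈
    in subst₂ BiUnitary (sym e) (cong (λ k → p ^ k * ∏^ L) i+j≡a)
      (biUnitary-^* pp (∤-∏^ pp L ps ≢s) i≢j (∈-biUnitaryDivisors⁻ L ps us A′∈))

  unique-biUnitaryDivisors : ∀ L → All MonicIrreducible (primes L) → Unique (primes L) →
    Unique (biUnitaryDivisors L)
  unique-biUnitaryDivisors []            _         _         = [] ∷ []
  unique-biUnitaryDivisors ((p , a) ∷ L) (pp ∷ ps) (≢s ∷ us) = Unique.concat⁺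
    (All.map⁺ (All.universal
      (λ i → Unique.map⁺ (λ {x} {y} → *-cancelˡ (p ^ i) x y (^-≢0 i (monic≢0 (proj₁ pp)))) ih) (exponents a)))
    (AllPairs.map⁺ (AllPairs.map disjoint (unique-exponentsᴴ (half a))))
    where
    ih = unique-biUnitaryDivisors L ps us
    p∤ : ∀ {A} → A ∈ biUnitaryDivisors L → p ∤ A
    p∤ A∈ p∣A with ∈-biUnitaryDivisors⁻ L ps us A∈
    ... | _ , B , e , _ = ∤-∏^ pp L ps ≢s (∣-trans p∣A (factorˡ _ B e))
    disjoint : ∀ {i j} → i ≢ j → Disjoint (map (p ^ i *_) (biUnitaryDivisors L)) (map (p ^ j *_) (biUnitaryDivisors L))
    disjoint {i} {j} i≢j (x∈ , y∈) with ∈-map⁻ (p ^ i *_) x∈ | ∈-map⁻ (p ^ j *_) y∈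
    ... | A , A∈ , refl | B , B∈ , e = i≢j (proj₁ (exponent-unique (proj₂ pp) i j A B (p∤ A∈) (p∤ B∈) e))

  ∑-map-* : ∀ y xs → ∑ (map (y *_) xs) ≡ y * ∑ xs
  ∑-map-* y []       = sym (zeroʳ y)
  ∑-map-* y (x ∷ xs) = trans (cong (y * x +_) (∑-map-* y xs)) (sym (distribˡ y x _))

  ∑-products : ∀ p (is : List ℕ) xs →
    ∑ (concat (map (λ i → map (p ^ i *_) xs) is)) ≡ ∑ (map (p ^_) is) * ∑ xs
  ∑-products p []       xs = sym (zeroˡ _)
  ∑-products p (i ∷ is) xs = begin
    ∑ (map (p ^ i *_) xs ++ concat (map (λ i → map (p ^ i *_) xs) is))  ≡⟨ ∑-++ (map (p ^ i *_) xs) _ ⟩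
    ∑ (map (p ^ i *_) xs) + ∑ (concat (map (λ i → map (p ^ i *_) xs) is)) ≡⟨ cong₂ _+_ (∑-map-* (p ^ i) xs) (∑-products p is xs) ⟩
    p ^ i * ∑ xs + ∑ (map (p ^_) is) * ∑ xs  ≡⟨ distribʳ (∑ xs) (p ^ i) _ ⟨
    (p ^ i + ∑ (map (p ^_) is)) * ∑ xs                                  ∎

  -- Multiplicativity of σ**: a bi-unitary divisor is an independent choice of one power for each
  -- prime.
  ∑-biUnitaryDivisors : ∀ L → ∑ (biUnitaryDivisors L) ≡ ∏σ** L
  ∑-biUnitaryDivisors []            = +-identityʳ 1#
  ∑-biUnitaryDivisors ((p , a) ∷ L) = trans (∑-products p (exponents a) (biUnitaryDivisors L))
    (cong₂ _*_ (∑-exponents p a) (∑-biUnitaryDivisors L))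

-- Derivatives and bounds on multiplicities.

module Derivation (𝓟 : PolynomialRing) where

  open PolynomialRing 𝓟
  open Primes 𝓟
  open Geometric 𝓟
  open BiUnitary 𝓟

  private
    variable
      p q x y z : Carrier

  private
    factorize-acc : ∀ x → Monic x → Acc _<_ (deg x) → ∃[ L ]
      All MonicIrreducible (primes L) × Unique (primes L) × All (_∣ x) (primes L) × All ((0 <_) ∘ proj₂) L × ∏^ L ≡ x
    factorize-acc x mx (acc rec) with deg x ℕ.≟ 0
    ... | yes d≡0 = [] , [] , [] , [] , [] , sym (monic-deg0 mx d≡0)
    ... | no  d≢0 with irreducibleFactor x (monic≢0 mx) (λ x∣1 → d≢0 (∣1⇒deg≡0 x∣1))
    ... | p , pp@(mp , ip) , p∣x with extract ip x (monic≢0 mx)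
    ... | zero , y , e , p∤y = contradiction (subst (p ∣_) (trans (sym e) (*-identityˡ y)) p∣x) p∤y
    ... | suc k , y , e , p∤y =
      let my = monic-cancelˡ (p ^ suc k) y (monic-^ (suc k) mp) (subst Monic (sym e) mx)
          y∣x = factorʳ (p ^ suc k) y e
          dx = trans (cong deg (sym e)) (trans (deg-* (p ^ suc k) y (^-≢0 (suc k) (monic≢0 mp)) (monic≢0 my)) (cong (ℕ._+ deg y) (deg-^ p (suc k) (monic≢0 mp))))
          lt = subst (deg y <_) (sym dx) (ℕ.m<n+m (deg y) (ℕ.≤-trans (irreducible-deg ip) (ℕ.m≤m+n (deg p) (k ℕ.* deg p))))
          L , ps , us , ds , es , eL = factorize-acc y my (rec lt)
      in (p , suc k) ∷ L , pp ∷ ps , All.map (λ q∣y p≡q → p∤y (subst (_∣ y) (sym p≡q) q∣y)) ds ∷ us ,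
         p∣x ∷ All.map (λ q∣y → ∣-trans q∣y y∣x) ds , s≤s z≤n ∷ es , trans (cong (p ^ suc k *_) eL) e

  abstract
    factorize : ∀ x → Monic x → ∃[ L ]
      All MonicIrreducible (primes L) × Unique (primes L) × All (_∣ x) (primes L) × All ((0 <_) ∘ proj₂) L × ∏^ L ≡ x
    factorize x mx = factorize-acc x mx (<-wellFounded (deg x))

  D-1 : D 1# ≡ 0#
  D-1 = begin
    D 1#  ≡⟨ cong D (*-identityˡ 1#) ⟨
    D (1# * 1#)  ≡⟨ D-* 1# 1# ⟩
    D 1# * 1# + 1# * D 1#  ≡⟨ solve 1 (λ d → d :* con 1₄ :+ con 1₄ :* d := con 0₄) refl (D 1#) ⟩
    0#                          ∎
    where open ≡-Reasoning

  D-+1 : ∀ x → D (x + 1#) ≡ D x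
  D-+1 x = trans (D-+ x 1#) (trans (cong (D x +_) D-1) (+-identityʳ _))

  D-square : ∀ x → D (x * x) ≡ 0#
  D-square x = trans (D-* x x) (trans (cong (D x * x +_) (*-comm x (D x))) (+-self _))

  D-^-even : ∀ x m → D (x ^ (m ℕ.+ m)) ≡ 0#
  D-^-even x m = trans (cong D (^-homo-* x m m)) (D-square (x ^ m))

  D-^-odd : ∀ x m → D (x ^ suc (m ℕ.+ m)) ≡ x ^ (m ℕ.+ m) * D x
  D-^-odd x m = trans (D-* x (x ^ (m ℕ.+ m))) (trans (cong (λ z → D x * x ^ (m ℕ.+ m) + x * z) (D-^-even x m))
    (solve 3 (λ d y x → d :* y :+ x :* con 0₄ := y :* d) refl (D x) (x ^ (m ℕ.+ m)) x))

  ∣-D-^ : ∀ y e → y ^ e ∣ D (y ^ suc e)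
  ∣-D-^ y zero    = D (y ^ 1) , *-identityʳ _
  ∣-D-^ y (suc e) = subst (y ^ suc e ∣_) (sym (D-* y (y ^ suc e)))
    (∣-+ (∣-factorʳ (y ^ suc e) (D y)) (*-monoʳ-∣ y (∣-D-^ y e)))

  -- By the product rule, differentiation lowers the multiplicity of `y` by at most one.
  ∣-D : ∀ y e z → y ^ suc e ∣ z → y ^ e ∣ D z
  ∣-D y e z (h , hy≡z) = subst (y ^ e ∣_) (trans (sym (D-* h (y ^ suc e))) (cong D hy≡z))
    (∣-+ (∣-*ˡ (D h) (∣-factorʳ (y ^ e) y)) (∣-*ˡ h (∣-D-^ y e)))

  -- A polynomial with zero derivative is a square here, and an irreducible one is not.
  irreducible-D≢0 : Irreducible x → D x ≢ 0#
  irreducible-D≢0 {x} ix Dx≡0 with D≡0⇒square x Dx≡0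
  ... | q , x≡q² = Irreducible.p∤1 ix (subst₂ _∣_ (sym x≡q²) (*-identityˡ 1#) (*-cong-∣ q∣1 q∣1))
    where
    q∣1 : q ∣ 1#
    q∣1 with Irreducible.split-∣1 ix x≡q²
    ... | inj₁ d = d
    ... | inj₂ d = d

  deg-D : Irreducible x → deg (D x) < deg x
  deg-D {x} ix = ℕ.≤-pred (subst₂ _<_ (size≡ (irreducible-D≢0 ix)) (size≡ (irreducible≢0 ix)) (size-D x (irreducible≢0 ix)))

  -- `G x u` divides x ^ u + 1, whose derivative for odd `u` is x ^ (u - 1) x′; since y ≠ x, the
  -- power of `x` can be stripped.
  ∣-D-G : MonicIrreducible x → MonicIrreducible y → x ≢ y → ∀ k e →
    y ^ suc e ∣ G x (suc (k ℕ.+ k)) → y ^ e ∣ D x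
  ∣-D-G {x} {y} xx yy x≢y k e d = strip (proj₂ xx) (y ^ e) (k ℕ.+ k) (D x)
    (∤-^ (proj₂ xx) y e (≢⇒∤ xx yy x≢y))
    (subst (y ^ e ∣_) (trans (D-+1 (x ^ suc (k ℕ.+ k))) (D-^-odd x k))
      (∣-D y e _ (∣-trans d (factorʳ (x + 1#) _ (G-telescope x (suc (k ℕ.+ k)))))))

  -- A second factor `y` would divide x′, which is nonzero and of degree below deg x ≤ deg y.
  exponent≤1 : MonicIrreducible x → MonicIrreducible y → x ≢ y → deg x ≤ deg y → ∀ k e →
    y ^ e ∣ G x (suc (k ℕ.+ k)) → e ≤ 1
  exponent≤1 xx yy x≢y le k zero          d = z≤n
  exponent≤1 xx yy x≢y le k (suc zero)    d = s≤s z≤n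
  exponent≤1 {x} {y} xx yy x≢y le k (suc (suc e)) d = contradiction
    (ℕ.≤-trans le (ℕ.≤-trans (∣-deg (∣-trans (∣-factorˡ y (y ^ e)) (∣-D-G xx yy x≢y k (suc e) d)) (irreducible-D≢0 (proj₂ xx))) ℕ.≤-refl))
    (ℕ.<⇒≱ (deg-D (proj₂ xx)))

  ∣-coprime-powers : MonicIrreducible p → MonicIrreducible q → p ≢ q → ∀ m n z → p ^ m ∣ z → q ^ n ∣ z → p ^ m * q ^ n ∣ z
  ∣-coprime-powers {p} {q} pp qq p≢q m n z (h , hp≡z) q∣z =
    subst (p ^ m * q ^ n ∣_) (trans (*-comm (p ^ m) h) hp≡z)
      (*-monoʳ-∣ (p ^ m) (strip (proj₂ pp) (q ^ n) m h (∤-^ (proj₂ pp) q n (≢⇒∤ pp qq p≢q))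
        (subst (q ^ n ∣_) (trans (sym hp≡z) (*-comm h (p ^ m))) q∣z)))

  private
    ∣-D-G-pred : MonicIrreducible x → MonicIrreducible y → x ≢ y → ∀ k e →
      y ^ e ∣ G x (suc (k ℕ.+ k)) → y ^ (e ∸ 1) ∣ D x
    ∣-D-G-pred {x} xx yy x≢y k zero    d = D x , *-identityʳ _
    ∣-D-G-pred xx yy x≢y k (suc e) d = ∣-D-G xx yy x≢y k e d

    *≤pred*+ : ∀ e n → e ℕ.* n ≤ (e ∸ 1) ℕ.* n ℕ.+ n
    *≤pred*+ zero    n = z≤n
    *≤pred*+ (suc e) n = ℕ.≤-reflexive (ℕ.+-comm n (e ℕ.* n))

  -- Here deg x bounds the degree of D x, which the repeated factors divide.
  G≡*⇒k≤1 : MonicIrreducible x → MonicIrreducible y → MonicIrreducible z → x ≢ y → x ≢ z → y ≢ z →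
    deg y ≤ deg x → deg z ≤ deg x → ∀ k e f → G x (suc (k ℕ.+ k)) ≡ y ^ e * z ^ f → k ≤ 1
  G≡*⇒k≤1 {x} {y} {z} xx yy zz x≢y x≢z y≢z y≤x z≤x k e f eq = ℕ.≮⇒≥ λ 2≤k →
    contradiction (ℕ.≤-trans (ℕ.*-monoˡ-≤ (deg x) (ℕ.+-mono-≤ 2≤k 2≤k)) bound) (ℕ.<⇒≱ lt)
    where
    x≢0 = irreducible≢0 (proj₂ xx)
    y≢0 = irreducible≢0 (proj₂ yy)
    z≢0 = irreducible≢0 (proj₂ zz)
    r = deg (D x)
    repeated : (e ∸ 1) ℕ.* deg y ℕ.+ (f ∸ 1) ℕ.* deg z ≤ r
    repeated = subst (_≤ r)
      (trans (deg-* _ _ (^-≢0 (e ∸ 1) y≢0) (^-≢0 (f ∸ 1) z≢0)) (cong₂ ℕ._+_ (deg-^ y (e ∸ 1) y≢0) (deg-^ z (f ∸ 1) z≢0)))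
      (∣-deg (∣-coprime-powers yy zz y≢z (e ∸ 1) (f ∸ 1) (D x)
        (∣-D-G-pred xx yy x≢y k e (factorˡ _ _ (sym eq)))
        (∣-D-G-pred xx zz x≢z k f (factorʳ _ _ (sym eq)))) (irreducible-D≢0 (proj₂ xx)))
    -- The repeated factors account for at most deg x′ and the first copies of `y` and `z` for at
    -- most 2 deg x. Together this is less than the 4 deg x that k ≥ 2 would require.
    bound : (k ℕ.+ k) ℕ.* deg x ≤ r ℕ.+ (deg x ℕ.+ deg x)
    bound = let open ℕ.≤-Reasoning in begin
      (k ℕ.+ k) ℕ.* deg x  ≡⟨ proj₂ (monic-deg-G (proj₁ xx) (irreducible-deg (proj₂ xx)) (k ℕ.+ k)) ⟨
      deg (G x (suc (k ℕ.+ k)))  ≡⟨ cong deg eq ⟩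
      deg (y ^ e * z ^ f)  ≡⟨ deg-* _ _ (^-≢0 e y≢0) (^-≢0 f z≢0) ⟩
      deg (y ^ e) ℕ.+ deg (z ^ f)  ≡⟨ cong₂ ℕ._+_ (deg-^ y e y≢0) (deg-^ z f z≢0) ⟩
      e ℕ.* deg y ℕ.+ f ℕ.* deg z        ≤⟨ ℕ.+-mono-≤ (*≤pred*+ e (deg y)) (*≤pred*+ f (deg z)) ⟩
      ((e ∸ 1) ℕ.* deg y ℕ.+ deg y) ℕ.+ ((f ∸ 1) ℕ.* deg z ℕ.+ deg z)
        ≡⟨ ℕ-solve 4 (λ a b c d → (a ⊹ b) ⊹ (c ⊹ d) ≐ (a ⊹ c) ⊹ (b ⊹ d)) refl ((e ∸ 1) ℕ.* deg y) (deg y) ((f ∸ 1) ℕ.* deg z) (deg z) ⟩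
      ((e ∸ 1) ℕ.* deg y ℕ.+ (f ∸ 1) ℕ.* deg z) ℕ.+ (deg y ℕ.+ deg z)
        ≤⟨ ℕ.+-mono-≤ repeated (ℕ.+-mono-≤ y≤x z≤x) ⟩
      r ℕ.+ (deg x ℕ.+ deg x)            ∎
      where
      open +-*-Solver renaming (solve to ℕ-solve; _:+_ to infixl 6 _⊹_; _:=_ to infix 4 _≐_)
    lt : r ℕ.+ (deg x ℕ.+ deg x) < 4 ℕ.* deg x
    lt = subst (r ℕ.+ (deg x ℕ.+ deg x) <_)
      (cong (λ n → deg x ℕ.+ (deg x ℕ.+ (deg x ℕ.+ n))) (sym (ℕ.+-identityʳ (deg x))))
      (ℕ.+-mono-<-≤ (deg-D (proj₂ xx)) (ℕ.+-monoʳ-≤ (deg x) (ℕ.m≤m+n (deg x) (deg x))))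

-- Reducibility of geometric sums of length 2ᵗ + 1.

module Reducibility (𝓟 : PolynomialRing) where

  open PolynomialRing 𝓟
  open Primes 𝓟
  open Geometric 𝓟
  open import Defs using (α; α+1)

  open ≡-Reasoning

  ^-double : ∀ x n → x ^ (2 ℕ.^ suc n) ≡ x ^ (2 ℕ.^ n) * x ^ (2 ℕ.^ n)
  ^-double x n = trans (cong (λ k → x ^ (2 ℕ.^ n ℕ.+ k)) (ℕ.+-identityʳ (2 ℕ.^ n))) (^-homo-* x (2 ℕ.^ n) (2 ℕ.^ n))

  frobenius : ∀ x y n → (x + y) ^ (2 ℕ.^ n) ≡ x ^ (2 ℕ.^ n) + y ^ (2 ℕ.^ n)
  frobenius x y zero    = solve 2 (λ x y → (x :+ y) :* con 1₄ := x :* con 1₄ :+ y :* con 1₄) refl x y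
  frobenius x y (suc n) = begin
    (x + y) ^ (2 ℕ.^ suc n)  ≡⟨ ^-double (x + y) n ⟩
    (x + y) ^ (2 ℕ.^ n) * (x + y) ^ (2 ℕ.^ n)  ≡⟨ cong (λ z → z * z) (frobenius x y n) ⟩
    (a + b) * (a + b)  ≡⟨ solve 2 (λ a b → (a :+ b) :* (a :+ b) := a :* a :+ b :* b) refl a b ⟩
    a * a + b * b  ≡⟨ cong₂ _+_ (^-double x n) (^-double y n) ⟨
    x ^ (2 ℕ.^ suc n) + y ^ (2 ℕ.^ suc n)          ∎
    where
    a = x ^ (2 ℕ.^ n)
    b = y ^ (2 ℕ.^ n)

  -- With q = x + 1 and v = q ^ 2ᵗ, the norm form of m = ∑ (i ≤ t) q ^ (2ᵗ - 2ⁱ)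
  -- satisfies m² + m v + v² = G x (2ᵗ⁺¹ + 1), which therefore factors over 𝔽₄.
  traceSum : Carrier → ℕ → Carrier
  traceSum q zero    = 1#
  traceSum q (suc t) = traceSum q t * q ^ (2 ℕ.^ t) + 1#

  traceSum-identity : ∀ q t → let m = traceSum q t ; v = q ^ (2 ℕ.^ t) in
    m * m + m * v ≡ q ^ mersenne (suc t) + 1#
  traceSum-identity q zero    = solve 1 (λ q → con 1₄ :* con 1₄ :+ con 1₄ :* (q :* con 1₄) := q :* con 1₄ :+ con 1₄) refl q
  traceSum-identity q (suc t) = begin
    (m * v + 1#) * (m * v + 1#) + (m * v + 1#) * q ^ (2 ℕ.^ suc t)
      ≡⟨ cong (λ z → (m * v + 1#) * (m * v + 1#) + (m * v + 1#) * z) (^-double q t) ⟩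
    (m * v + 1#) * (m * v + 1#) + (m * v + 1#) * (v * v)
      ≡⟨ solve 2 (λ m v → (m :* v :+ con 1₄) :* (m :* v :+ con 1₄) :+ (m :* v :+ con 1₄) :* (v :* v)
                        := v :* v :* ((m :* m :+ m :* v) :+ con 1₄) :+ con 1₄) refl m v ⟩
    v * v * ((m * m + m * v) + 1#) + 1#
      ≡⟨ cong (λ z → v * v * (z + 1#) + 1#) (traceSum-identity q t) ⟩
    v * v * ((c + 1#) + 1#) + 1#
      ≡⟨ cong (λ z → v * v * z + 1#) (+-cancelʳ c 1#) ⟩
    v * v * c + 1#
      ≡⟨ cong (λ z → z * c + 1#) (trans (cong (q ^_) (suc-mersenne (suc t))) (^-double q t)) ⟨
    q * c * c + 1#
      ≡⟨ cong (_+ 1#) (trans (*-assoc q c c) (cong (q *_) (sym (^-homo-* q (mersenne (suc t)) (mersenne (suc t)))))) ⟩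
    q ^ mersenne (suc (suc t)) + 1# ∎
    where
    m = traceSum q t
    v = q ^ (2 ℕ.^ t)
    c = q ^ mersenne (suc t)

  -- After multiplication by `q`, Frobenius rewrites x ^ N as q ^ N + 1 and everything becomes a
  -- polynomial in `q`. The form m² + m v + v² splits because ω and ω + 1 are the roots of z² + z +
  -- 1.
  G-2^+1 : ∀ x → x + 1# ≢ 0# → ∀ t → let q = x + 1# ; m = traceSum q t ; v = q ^ (2 ℕ.^ t) in
    G x (suc (2 ℕ.^ suc t)) ≡ (ω * v + m) * ((ω + 1#) * v + m)
  G-2^+1 x q≢0 t = *-cancelˡ q _ _ q≢0 (begin
    q * G x (suc N)  ≡⟨ G-telescope x (suc N) ⟩
    x * x ^ N + 1#  ≡⟨ cong (λ z → x * z + 1#) x^N ⟩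
    x * (q ^ N + 1#) + 1#  ≡⟨ cong (λ z → x * (z + 1#) + 1#) q^N ⟩
    x * (q * c + 1#) + 1#  ≡⟨ solve 2 (λ x c → x :* ((x :+ con 1₄) :* c :+ con 1₄) :+ con 1₄
                                                := (x :+ con 1₄) :* ((c :+ con 1₄) :+ (x :+ con 1₄) :* c)) refl x c ⟩
    q * ((c + 1#) + q * c)  ≡⟨ cong₂ (λ y z → q * (y + z)) (traceSum-identity q t) (trans (sym (^-double q t)) q^N) ⟨
    q * ((m * m + m * v) + v * v)  ≡⟨ solve 3 (λ q m v → q :* ((m :* m :+ m :* v) :+ v :* v)
                                                := q :* ((con α :* v :+ m) :* ((con α+1) :* v :+ m))) refl q m v ⟩
    q * ((ω * v + m) * ((ω + 1#) * v + m)) ∎)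
    where
    N = 2 ℕ.^ suc t
    q = x + 1#
    m = traceSum q t
    v = q ^ (2 ℕ.^ t)
    c = q ^ mersenne (suc t)
    q^N : q ^ N ≡ q * c
    q^N = cong (q ^_) (sym (suc-mersenne (suc t)))
    x^N : x ^ N ≡ q ^ N + 1#
    x^N = trans (cong (_^ N) (sym (+-cancelʳ x 1#))) (trans (frobenius q 1# (suc t)) (cong (q ^ N +_) (1^ N)))

  module _ {q} (mq : Monic q) (dq : 0 < deg q) where

    deg-^2^ : ∀ t → 0 < deg (q ^ (2 ℕ.^ t))
    deg-^2^ t = subst (0 <_) (sym (deg-^ q (2 ℕ.^ t) (monic≢0 mq))) (ℕ.*-mono-≤ (ℕ.m^n>0 2 t) dq)

    traceSum-deg : ∀ t → Monic (traceSum q t) × deg (traceSum q t) < deg (q ^ (2 ℕ.^ t))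
    traceSum-deg zero    = monic-1 , 1<deg (deg-^2^ 0)
    traceSum-deg (suc t) with traceSum-deg t
    ... | mm , lt = monic-+1 mmv 0<dmv , subst₂ _<_ (sym (trans (deg-+1 mmv 0<dmv) dmv))
            (sym (trans (cong deg (^-double q t)) (deg-* v v (monic≢0 mv) (monic≢0 mv)))) (ℕ.+-monoˡ-< (deg v) lt)
      where
      m = traceSum q t
      v = q ^ (2 ℕ.^ t)
      mv : Monic v
      mv = monic-^ (2 ℕ.^ t) mq
      mmv : Monic (m * v)
      mmv = monic-* m v mm mv
      dmv : deg (m * v) ≡ deg m ℕ.+ deg v
      dmv = deg-* m v (monic≢0 mm) (monic≢0 mv)
      0<dmv : 0 < deg (m * v)
      0<dmv = subst (0 <_) (sym dmv) (ℕ.≤-trans (deg-^2^ t) (ℕ.m≤n+m (deg v) (deg m)))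

    -- `v` has larger degree than `m`, so it dominates the sum and the factor is not constant.
    unit*v+m∤1 : ∀ t u → u ∣ 1# → u * q ^ (2 ℕ.^ t) + traceSum q t ∤ 1#
    unit*v+m∤1 t u u∣1 d = contradiction (∣1⇒deg≡0 d) (≢-sym (ℕ.<⇒≢ (subst (0 <_)
      (sym (trans (deg-+ʳ (u * v) m (*-≢0 u≢0 v≢0) (subst (deg m <_) (sym duv) (proj₂ (traceSum-deg t)))) duv)) (deg-^2^ t))))
      where
      m = traceSum q t
      v = q ^ (2 ℕ.^ t)
      u≢0 = ∣1⇒≢0 u∣1
      v≢0 = monic≢0 (monic-^ (2 ℕ.^ t) mq)
      duv : deg (u * v) ≡ deg v
      duv = trans (deg-* u v u≢0 v≢0) (cong (ℕ._+ deg v) (∣1⇒deg≡0 u∣1))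

  G-2^+1-reducible : ∀ {x} → Monic x → 0 < deg x → ∀ t → ¬ Irreducible (G x (suc (2 ℕ.^ suc t)))
  G-2^+1-reducible {x} mx dx t ig = [ ∤1 ω ω∣1 , ∤1 (ω + 1#) ω+1∣1 ]′
    (Irreducible.split-∣1 ig (G-2^+1 x (monic≢0 mq) t))
    where
    mq = monic-+1 mx dx
    ∤1 = unit*v+m∤1 mq (subst (0 <_) (sym (deg-+1 mx dx)) dx) t
    ω∣1 : ω ∣ 1#
    ω∣1 = ω + 1# , solve 0 (con α+1 :* con α := con 1₄) refl
    ω+1∣1 : ω + 1# ∣ 1#
    ω+1∣1 = ω , solve 0 (con α :* con α+1 := con 1₄) refl

  private
    2^*odd-acc : ∀ n → Acc _<_ n → ∃[ s ] ∃[ k ] suc n ≡ 2 ℕ.^ s ℕ.* suc (k ℕ.+ k)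
    2^*odd-acc n (acc rec) with half n
    ... | zero   = 0 , 0 , refl
    ... | even m = 0 , suc m , cong (suc ∘ suc) (trans (sym (ℕ.+-suc m m)) (sym (ℕ.+-identityʳ _)))
    ... | odd m with 2^*odd-acc m (rec (s≤s (ℕ.m≤m+n m m)))
    ... | s , k , e = suc s , k , trans (sym (ℕ.+-suc (suc m) m))
      (trans (cong (λ z → z ℕ.+ z) e) (sym (2^suc*≡ s (suc (k ℕ.+ k)))))

  2^*odd : ∀ n → ∃[ s ] ∃[ k ] suc n ≡ 2 ℕ.^ s ℕ.* suc (k ℕ.+ k)
  2^*odd n = 2^*odd-acc n (<-wellFounded n)

  -- If y = G x (2k+1) is prime then y + 1 = x (x + 1) (G x k)², where k is not
  -- a power of 2 by reducibility; so the odd part of k exceeds 1.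
  G-prime-+1 : ∀ {x} → Monic x → 0 < deg x → ∀ k → Irreducible (G x (suc (suc k ℕ.+ suc k))) →
    ∃[ v ] G x (suc (suc v ℕ.+ suc v)) ∣ G x (suc (suc k ℕ.+ suc k)) + 1#
  G-prime-+1 {x} mx dx k iy with 2^*odd k
  ... | s , zero , e = contradiction (subst (λ n → Irreducible (G x (suc n))) (trans (cong (λ z → z ℕ.+ z) e)
          (trans (sym (2^suc*≡ s 1)) (ℕ.*-identityʳ (2 ℕ.^ suc s)))) iy) (G-2^+1-reducible mx dx s)
  ... | s , suc v , e = v , subst (G x (suc (suc v ℕ.+ suc v)) ∣_)
    (sym (trans (cong (_+ 1#) (G-odd x (suc k))) (+-cancelʳ _ 1#)))
    (∣-*ˡ (x * (x + 1#)) (∣-*ˡ (G x (suc k)) (subst (λ n → G x (suc (suc v ℕ.+ suc v)) ∣ G x n) (sym e) (G-∣ x (2 ℕ.^ s) _))))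

-- Possible exponents, according to the odd sums occurring in σ** (X ^ a).

module Shapes (𝓟 : PolynomialRing) where

  open PolynomialRing 𝓟
  open Primes 𝓟
  open Geometric 𝓟
  open Reducibility 𝓟
  open import Data.Nat.Divisibility as ℕ using ()

  open ≡-Reasoning

  -- The exponents for which σ** (X ^ a) is just (X + 1) ^ a. The exponent 0 is included, as
  -- `mersenne 0`.
  TwoOrMersenne : ℕ → Set
  TwoOrMersenne a = a ≡ 2 ⊎ ∃[ n ] a ≡ mersenne n

  power≡1⊎even : ∀ s u → (s ≡ 0) ⊎ ∃[ m ] 2 ℕ.^ s ℕ.* u ≡ m ℕ.+ m
  power≡1⊎even zero    u = inj₁ refl
  power≡1⊎even (suc s) u = inj₂ (2 ℕ.^ s ℕ.* u , 2^suc*≡ s u)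

  -- Of two neighbouring numbers one is odd, so one of the two powers of 2 is trivial.
  consecutive : ∀ r s {u v} → 2 ℕ.^ s ℕ.* u ≡ suc (2 ℕ.^ r ℕ.* v) → r ≡ 0 ⊎ s ≡ 0
  consecutive r s {u} {v} e with power≡1⊎even r v | power≡1⊎even s u
  ... | inj₁ r≡0 | _ = inj₁ r≡0
  ... | inj₂ _   | inj₁ s≡0 = inj₂ s≡0
  ... | inj₂ (m , em) | inj₂ (n , en) = contradiction (trans (sym en) (trans e (cong suc em))) (n+n≢suc[m+m] n m)

  -- The exponents for which σ** (X ^ a) = (X + 1) ^ α W ^ p, where W = G X U is
  -- the only G X u with u > 1 odd that divides it.
  data Shape (U : ℕ) : (a α p : ℕ) → Set where
    plain  : ∀ {a} → TwoOrMersenne a → Shape U a a 0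
    double : ∀ {a} s → suc a ≡ 2 ℕ.^ suc s ℕ.* U → Shape U a (mersenne (suc s)) (2 ℕ.^ suc s)
    single : ∀ {a} s → suc a ≡ U ℕ.+ 2 ℕ.^ s → suc U ≡ 2 ℕ.^ s ⊎ U ≡ suc (2 ℕ.^ s) → Shape U a (2 ℕ.^ s) 1

  module _ (x : Carrier) (ν : ℕ) (2≤ν : 2 ≤ ν) (W : Carrier) where
    private
      U = suc (ν ℕ.+ ν)
      q = x + 1#

      5≤U : 5 ≤ U
      5≤U = s≤s (ℕ.+-mono-≤ 2≤ν 2≤ν)

    -- For a = 2m + 1 both sums have length m + 1. For a = 2m + 2 the lengths are the neighbours m +
    -- 1 and m + 2, and `U` cannot divide both. If it divides one, that one is the odd one, since
    -- the other is a power of 2 and exceeds 1; so `W` occurs once.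
    σ**-shapeᴴ : ∀ {a} (h : Halved a) →
      (∀ k → G x (suc (k ℕ.+ k)) ∣ σ**ᴴ x h → k ≡ 0 ⊎ (k ≡ ν × G x (suc (k ℕ.+ k)) ≡ W)) →
      ∃[ α ] ∃[ p ] Shape U a α p × σ**ᴴ x h ≡ q ^ α * W ^ p × (0 < p → G x U ≡ W × G x U ∣ σ**ᴴ x h)
    σ**-shapeᴴ zero hyp = 0 , 0 , plain (inj₂ (0 , refl)) , sym (*-identityˡ 1#) , λ ()
    σ**-shapeᴴ (odd m) hyp with 2^*odd m
    ... | s , k , e with hyp k (∣-*ˡ q (∣-*ʳ (G x (suc m)) (subst (λ n → G x (suc (k ℕ.+ k)) ∣ G x n) (sym e) (G-∣ x (2 ℕ.^ s) _))))
    ... | inj₁ refl = a , 0 , plain (inj₂ (suc s , a≡)) , eq , λ ()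
      where
      a = suc (m ℕ.+ m)
      suc-m≡ : suc m ≡ 2 ℕ.^ s
      suc-m≡ = trans e (ℕ.*-identityʳ _)
      m≡ : m ≡ mersenne s
      m≡ = ℕ.suc-injective (trans suc-m≡ (sym (suc-mersenne s)))
      a≡ : a ≡ mersenne (suc s)
      a≡ = cong (λ n → suc (n ℕ.+ n)) m≡
      g≡ : G x (suc m) ≡ q ^ m
      g≡ = trans (cong (G x) suc-m≡) (trans (G-2^ x s) (cong (q ^_) (sym m≡)))
      eq : q * (G x (suc m) * G x (suc m)) ≡ q ^ a * 1#
      eq = trans (cong (q *_) (trans (cong₂ _*_ g≡ g≡) (sym (^-homo-* q m m)))) (sym (*-identityʳ _))
    ... | inj₂ (refl , w) = mersenne (suc s) , 2 ℕ.^ suc s , double s suc-a≡ , eq , λ _ → w ,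
        ∣-*ˡ q (∣-*ʳ (G x (suc m)) (subst (λ n → G x U ∣ G x n) (sym e) (G-∣ x (2 ℕ.^ s) U)))
      where
      suc-a≡ : suc (suc (m ℕ.+ m)) ≡ 2 ℕ.^ suc s ℕ.* U
      suc-a≡ = trans (sym (ℕ.+-suc (suc m) m)) (trans (cong (λ z → z ℕ.+ z) e) (sym (2^suc*≡ s U)))
      c = q ^ mersenne s
      w^ = W ^ (2 ℕ.^ s)
      g≡ : G x (suc m) ≡ c * w^
      g≡ = trans (cong (G x) e) (trans (G-2^* x s U) (cong (λ z → c * z ^ (2 ℕ.^ s)) w))
      eq : q * (G x (suc m) * G x (suc m)) ≡ q ^ mersenne (suc s) * W ^ (2 ℕ.^ suc s)
      eq = begin
        q * (G x (suc m) * G x (suc m)) ≡⟨ cong (λ z → q * (z * z)) g≡ ⟩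
        q * ((c * w^) * (c * w^))  ≡⟨ solve 3 (λ q c w → q :* ((c :* w) :* (c :* w)) := q :* (c :* c) :* (w :* w)) refl q c w^ ⟩
        q * (c * c) * (w^ * w^)  ≡⟨ cong₂ (λ y z → q * y * z) (sym (^-homo-* q (mersenne s) (mersenne s))) (sym (^-double W s)) ⟩
        q ^ mersenne (suc s) * W ^ (2 ℕ.^ suc s) ∎
    σ**-shapeᴴ (even m) hyp with 2^*odd (suc m) | 2^*odd m
    ... | s , k , e | r , l , f
      with hyp k (∣-*ˡ q (∣-*ʳ (G x (suc m)) (subst (λ n → G x (suc (k ℕ.+ k)) ∣ G x n) (sym e) (G-∣ x (2 ℕ.^ s) _))))
         | hyp l (∣-*ˡ q (∣-*ˡ (G x (suc (suc m))) (subst (λ n → G x (suc (l ℕ.+ l)) ∣ G x n) (sym f) (G-∣ x (2 ℕ.^ r) _))))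
         | consecutive r s (trans (sym e) (cong suc f))
    -- Both lengths are powers of 2 and the smaller is odd: they are 1 and 2, so a = 2.
    ... | inj₁ refl | inj₁ refl | inj₁ refl with refl ← ℕ.suc-injective f = 2 , 0 , plain (inj₁ refl) ,
        solve 1 (λ x → (x :+ con 1₄) :* ((con 1₄ :+ x :* (con 1₄ :+ x :* con 0₄)) :* (con 1₄ :+ x :* con 0₄))
                    := ((x :+ con 1₄) :* ((x :+ con 1₄) :* con 1₄)) :* con 1₄) refl x , λ ()
    ... | inj₁ refl | inj₁ refl | inj₂ refl with () ← ℕ.suc-injective e
    -- `U` would divide two neighbouring numbers, hence 1.
    ... | inj₂ (refl , w) | inj₂ (refl , _) | zero-exponent = contradiction
        (ℕ.∣-antisym (ℕ.∣m+n∣m⇒∣n (subst (U ℕ.∣_) (trans (sym e) (trans (cong suc f) (ℕ.+-comm 1 _))) (ℕ.n∣m*n (2 ℕ.^ s))) (ℕ.n∣m*n (2 ℕ.^ r))) (ℕ.1∣ U))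
        (≢-sym (ℕ.<⇒≢ (ℕ.≤-trans (s≤s (s≤s z≤n)) 5≤U)))
    ... | inj₂ (refl , w) | inj₁ refl | inj₁ refl with refl ← ℕ.suc-injective f = contradiction
        (ℕ.≤-trans 5≤U (ℕ.≤-trans (ℕ.m≤n*m U (2 ℕ.^ s) {{ℕ.m^n≢0 2 s}}) (ℕ.≤-reflexive (sym e)))) λ { (s≤s (s≤s ())) }
    ... | inj₁ refl | inj₂ (refl , w) | inj₂ refl with () ← ℕ.suc-injective e
    ... | inj₂ (refl , w) | inj₁ refl | inj₂ refl = 2 ℕ.^ r , 1 , single r suc-a≡ (inj₂ U≡) , eq , λ _ → w ,
        ∣-*ˡ q (∣-*ʳ (G x (suc m)) (subst (λ n → G x U ∣ G x n) (sym e) (G-∣ x 1 U)))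
      where
      suc-m≡ : suc m ≡ 2 ℕ.^ r
      suc-m≡ = trans f (ℕ.*-identityʳ _)
      2+m≡ : suc (suc m) ≡ U
      2+m≡ = trans e (ℕ.*-identityˡ U)
      U≡ : U ≡ suc (2 ℕ.^ r)
      U≡ = trans (sym 2+m≡) (cong suc suc-m≡)
      suc-a≡ : suc (suc (suc (m ℕ.+ m))) ≡ U ℕ.+ 2 ℕ.^ r
      suc-a≡ = trans (cong (suc ∘ suc) (sym (ℕ.+-suc m m))) (cong₂ ℕ._+_ 2+m≡ suc-m≡)
      eq : q * (G x (suc (suc m)) * G x (suc m)) ≡ q ^ (2 ℕ.^ r) * W ^ 1
      eq = begin
        q * (G x (suc (suc m)) * G x (suc m)) ≡⟨ cong₂ (λ y z → q * (y * z)) (trans (cong (G x) 2+m≡) w) (trans (cong (G x) suc-m≡) (G-2^ x r)) ⟩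
        q * (W * q ^ mersenne r)  ≡⟨ solve 3 (λ q w c → q :* (w :* c) := (q :* c) :* (w :* con 1₄)) refl q W (q ^ mersenne r) ⟩
        q ^ suc (mersenne r) * W ^ 1  ≡⟨ cong (λ n → q ^ n * W ^ 1) (suc-mersenne r) ⟩
        q ^ (2 ℕ.^ r) * W ^ 1                 ∎
    ... | inj₁ refl | inj₂ (refl , w) | inj₁ refl = 2 ℕ.^ s , 1 , single s suc-a≡ (inj₁ U≡) , eq , λ _ → w ,
        ∣-*ˡ q (∣-*ˡ (G x (suc (suc m))) (subst (λ n → G x U ∣ G x n) (sym f) (G-∣ x 1 U)))
      where
      2+m≡ : suc (suc m) ≡ 2 ℕ.^ s
      2+m≡ = trans e (ℕ.*-identityʳ _)
      suc-m≡ : suc m ≡ U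
      suc-m≡ = trans f (ℕ.*-identityˡ U)
      U≡ : suc U ≡ 2 ℕ.^ s
      U≡ = trans (cong suc (sym suc-m≡)) 2+m≡
      suc-a≡ : suc (suc (suc (m ℕ.+ m))) ≡ U ℕ.+ 2 ℕ.^ s
      suc-a≡ = trans (cong suc (trans (sym (ℕ.+-suc (suc m) m)) refl)) (trans (sym (ℕ.+-suc (suc m) (suc m))) (cong₂ ℕ._+_ suc-m≡ 2+m≡))
      eq : q * (G x (suc (suc m)) * G x (suc m)) ≡ q ^ (2 ℕ.^ s) * W ^ 1
      eq = begin
        q * (G x (suc (suc m)) * G x (suc m)) ≡⟨ cong₂ (λ y z → q * (y * z)) (trans (cong (G x) 2+m≡) (G-2^ x s)) (trans (cong (G x) suc-m≡) w) ⟩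
        q * (q ^ mersenne s * W)  ≡⟨ solve 3 (λ q w c → q :* (c :* w) := (q :* c) :* (w :* con 1₄)) refl q W (q ^ mersenne s) ⟩
        q ^ suc (mersenne s) * W ^ 1  ≡⟨ cong (λ n → q ^ n * W ^ 1) (suc-mersenne s) ⟩
        q ^ (2 ℕ.^ s) * W ^ 1                 ∎

    σ**-shape : ∀ a →
      (∀ k → G x (suc (k ℕ.+ k)) ∣ σ** x a → k ≡ 0 ⊎ (k ≡ ν × G x (suc (k ℕ.+ k)) ≡ W)) →
      ∃[ α ] ∃[ p ] Shape U a α p × σ** x a ≡ q ^ α * W ^ p × (0 < p → G x U ≡ W × G x U ∣ σ** x a)
    σ**-shape a = σ**-shapeᴴ (half a)

  σ**-plain : ∀ x a → (∀ k → G x (suc (k ℕ.+ k)) ∣ σ** x a → k ≡ 0) →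
    TwoOrMersenne a × σ** x a ≡ (x + 1#) ^ a
  -- The values 2 for `ν` and 0 for `W` are placeholders: the hypothesis always selects the first
  -- alternative.
  σ**-plain x a hyp with σ**-shape x 2 ℕ.≤-refl 0# a (inj₁ ∘₂ hyp)
    where open import Function.Base using (_∘₂_)
  ... | α , p , sh , e , occurs with sh
  ... | plain t = t , trans e (*-identityʳ _)
  ... | single s _ _ = contradiction (hyp 2 (proj₂ (occurs (s≤s z≤n)))) λ ()
  ... | double s _ = contradiction (hyp 2 (proj₂ (occurs (ℕ.m^n>0 2 (suc s))))) λ ()

-- The exponent equation behind G P u = R S.

module FactorIdentity (𝓟 : PolynomialRing) where

  open PolynomialRing 𝓟
  open Primes 𝓟
  open Geometric 𝓟
  open Derivation 𝓟
  open import Algebra.Properties.CommutativeSemigroup ℕ.+-commutativeSemigroup using (interchange)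

  open ≡-Reasoning

  parity : ∀ n → ∃[ m ] (n ≡ m ℕ.+ m ⊎ n ≡ suc (m ℕ.+ m))
  parity zero    = 0 , inj₁ refl
  parity (suc n) with parity n
  ... | m , inj₁ refl = m , inj₂ refl
  ... | m , inj₂ refl = suc m , inj₁ (cong suc (sym (ℕ.+-suc m m)))

  D-even : ∀ x {n} m → n ≡ m ℕ.+ m → D (x ^ n) ≡ 0#
  D-even x m refl = D-^-even x m

  D-odd : ∀ x {n} m → n ≡ suc (m ℕ.+ m) → D (x ^ n) ≡ x ^ (m ℕ.+ m) * D x
  D-odd x m refl = D-^-odd x m

  square≡0 : ∀ x → x * x ≡ 0# → x ≡ 0#
  square≡0 x e with x ≟0
  ... | yes x≡0 = x≡0
  ... | no  x≢0 = contradiction e (*-≢0 x≢0 x≢0)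

  module Consecutive {P : Carrier} (pp : MonicIrreducible P) (qq : MonicIrreducible (P + 1#)) where

    Q = P + 1#
    private
      δ = D P
      ip = proj₂ pp
      iq = proj₂ qq
      δ≢0 : δ ≢ 0#
      δ≢0 = irreducible-D≢0 ip

    P∤1 : P ∤ 1#
    P∤1 = Irreducible.p∤1 ip

    P∤Q : P ∤ Q
    P∤Q d = P∤1 (∣-+⁻ˡ d ∣-refl)

    Q∤P : Q ∤ P
    Q∤P d = Irreducible.p∤1 iq (∣-+⁻ˡ ∣-refl d)

    P∣Q^+1 : ∀ n → P ∣ Q ^ n + 1#
    P∣Q^+1 n = factorˡ P (G Q n) (trans (cong (_* G Q n) (sym (+-cancelʳ P 1#))) (G-telescope Q n))

    cancelδ : ∀ z → z * δ ≡ 0# → z ≡ 0#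
    cancelδ z e with z ≟0
    ... | yes z≡0 = z≡0
    ... | no  z≢0 = contradiction e (*-≢0 z≢0 δ≢0)

    monomial≢0 : ∀ m n → P ^ m * Q ^ n ≢ 0#
    monomial≢0 m n = *-≢0 (^-≢0 m (irreducible≢0 ip)) (^-≢0 n (irreducible≢0 iq))

    private
      -- The derivative of P ^ m Q ^ n is 0 when both exponents are even. Otherwise both exponents
      -- are rounded down to even numbers and P′ is appended; when both are odd this uses P + Q = 1.
      D-ee : ∀ {m n} a b → m ≡ a ℕ.+ a → n ≡ b ℕ.+ b → D (P ^ m * Q ^ n) ≡ 0# * δ
      D-ee {m} {n} a b e f = trans (D-* _ _) (trans (cong₂ (λ y z → y * Q ^ n + P ^ m * z) (D-even P a e) (D-even Q b f))
        (solve 3 (λ x y d → con 0₄ :* y :+ x :* con 0₄ := con 0₄ :* d) refl (P ^ m) (Q ^ n) δ))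

      D-Q-odd : ∀ {n} b → n ≡ suc (b ℕ.+ b) → D (Q ^ n) ≡ Q ^ (b ℕ.+ b) * δ
      D-Q-odd b f = trans (D-odd Q b f) (cong (Q ^ (b ℕ.+ b) *_) (D-+1 P))

      D-oe : ∀ {m n} a b → m ≡ suc (a ℕ.+ a) → n ≡ b ℕ.+ b → D (P ^ m * Q ^ n) ≡ P ^ (a ℕ.+ a) * Q ^ (b ℕ.+ b) * δ
      D-oe {m} {n} a b e refl = trans (D-* _ _) (trans (cong₂ (λ y z → y * Q ^ n + P ^ m * z) (D-odd P a e) (D-even Q b refl))
        (solve 4 (λ x y u d → (x :* d) :* y :+ u :* con 0₄ := x :* y :* d) refl (P ^ (a ℕ.+ a)) (Q ^ n) (P ^ m) δ))

      D-eo : ∀ {m n} a b → m ≡ a ℕ.+ a → n ≡ suc (b ℕ.+ b) → D (P ^ m * Q ^ n) ≡ P ^ (a ℕ.+ a) * Q ^ (b ℕ.+ b) * δ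
      D-eo {m} {n} a b refl f = trans (D-* _ _) (trans (cong₂ (λ y z → y * Q ^ n + P ^ m * z) (D-even P a refl) (D-Q-odd b f))
        (solve 4 (λ x y u d → con 0₄ :* u :+ x :* (y :* d) := x :* y :* d) refl (P ^ m) (Q ^ (b ℕ.+ b)) (Q ^ n) δ))

      D-oo : ∀ {m n} a b → m ≡ suc (a ℕ.+ a) → n ≡ suc (b ℕ.+ b) → D (P ^ m * Q ^ n) ≡ P ^ (a ℕ.+ a) * Q ^ (b ℕ.+ b) * δ
      D-oo {m} {n} a b refl refl = trans (D-* _ _) (trans (cong₂ (λ y z → y * Q ^ n + P ^ m * z) (D-odd P a refl) (D-Q-odd b refl))
        (solve 4 (λ x y p d → (x :* d) :* ((p :+ con 1₄) :* y) :+ (p :* x) :* (y :* d) := x :* y :* d) refl (P ^ (a ℕ.+ a)) (Q ^ (b ℕ.+ b)) P δ))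

      -- Every derivative carries the factor P′, which is nonzero and cancels.
      differentiate : ∀ {s t u r a b c} → s + t + u ≡ r → D s ≡ a * δ → D t ≡ b * δ → D u ≡ c * δ → D r ≡ 0# → a + b + c ≡ 0#
      differentiate {s} {t} {u} {r} {a} {b} {c} e es et eu er = cancelδ _ (begin
        (a + b + c) * δ  ≡⟨ solve 4 (λ a b c d → (a :+ b :+ c) :* d := a :* d :+ b :* d :+ c :* d) refl a b c δ ⟩
        a * δ + b * δ + c * δ ≡⟨ cong₂ _+_ (cong₂ _+_ es et) eu ⟨
        D s + D t + D u  ≡⟨ trans (D-+ (s + t) u) (cong (_+ D u) (D-+ s t)) ⟨
        D (s + t + u)  ≡⟨ cong D e ⟩
        D r  ≡⟨ er ⟩
        0#                    ∎)

      D-rhs : ∀ ν → D (P ^ (ν ℕ.+ ν) + 1#) ≡ 0#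
      D-rhs ν = trans (D-+1 _) (D-even P ν refl)

      ∤Q^ : ∀ n → P ∤ Q ^ n
      ∤Q^ n = ∤-^ ip Q n P∤Q

      ∤P^ : ∀ n → Q ∤ P ^ n
      ∤P^ n = ∤-^ iq P n Q∤P

      D-Q-even : ∀ {n} b → n ≡ b ℕ.+ b → D (Q ^ n) ≡ 0# * δ
      D-Q-even b e = trans (D-even Q b e) (sym (zeroˡ δ))

      -- Obtained from (P Q ^ j + 1)(P ^ (k + 1) Q ^ l + 1) = G P (2ν + 1) by multiplying with `Q`,
      -- adding `Q` and dividing by `P`.
      Equation : (j k l ν : ℕ) → Set
      Equation j k l ν = Q ^ suc j + P ^ k * Q ^ suc l + P ^ suc k * Q ^ suc (j ℕ.+ l) ≡ P ^ (ν ℕ.+ ν) + 1#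

      drop₁₃ : ∀ {x y} → 0# + x + 0# ≡ y → x ≡ y
      drop₁₃ e = trans (solve 1 (λ x → x := con 0₄ :+ x :+ con 0₄) refl _) e

      drop₁₂ : ∀ {x y} → 0# + 0# + x ≡ y → x ≡ y
      drop₁₂ e = trans (solve 1 (λ x → x := con 0₄ :+ con 0₄ :+ x) refl _) e

      -- Differentiation leaves Q ^ 2g + P ^ 2g = 0 for even `g`, with Q ^ (g - 1) as a third term
      -- for odd `g`. Unless g = 1, `Q` would divide a power of `P`.
      last-step : ∀ g → 1 ≤ g → Q ^ g + P * Q ^ (g ℕ.+ g) + P ^ suc (g ℕ.+ g) ≡ 1# → g ≡ 1
      last-step g 1≤g e with parity g
      ... | h , inj₁ refl = contradiction (subst (Q ∣_) (+≡0⇒≡ _ _ sum≡0) (∣-pos (g ℕ.+ g) (ℕ.≤-trans 1≤g (ℕ.m≤m+n g g)))) (∤P^ (g ℕ.+ g))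
        where
        ∣-pos : ∀ n → 1 ≤ n → Q ∣ Q ^ n
        ∣-pos (suc n) _ = ∣-factorˡ Q (Q ^ n)
        sum≡0 : Q ^ (g ℕ.+ g) + P ^ (g ℕ.+ g) ≡ 0#
        sum≡0 = trans (solve 2 (λ x y → x :+ y := con 0₄ :+ x :+ y) refl _ _)
          (differentiate {b = Q ^ (g ℕ.+ g)} {c = P ^ (g ℕ.+ g)} e (D-Q-even h refl)
            (trans (D-* P _) (trans (cong (λ z → δ * Q ^ (g ℕ.+ g) + P * z) (D-even Q g refl))
              (solve 3 (λ d y p → d :* y :+ p :* con 0₄ := y :* d) refl δ (Q ^ (g ℕ.+ g)) P)))
            (D-odd P g refl) D-1)
      ... | zero , inj₂ refl = refl
      ... | suc h , inj₂ refl = contradiction (subst (Q ∣_) (+≡0⇒≡ _ _ sum≡0)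
              (∣-+ (∣-^ (h ℕ.+ suc h) ∣-refl) (∣-^ (suc h ℕ.+ suc h ℕ.+ g) ∣-refl))) (∤P^ (g ℕ.+ g))
        where
        sum≡0 : Q ^ (suc h ℕ.+ suc h) + Q ^ (g ℕ.+ g) + P ^ (g ℕ.+ g) ≡ 0#
        sum≡0 = differentiate {a = Q ^ (suc h ℕ.+ suc h)} {b = Q ^ (g ℕ.+ g)} {c = P ^ (g ℕ.+ g)} e (D-Q-odd (suc h) refl)
            (trans (D-* P _) (trans (cong (λ z → δ * Q ^ (g ℕ.+ g) + P * z) (D-even Q g refl))
              (solve 3 (λ d y p → d :* y :+ p :* con 0₄ := y :* d) refl δ (Q ^ (g ℕ.+ g)) P)))
            (D-odd P g refl) D-1

      -- By P + Q = 1 the first two terms combine to Q ^ 2g; then all terms are squares, and a root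
      -- can be taken in characteristic 2.
      square-root : ∀ c → Equation (suc c ℕ.+ suc c) 1 (suc (c ℕ.+ c)) (suc (suc c ℕ.+ suc c)) →
        let g = suc c in Q ^ g + P * Q ^ (g ℕ.+ g) + P ^ suc (g ℕ.+ g) ≡ 1#
      square-root c e = +≡0⇒≡ _ _ (square≡0 _ (begin
        (y + P * Q ^ (g ℕ.+ g) + z + 1#) * (y + P * Q ^ (g ℕ.+ g) + z + 1#)
          ≡⟨ cong (λ w → (y + P * w + z + 1#) * (y + P * w + z + 1#)) (^-homo-* Q g g) ⟩
        (y + P * (y * y) + z + 1#) * (y + P * (y * y) + z + 1#)
          ≡⟨ solve 3 (λ p y z → (y :+ p :* (y :* y) :+ z :+ con 1₄) :* (y :+ p :* (y :* y) :+ z :+ con 1₄) :=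
               ((p :+ con 1₄) :* (y :* y) :+ (p :* con 1₄) :* (y :* y) :+ (p :* (p :* con 1₄)) :* ((y :* y) :* (y :* y))) :+ (z :* z :+ con 1₄)) refl P y z ⟩
        (Q * (y * y) + P ^ 1 * (y * y) + P ^ 2 * ((y * y) * (y * y))) + (z * z + 1#)
          ≡⟨ cong₂ _+_ (cong₂ _+_ (cong₂ (λ u v → Q * u + P ^ 1 * v) y² (trans y² (cong (λ n → Q ^ suc n) (ℕ.+-suc c c)))) (cong (P ^ 2 *_) y⁴)) (cong (_+ 1#) z²) ⟩
        (Q ^ suc (g ℕ.+ g) + P ^ 1 * Q ^ suc (suc (c ℕ.+ c)) + P ^ 2 * Q ^ suc (g ℕ.+ g ℕ.+ suc (c ℕ.+ c))) + (P ^ (suc (g ℕ.+ g) ℕ.+ suc (g ℕ.+ g)) + 1#)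
          ≡⟨ cong (_+ (P ^ (suc (g ℕ.+ g) ℕ.+ suc (g ℕ.+ g)) + 1#)) e ⟩
        (P ^ (suc (g ℕ.+ g) ℕ.+ suc (g ℕ.+ g)) + 1#) + (P ^ (suc (g ℕ.+ g) ℕ.+ suc (g ℕ.+ g)) + 1#) ≡⟨ +-self _ ⟩
        0# ∎))
        where
        g = suc c
        y = Q ^ g
        z = P ^ suc (g ℕ.+ g)
        y² : y * y ≡ Q ^ (g ℕ.+ g)
        y² = sym (^-homo-* Q g g)
        y⁴ : (y * y) * (y * y) ≡ Q ^ suc (g ℕ.+ g ℕ.+ suc (c ℕ.+ c))
        y⁴ = trans (cong₂ _*_ y² y²) (trans (sym (^-homo-* Q (g ℕ.+ g) (g ℕ.+ g)))
          (cong (Q ^_) (ℕ-solve 1 (λ c → (c1 c ⊹ c1 c) ⊹ (c1 c ⊹ c1 c) ≐ ℕ-con 1 ⊹ ((c1 c ⊹ c1 c) ⊹ (ℕ-con 1 ⊹ (c ⊹ c)))) refl c)))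
          where
          open +-*-Solver using () renaming (solve to ℕ-solve; _:+_ to infixl 6 _⊹_; _:=_ to infix 4 _≐_; con to ℕ-con; Polynomial to Pol)
          c1 : Pol 1 → Pol 1
          c1 c = ℕ-con 1 ⊹ c
        z² : z * z ≡ P ^ (suc (g ℕ.+ g) ℕ.+ suc (g ℕ.+ g))
        z² = sym (^-homo-* P (suc (g ℕ.+ g)) (suc (g ℕ.+ g)))

    private
      even-sum : ∀ a c → suc ((a ℕ.+ a) ℕ.+ (c ℕ.+ c)) ≡ suc ((a ℕ.+ c) ℕ.+ (a ℕ.+ c))
      even-sum a c = cong suc (interchange a a c c)

      odd-sum : ∀ a c → suc ((a ℕ.+ a) ℕ.+ suc (c ℕ.+ c)) ≡ (a ℕ.+ suc c) ℕ.+ (a ℕ.+ suc c)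
      odd-sum a c = trans (sym (ℕ.+-suc (a ℕ.+ a) _)) (trans (cong (a ℕ.+ a ℕ.+_) (cong suc (sym (ℕ.+-suc c c)))) (interchange a a (suc c) (suc c)))

      double-suc : ∀ a → suc (suc (a ℕ.+ a)) ≡ suc a ℕ.+ suc a
      double-suc a = cong suc (sym (ℕ.+-suc a a))

      -- In this and the next parity class a single monomial survives differentiation, and it would
      -- have to be zero.
      odd-odd-even : ∀ a b c ν → ¬ Equation (suc (a ℕ.+ a)) (suc (b ℕ.+ b)) (c ℕ.+ c) ν
      odd-odd-even a b c ν eq = monomial≢0 (b ℕ.+ b) (c ℕ.+ c) (drop₁₃ (differentiate eq
        (D-Q-even (suc a) (double-suc a)) (D-oo b c refl refl)
        (D-ee (suc b) (suc (a ℕ.+ c)) (double-suc b) (trans (cong suc (even-sum a c)) (double-suc (a ℕ.+ c)))) (D-rhs ν)))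

      odd-even-odd : ∀ a b c ν → ¬ Equation (suc (a ℕ.+ a)) (b ℕ.+ b) (suc (c ℕ.+ c)) ν
      odd-even-odd a b c ν eq = monomial≢0 (b ℕ.+ b) ((a ℕ.+ suc c) ℕ.+ (a ℕ.+ suc c)) (drop₁₂ (differentiate eq
        (D-Q-even (suc a) (double-suc a)) (D-ee b (suc c) refl (double-suc c))
        (D-oo b (a ℕ.+ suc c) refl (cong suc (odd-sum a c))) (D-rhs ν)))

      -- All three terms survive. For k > 0 the prime `P` divides two of them but not the third; for
      -- k = 0 they say (Q ^ j + 1)(Q ^ l + 1) = 1, although `P` divides the first factor.
      even-even-even : ∀ a b c ν → ¬ Equation (a ℕ.+ a) (b ℕ.+ b) (c ℕ.+ c) ν
      even-even-even a zero c ν eq = P∤1 (∣-trans (P∣Q^+1 (a ℕ.+ a)) (factorˡ _ (y + 1#) (begin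
        (x + 1#) * (y + 1#)  ≡⟨ solve 2 (λ x y → (x :+ con 1₄) :* (y :+ con 1₄) := (x :+ con 1₄ :* y :+ con 1₄ :* (x :* y)) :+ con 1₄) refl x y ⟩
        (x + 1# * y + 1# * (x * y)) + 1# ≡⟨ cong (λ z → (x + 1# * y + 1# * z) + 1#) (trans (sym (^-homo-* Q (a ℕ.+ a) (c ℕ.+ c)))
                                              (cong (Q ^_) (interchange a a c c))) ⟩
        (x + 1# * y + 1# * Q ^ ((a ℕ.+ c) ℕ.+ (a ℕ.+ c))) + 1#
          ≡⟨ cong (_+ 1#) (differentiate eq (D-Q-odd a refl) (D-eo 0 c refl refl) (D-oo 0 (a ℕ.+ c) refl (even-sum a c)) (D-rhs ν)) ⟩
        0# + 1#  ≡⟨ +-identityˡ 1# ⟩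
        1#                               ∎)))
        where
        x = Q ^ (a ℕ.+ a)
        y = Q ^ (c ℕ.+ c)
      even-even-even a (suc b) c ν eq = ∤Q^ (a ℕ.+ a) (subst (P ∣_)
        (sym (+≡0⇒≡ _ _ (trans (sym (+-assoc _ _ _)) (differentiate eq (D-Q-odd a refl) (D-eo (suc b) c refl refl)
          (D-oo (suc b) (a ℕ.+ c) refl (even-sum a c)) (D-rhs ν)))))
        (∣-+ (∣-*ʳ _ P∣) (∣-*ʳ _ P∣)))
        where
        P∣ : P ∣ P ^ (suc b ℕ.+ suc b)
        P∣ = ∣-^ (b ℕ.+ suc b) ∣-refl

      -- The first two terms survive and must agree; unique factorization then gives k = 1 and j = l
      -- + 1.
      even-odd-odd : ∀ a b c ν → Equation (a ℕ.+ a) (suc (b ℕ.+ b)) (suc (c ℕ.+ c)) ν → b ≡ 0 × a ≡ suc c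
      even-odd-odd a b c ν eq = cases b Q^≡
        where
        Q^≡ : Q ^ (a ℕ.+ a) ≡ P ^ (b ℕ.+ b) * Q ^ (suc c ℕ.+ suc c)
        Q^≡ = +≡0⇒≡ _ _ (trans (sym (+-identityʳ _)) (differentiate eq (D-Q-odd a refl)
          (D-oe b (suc c) refl (double-suc c)) (D-ee (suc b) (a ℕ.+ suc c) (double-suc b) (odd-sum a c)) (D-rhs ν)))
        cases : ∀ b → Q ^ (a ℕ.+ a) ≡ P ^ (b ℕ.+ b) * Q ^ (suc c ℕ.+ suc c) → b ≡ 0 × a ≡ suc c
        cases zero e = refl , n+n-injective a (suc c) (proj₁ (exponent-unique iq (a ℕ.+ a) (suc c ℕ.+ suc c) 1# 1#
          (Irreducible.p∤1 iq) (Irreducible.p∤1 iq) (trans (*-identityʳ _) (trans e (trans (*-identityˡ _) (sym (*-identityʳ _)))))))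
        cases (suc b) e = contradiction (subst (P ∣_) (sym e) (∣-*ʳ _ (∣-^ (b ℕ.+ suc b) ∣-refl))) (∤Q^ (a ℕ.+ a))

      open +-*-Solver using () renaming (solve to ℕ-solve; _:+_ to infixl 6 _⊹_; _:=_ to infix 4 _≐_; con to ℕ-con)

      c≡0 : ∀ c ν → ν ≡ suc (suc c ℕ.+ suc c) → Equation (suc c ℕ.+ suc c) 1 (suc (c ℕ.+ c)) ν → c ≡ 0
      c≡0 c _ refl eq = ℕ.suc-injective (last-step (suc c) (s≤s z≤n) (square-root c eq))

      ν≡ : ∀ c ν → suc (suc ((suc c ℕ.+ suc c) ℕ.+ 1 ℕ.+ suc (c ℕ.+ c))) ≡ ν ℕ.+ ν → ν ≡ suc (suc c ℕ.+ suc c)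
      ν≡ c ν n = n+n-injective ν (suc (suc c ℕ.+ suc c)) (trans (sym n)
        (ℕ-solve 1 (λ c → ℕ-con 2 ⊹ (((ℕ-con 1 ⊹ c) ⊹ (ℕ-con 1 ⊹ c)) ⊹ ℕ-con 1 ⊹ (ℕ-con 1 ⊹ (c ⊹ c)))
          ≐ (ℕ-con 1 ⊹ ((ℕ-con 1 ⊹ c) ⊹ (ℕ-con 1 ⊹ c))) ⊹ (ℕ-con 1 ⊹ ((ℕ-con 1 ⊹ c) ⊹ (ℕ-con 1 ⊹ c)))) refl c))

      only-solution : ∀ a b c ν → b ≡ 0 → a ≡ suc c → suc (suc ((a ℕ.+ a) ℕ.+ suc (b ℕ.+ b) ℕ.+ suc (c ℕ.+ c))) ≡ ν ℕ.+ ν →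
        Equation (a ℕ.+ a) (suc (b ℕ.+ b)) (suc (c ℕ.+ c)) ν → a ℕ.+ a ≡ 2 × suc (b ℕ.+ b) ≡ 1 × suc (c ℕ.+ c) ≡ 1
      only-solution _ _ c ν refl refl n eq =
        cong (λ c → suc c ℕ.+ suc c) c≡0′ , refl , cong (λ c → suc (c ℕ.+ c)) c≡0′
        where c≡0′ = c≡0 c ν (ν≡ c ν n) eq

      -- The degree condition makes j + k + l even, which leaves four of the eight parity classes;
      -- only one of these has a solution.
      solve-Equation : ∀ j k l ν → suc (suc (j ℕ.+ k ℕ.+ l)) ≡ ν ℕ.+ ν → Equation j k l ν → j ≡ 2 × k ≡ 1 × l ≡ 1
      solve-Equation j k l ν n eq with parity j | parity k | parity l
      ... | a , inj₂ refl | b , inj₂ refl | c , inj₁ refl = contradiction eq (odd-odd-even a b c ν)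
      ... | a , inj₂ refl | b , inj₁ refl | c , inj₂ refl = contradiction eq (odd-even-odd a b c ν)
      ... | a , inj₁ refl | b , inj₁ refl | c , inj₁ refl = contradiction eq (even-even-even a b c ν)
      ... | a , inj₁ refl | b , inj₂ refl | c , inj₂ refl =
        let b≡0 , a≡ = even-odd-odd a b c ν eq in only-solution a b c ν b≡0 a≡ n eq
      ... | a , inj₁ refl | b , inj₁ refl | c , inj₂ refl = contradiction (trans (sym n)
              (ℕ-solve 3 (λ a b c → ℕ-con 2 ⊹ ((a ⊹ a) ⊹ (b ⊹ b) ⊹ (ℕ-con 1 ⊹ (c ⊹ c))) ≐ ℕ-con 1 ⊹ ((ℕ-con 1 ⊹ (a ⊹ b ⊹ c)) ⊹ (ℕ-con 1 ⊹ (a ⊹ b ⊹ c)))) refl a b c))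
              (n+n≢suc[m+m] ν (suc (a ℕ.+ b ℕ.+ c)))
      ... | a , inj₁ refl | b , inj₂ refl | c , inj₁ refl = contradiction (trans (sym n)
              (ℕ-solve 3 (λ a b c → ℕ-con 2 ⊹ ((a ⊹ a) ⊹ (ℕ-con 1 ⊹ (b ⊹ b)) ⊹ (c ⊹ c)) ≐ ℕ-con 1 ⊹ ((ℕ-con 1 ⊹ (a ⊹ b ⊹ c)) ⊹ (ℕ-con 1 ⊹ (a ⊹ b ⊹ c)))) refl a b c))
              (n+n≢suc[m+m] ν (suc (a ℕ.+ b ℕ.+ c)))
      ... | a , inj₂ refl | b , inj₁ refl | c , inj₁ refl = contradiction (trans (sym n)
              (ℕ-solve 3 (λ a b c → ℕ-con 2 ⊹ ((ℕ-con 1 ⊹ (a ⊹ a)) ⊹ (b ⊹ b) ⊹ (c ⊹ c)) ≐ ℕ-con 1 ⊹ ((ℕ-con 1 ⊹ (a ⊹ b ⊹ c)) ⊹ (ℕ-con 1 ⊹ (a ⊹ b ⊹ c)))) refl a b c))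
              (n+n≢suc[m+m] ν (suc (a ℕ.+ b ℕ.+ c)))
      ... | a , inj₂ refl | b , inj₂ refl | c , inj₂ refl = contradiction (trans (sym n)
              (ℕ-solve 3 (λ a b c → ℕ-con 2 ⊹ ((ℕ-con 1 ⊹ (a ⊹ a)) ⊹ (ℕ-con 1 ⊹ (b ⊹ b)) ⊹ (ℕ-con 1 ⊹ (c ⊹ c))) ≐ ℕ-con 1 ⊹ ((ℕ-con 2 ⊹ (a ⊹ b ⊹ c)) ⊹ (ℕ-con 2 ⊹ (a ⊹ b ⊹ c)))) refl a b c))
              (n+n≢suc[m+m] ν (suc (suc (a ℕ.+ b ℕ.+ c))))

    private
      divided : ∀ i j k l ν → (P ^ suc i * Q ^ j + 1#) * (P ^ suc k * Q ^ l + 1#) ≡ G P (suc (ν ℕ.+ ν)) →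
        P ^ i * Q ^ suc j + P ^ k * Q ^ suc l + P ^ suc (i ℕ.+ k) * Q ^ suc (j ℕ.+ l) ≡ P ^ (ν ℕ.+ ν) + 1#
      divided i j k l ν e = *-cancelˡ P _ _ (irreducible≢0 ip) (begin
        P * (x * (Q * y) + u * (Q * v) + (P * P ^ (i ℕ.+ k)) * (Q * Q ^ (j ℕ.+ l)))
          ≡⟨ cong₂ (λ s t → P * (x * (Q * y) + u * (Q * v) + (P * s) * (Q * t))) (^-homo-* P i k) (^-homo-* Q j l) ⟩
        P * (x * (Q * y) + u * (Q * v) + (P * (x * u)) * (Q * (y * v)))
          ≡⟨ solve 6 (λ p q x y u v → p :* (x :* (q :* y) :+ u :* (q :* v) :+ (p :* (x :* u)) :* (q :* (y :* v)))
               := q :* ((p :* x :* y :+ con 1₄) :* (p :* u :* v :+ con 1₄)) :+ q) refl P Q x y u v ⟩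
        Q * ((P ^ suc i * Q ^ j + 1#) * (P ^ suc k * Q ^ l + 1#)) + Q
          ≡⟨ cong (_+ Q) (trans (cong (Q *_) e) (G-telescope P (suc (ν ℕ.+ ν)))) ⟩
        (P * P ^ (ν ℕ.+ ν) + 1#) + (P + 1#)
          ≡⟨ solve 2 (λ p z → (p :* z :+ con 1₄) :+ (p :+ con 1₄) := p :* (z :+ con 1₄)) refl P (P ^ (ν ℕ.+ ν)) ⟩
        P * (P ^ (ν ℕ.+ ν) + 1#) ∎)
        where
        x = P ^ i
        y = Q ^ j
        u = P ^ k
        v = Q ^ l

      cancel₁ : ∀ x {y z} → 1# * x + y + z ≡ x + y + z
      cancel₁ x = cong (λ w → w + _ + _) (*-identityˡ x)

      first : ∀ j k l ν → suc j ℕ.+ (suc k ℕ.+ l) ≡ ν ℕ.+ ν →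
        1# * Q ^ suc j + P ^ k * Q ^ suc l + P ^ suc k * Q ^ suc (j ℕ.+ l) ≡ P ^ (ν ℕ.+ ν) + 1# → j ≡ 2 × k ≡ 1 × l ≡ 1
      first j k l ν n e = solve-Equation j k l ν
        (trans (ℕ-solve 3 (λ j k l → ℕ-con 2 ⊹ (j ⊹ k ⊹ l) ≐ ℕ-con 1 ⊹ j ⊹ (ℕ-con 1 ⊹ k ⊹ l)) refl j k l) n)
        (trans (sym (cancel₁ (Q ^ suc j))) e)

      second : ∀ i j l ν → suc i ℕ.+ j ℕ.+ (1 ℕ.+ l) ≡ ν ℕ.+ ν →
        P ^ i * Q ^ suc j + 1# * Q ^ suc l + P ^ suc (i ℕ.+ 0) * Q ^ suc (j ℕ.+ l) ≡ P ^ (ν ℕ.+ ν) + 1# → l ≡ 2 × i ≡ 1 × j ≡ 1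
      second i j l ν n e = solve-Equation l i j ν
        (trans (ℕ-solve 3 (λ l i j → ℕ-con 2 ⊹ (l ⊹ i ⊹ j) ≐ ℕ-con 1 ⊹ i ⊹ j ⊹ (ℕ-con 1 ⊹ l)) refl l i j) n)
        (trans (trans (cong₂ (λ a b → Q ^ suc l + P ^ i * Q ^ suc j + P ^ suc a * Q ^ suc b) (sym (ℕ.+-identityʳ i)) (ℕ.+-comm l j))
          (solve 3 (λ x y z → x :+ y :+ z := y :+ con 1₄ :* x :+ z) refl (Q ^ suc l) (P ^ i * Q ^ suc j) (P ^ suc (i ℕ.+ 0) * Q ^ suc (j ℕ.+ l)))) e)

      third : ∀ i k m x y z ν → P ^ suc i * x + P ^ suc k * y + P ^ suc m * z ≢ P ^ (suc ν ℕ.+ suc ν) + 1#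
      third i k m x y z ν e = P∤1 (∣-+⁻ˡ (subst (P ∣_) e
        (∣-+ (∣-+ (∣-*ʳ x (∣-^ i ∣-refl)) (∣-*ʳ y (∣-^ k ∣-refl))) (∣-*ʳ z (∣-^ m ∣-refl))))
        (∣-^ (ν ℕ.+ suc ν) ∣-refl))

    -- The right side of `divided` is 1 modulo `P`, so one of the exponents `i` and `k` vanishes.
    -- The two possibilities differ by exchanging the factors.
    exponents-of-factors : ∀ i j k l ν → 0 < ν → suc i ℕ.+ j ℕ.+ (suc k ℕ.+ l) ≡ ν ℕ.+ ν →
      (P ^ suc i * Q ^ j + 1#) * (P ^ suc k * Q ^ l + 1#) ≡ G P (suc (ν ℕ.+ ν)) →
      (i ≡ 0 × j ≡ 2 × k ≡ 1 × l ≡ 1) ⊎ (i ≡ 1 × j ≡ 1 × k ≡ 0 × l ≡ 2)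
    exponents-of-factors zero j k l ν _ n e =
      let j≡ , k≡ , l≡ = first j k l ν n (divided 0 j k l ν e) in inj₁ (refl , j≡ , k≡ , l≡)
    exponents-of-factors (suc i) j zero l ν _ n e =
      let l≡ , i≡ , j≡ = second (suc i) j l ν n (divided (suc i) j 0 l ν e) in inj₂ (i≡ , j≡ , refl , l≡)
    exponents-of-factors (suc i) j (suc k) l (suc ν) _ n e =
      contradiction (divided (suc i) j (suc k) l (suc ν) e) (third i k (suc i ℕ.+ suc k) _ _ _ ν)

-- Four primes forming two pairs P, P + 1 and R, R + 1.

module PairedPrimes (𝓟 : PolynomialRing) where

  open PolynomialRing 𝓟
  open Primes 𝓟
  open Geometric 𝓟
  open Derivation 𝓟
  open Shapes 𝓟

  open ≡-Reasoning

  private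
    variable
      x y z w : Carrier

  +1-swap : x + 1# ≡ y → y + 1# ≡ x
  +1-swap {x} e = trans (cong (_+ 1#) (sym e)) (+-cancelʳ x 1#)

  ∤-G-odd : Irreducible y → y ∣ x * (x + 1#) → ∀ k → y ∤ G x (suc (k ℕ.+ k))
  ∤-G-odd {y} {x} iy d k e = Irreducible.p∤1 iy (∣-+⁻ˡ (subst (y ∣_) (G-odd x k) e) (∣-*ʳ _ d))

  ∤-+1 : Irreducible x → x ∤ x + 1#
  ∤-+1 ix d = Irreducible.p∤1 ix (∣-+⁻ˡ d ∣-refl)

  monic-G-odd : MonicIrreducible x → ∀ k → Monic (G x (suc (k ℕ.+ k)))
  monic-G-odd xx k = proj₁ (monic-deg-G (proj₁ xx) (irreducible-deg (proj₂ xx)) (k ℕ.+ k))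

  G-odd-∣1 : MonicIrreducible x → ∀ k → G x (suc (k ℕ.+ k)) ∣ 1# → k ≡ 0
  G-odd-∣1 xx zero    d = refl
  G-odd-∣1 {x} xx (suc k) d = contradiction
    (trans (sym (proj₂ (monic-deg-G (proj₁ xx) dx (suc k ℕ.+ suc k)))) (∣1⇒deg≡0 d))
    (≢-sym (ℕ.<⇒≢ (ℕ.≤-trans dx (ℕ.m≤m+n (deg x) _))))
    where dx = irreducible-deg (proj₂ xx)

  ∣-power : MonicIrreducible y → Monic w → ∀ m → w ∣ y ^ m * 1# → ∃[ e ] w ≡ y ^ e
  ∣-power {y} {w} yy mw m d =
    let e , v , _ , eq , v∣1 = ∣-^* yy w m 1# d
        v≡1 = monic-∣1 (monic-cancelˡ (y ^ e) v (monic-^ e (proj₁ yy)) (subst Monic eq mw)) v∣1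
    in e , trans eq (trans (cong (y ^ e *_) v≡1) (*-identityʳ _))

  ∣-two-powers : MonicIrreducible y → MonicIrreducible z → Monic w → ∀ m n → w ∣ y ^ m * (z ^ n * 1#) →
    ∃[ e ] ∃[ f ] w ≡ y ^ e * z ^ f
  ∣-two-powers {y} {z} {w} yy zz mw m n d =
    let e , v , _ , eq , v∣ = ∣-^* yy w m _ d
        f , v≡ = ∣-power zz (monic-cancelˡ (y ^ e) v (monic-^ e (proj₁ yy)) (subst Monic eq mw)) n v∣
    in e , f , trans eq (cong (y ^ e *_) v≡)

  ∣-three-powers : MonicIrreducible x → MonicIrreducible y → MonicIrreducible z → Monic w → ∀ l m n →
    w ∣ x ^ l * (y ^ m * (z ^ n * 1#)) → ∃[ e ] ∃[ f ] ∃[ g ] w ≡ x ^ e * (y ^ f * z ^ g)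
  ∣-three-powers {x} xx yy zz mw l m n d =
    let e , v , _ , eq , v∣ = ∣-^* xx _ l _ d
        f , g , v≡ = ∣-two-powers yy zz (monic-cancelˡ (x ^ e) v (monic-^ e (proj₁ xx)) (subst Monic eq mw)) m n v∣
    in e , f , g , trans eq (cong (x ^ e *_) v≡)

  σ**-+1-∣ : ∀ x a → 0 < a → x + 1# ∣ σ** x a
  σ**-+1-∣ x a 0<a = divides (half a) 0<a
    where
    divides : ∀ {a} (h : Halved a) → 0 < a → x + 1# ∣ σ**ᴴ x h
    divides (odd m)  _ = ∣-factorˡ _ _
    divides (even m) _ = ∣-factorˡ _ _

  -- G X 3 = (X + ω) (X + ω + 1), the product of two further translates of X.
  NoCubes : Carrier → Set
  NoCubes A = ∀ X → MonicIrreducible X → X ∣ A → X + 1# ∣ A → G X 3 ∤ A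

  -- `X` and `Y` divide X (X + 1), hence not the odd sum. Only `P` and `Q` remain, of degree at most
  -- deg X, so `G≡*⇒k≤1` applies; the value 1 is excluded by `NoCubes`.
  large-prime : ∀ A → NoCubes A → ∀ X Y P Q → MonicIrreducible X → MonicIrreducible Y → MonicIrreducible P → MonicIrreducible Q →
    X ≢ P → X ≢ Q → P ≢ Q → Y ∣ X * (X + 1#) →
    deg P ≤ deg X → deg Q ≤ deg X → ∀ m n r s → A ≡ X ^ m * (Y ^ n * (P ^ r * (Q ^ s * 1#))) → X ∣ A → X + 1# ∣ A →
    ∀ k → G X (suc (k ℕ.+ k)) ∣ A → k ≡ 0
  large-prime A nc X Y P Q xx yy pp qq X≢P X≢Q P≢Q Y∣ P≤X Q≤X m n r s A≡ X∣A X+1∣A k g∣A =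
    let g = G X (suc (k ℕ.+ k))
        e , f , g≡ = ∣-two-powers pp qq (monic-G-odd xx k) r s
          (strip (proj₂ yy) g n _ (∤-G-odd (proj₂ yy) Y∣ k)
            (strip (proj₂ xx) g m _ (∤-G-odd (proj₂ xx) (∣-factorˡ X _) k) (subst (g ∣_) A≡ g∣A)))
    in at-most-one k g∣A (G≡*⇒k≤1 xx pp qq X≢P X≢Q P≢Q P≤X Q≤X k e f g≡)
    where
    at-most-one : ∀ k → G X (suc (k ℕ.+ k)) ∣ A → k ≤ 1 → k ≡ 0
    at-most-one zero          _   _ = refl
    at-most-one (suc zero)    g∣A _ = contradiction g∣A (nc X xx X∣A X+1∣A)
    at-most-one (suc (suc k)) _   (s≤s ())

  -- `R` and `S` trade exponents between the two sides. Whatever `M` contains, c < d leaves too many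
  -- factors `R` on the left and d < c too many factors `S`.
  equal-exponents : ∀ R S → MonicIrreducible R → MonicIrreducible S → R ≢ S → ∀ M N c d → R ∤ N → S ∤ N →
    M * (S ^ c * R ^ d) ≡ N * (R ^ c * S ^ d) → c ≡ d × M ≡ N
  equal-exponents R S rr ss R≢S M N c d R∤N S∤N e with ℕ.<-cmp c d
  ... | tri≈ _ refl _ = refl , *-cancelˡ (R ^ c * S ^ c) M N (*-≢0 (^-≢0 c (irreducible≢0 (proj₂ rr))) (^-≢0 c (irreducible≢0 (proj₂ ss))))
        (trans (solve 3 (λ m r s → r :* s :* m := m :* (s :* r)) refl M (R ^ c) (S ^ c)) (trans e (*-comm N _)))
  ... | tri< c<d _ _ = contradiction (R∣ c d c<d e) λ R∣ → ∤-* (proj₂ rr) N _ R∤N (∤-^ (proj₂ rr) S (d ℕ.∸ c) (≢⇒∤ rr ss R≢S)) R∣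
    where
    R∣ : ∀ c d → c < d → M * (S ^ c * R ^ d) ≡ N * (R ^ c * S ^ d) → R ∣ N * S ^ (d ℕ.∸ c)
    R∣ zero (suc d) _ e = subst (R ∣_) (trans e (cong (N *_) (*-identityˡ _))) (∣-*ˡ M (∣-*ˡ 1# (∣-factorˡ R _)))
    R∣ (suc c) (suc d) (s≤s lt) e = R∣ c d lt (*-cancelˡ (R * S) _ _ (*-≢0 (irreducible≢0 (proj₂ rr)) (irreducible≢0 (proj₂ ss)))
      (trans (solve 5 (λ r s m x y → (r :* s) :* (m :* (x :* y)) := m :* ((s :* x) :* (r :* y))) refl R S M (S ^ c) (R ^ d))
        (trans e (solve 5 (λ r s m x y → m :* ((r :* x) :* (s :* y)) := (r :* s) :* (m :* (x :* y))) refl R S N (R ^ c) (S ^ d)))))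
  ... | tri> _ _ d<c = contradiction (S∣ c d d<c e) λ S∣ → ∤-* (proj₂ ss) N _ S∤N (∤-^ (proj₂ ss) R (c ℕ.∸ d) (≢⇒∤ ss rr (≢-sym R≢S))) S∣
    where
    S∣ : ∀ c d → d < c → M * (S ^ c * R ^ d) ≡ N * (R ^ c * S ^ d) → S ∣ N * R ^ (c ℕ.∸ d)
    S∣ (suc c) zero _ e = subst (S ∣_) (trans e (cong (N *_) (*-identityʳ _))) (∣-*ˡ M (∣-*ʳ 1# (∣-factorˡ S _)))
    S∣ (suc c) (suc d) (s≤s lt) e = S∣ c d lt (*-cancelˡ (R * S) _ _ (*-≢0 (irreducible≢0 (proj₂ rr)) (irreducible≢0 (proj₂ ss)))
      (trans (solve 5 (λ r s m x y → (r :* s) :* (m :* (x :* y)) := m :* ((s :* x) :* (r :* y))) refl R S M (S ^ c) (R ^ d))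
        (trans e (solve 5 (λ r s m x y → m :* ((r :* x) :* (s :* y)) := (r :* s) :* (m :* (x :* y))) refl R S N (R ^ c) (S ^ d)))))

  module TwoPairs
    (P Q R S : Carrier)
    (pp : MonicIrreducible P) (qq : MonicIrreducible Q) (rr : MonicIrreducible R) (ss : MonicIrreducible S)
    (P+1 : P + 1# ≡ Q) (R+1 : R + 1# ≡ S)
    (P≢R : P ≢ R) (P≢S : P ≢ S) (Q≢R : Q ≢ R) (Q≢S : Q ≢ S) (P≤R : deg P ≤ deg R)
    (a b c d : ℕ)
    where

    A = P ^ a * (Q ^ b * (R ^ c * (S ^ d * 1#)))

    private
      Q+1 = +1-swap P+1
      S+1 = +1-swap R+1
      Q≡P : deg Q ≡ deg P
      Q≡P = trans (cong deg (sym P+1)) (deg-+1 (proj₁ pp) (irreducible-deg (proj₂ pp)))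
      S≡R : deg S ≡ deg R
      S≡R = trans (cong deg (sym R+1)) (deg-+1 (proj₁ rr) (irreducible-deg (proj₂ rr)))
      P≢Q : P ≢ Q
      P≢Q e = ∤-+1 (proj₂ pp) (subst (P ∣_) (trans e (sym P+1)) ∣-refl)
      R≢S : R ≢ S
      R≢S e = ∤-+1 (proj₂ rr) (subst (R ∣_) (trans e (sym R+1)) ∣-refl)

    module _ (nc : NoCubes A) (perfect : σ** P a * (σ** Q b * (σ** R c * (σ** S d * 1#))) ≡ A) where
      private
        σR∣A : σ** R c ∣ A
        σR∣A = subst (σ** R c ∣_) perfect (∣-*ˡ _ (∣-*ˡ _ (∣-factorˡ _ _)))
        σS∣A : σ** S d ∣ A
        σS∣A = subst (σ** S d ∣_) perfect (∣-*ˡ _ (∣-*ˡ _ (∣-*ˡ _ (∣-factorˡ _ _))))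

        R-odd : ∀ k → G R (suc (k ℕ.+ k)) ∣ σ** R c → k ≡ 0
        R-odd = positive c refl
          where
          -- The exponent may be 0; then σ** is 1 and no divisibility of `A` by `R` is available.
          -- The copy `e` of `c` allows the case distinction.
          positive : ∀ e → e ≡ c → ∀ k → G R (suc (k ℕ.+ k)) ∣ σ** R e → k ≡ 0
          positive zero    _    k g∣ = G-odd-∣1 rr k g∣
          positive (suc e) refl k g∣ = large-prime A nc R S P Q rr ss pp qq (≢-sym P≢R) (≢-sym Q≢R) P≢Q
            (subst (λ z → S ∣ R * z) (sym R+1) (∣-factorʳ S R)) P≤R (subst (_≤ deg R) (sym Q≡P) P≤R) c d a b
            (solve 4 (λ p q r s → p :* (q :* (r :* (s :* con 1₄))) := r :* (s :* (p :* (q :* con 1₄)))) refl (P ^ a) (Q ^ b) (R ^ c) (S ^ d))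
            (∣-*ˡ _ (∣-*ˡ _ (∣-*ʳ _ (∣-^ e ∣-refl)))) (∣-trans (σ**-+1-∣ R c (s≤s z≤n)) σR∣A) k (∣-trans g∣ σR∣A)

        S-odd : ∀ k → G S (suc (k ℕ.+ k)) ∣ σ** S d → k ≡ 0
        S-odd = positive d refl
          where
          positive : ∀ e → e ≡ d → ∀ k → G S (suc (k ℕ.+ k)) ∣ σ** S e → k ≡ 0
          positive zero    _    k g∣ = G-odd-∣1 ss k g∣
          positive (suc e) refl k g∣ = large-prime A nc S R P Q ss rr pp qq (≢-sym P≢S) (≢-sym Q≢S) P≢Q
            (subst (λ z → R ∣ S * z) (sym S+1) (∣-factorʳ R S)) (subst (deg P ≤_) (sym S≡R) P≤R) (subst₂ _≤_ (sym Q≡P) (sym S≡R) P≤R) d c a b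
            (solve 4 (λ p q r s → p :* (q :* (r :* (s :* con 1₄))) := s :* (r :* (p :* (q :* con 1₄)))) refl (P ^ a) (Q ^ b) (R ^ c) (S ^ d))
            (∣-*ˡ _ (∣-*ˡ _ (∣-*ˡ _ (∣-*ʳ _ (∣-^ e ∣-refl))))) (∣-trans (σ**-+1-∣ S d (s≤s z≤n)) σS∣A) k (∣-trans g∣ σS∣A)

        σR = σ**-plain R c R-odd
        σS = σ**-plain S d S-odd

        M = σ** P a * σ** Q b
        N = P ^ a * Q ^ b

        -- Cancelling the powers of `R` and `S` leaves σ** (P ^ a) σ** (Q ^ b) = P ^ a Q ^ b. The
        -- smaller pair thus involves only `P` and `Q`, which divide no odd sum of `P` or `Q`.
        rs : c ≡ d × M ≡ N
        rs = equal-exponents R S rr ss R≢S M N c d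
          (∤-* (proj₂ rr) _ _ (∤-^ (proj₂ rr) P a (≢⇒∤ rr pp (≢-sym P≢R))) (∤-^ (proj₂ rr) Q b (≢⇒∤ rr qq (≢-sym Q≢R))))
          (∤-* (proj₂ ss) _ _ (∤-^ (proj₂ ss) P a (≢⇒∤ ss pp (≢-sym P≢S))) (∤-^ (proj₂ ss) Q b (≢⇒∤ ss qq (≢-sym Q≢S))))
          (begin
            M * (S ^ c * R ^ d)  ≡⟨ cong₂ (λ y z → M * (y ^ c * z ^ d)) R+1 S+1 ⟨
            M * ((R + 1#) ^ c * (S + 1#) ^ d)  ≡⟨ cong₂ (λ y z → M * (y * z)) (proj₂ σR) (proj₂ σS) ⟨
            M * (σ** R c * σ** S d)  ≡⟨ solve 4 (λ p q r s → (p :* q) :* (r :* s) := p :* (q :* (r :* (s :* con 1₄)))) refl (σ** P a) (σ** Q b) (σ** R c) (σ** S d) ⟩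
            σ** P a * (σ** Q b * (σ** R c * (σ** S d * 1#))) ≡⟨ perfect ⟩
            A  ≡⟨ solve 4 (λ p q r s → p :* (q :* (r :* (s :* con 1₄))) := (p :* q) :* (r :* s)) refl (P ^ a) (Q ^ b) (R ^ c) (S ^ d) ⟩
            N * (R ^ c * S ^ d)                            ∎)

        ∣N⇒∣1 : ∀ w → P ∤ w → Q ∤ w → w ∣ N → w ∣ 1#
        ∣N⇒∣1 w P∤w Q∤w d = strip (proj₂ qq) w b 1# Q∤w (strip (proj₂ pp) w a _ P∤w (subst (λ z → w ∣ P ^ a * z) (sym (*-identityʳ _)) d))

        P-odd : ∀ k → G P (suc (k ℕ.+ k)) ∣ σ** P a → k ≡ 0
        P-odd k g∣ = G-odd-∣1 pp k (∣N⇒∣1 _ (∤-G-odd (proj₂ pp) (∣-factorˡ P _) k)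
          (∤-G-odd (proj₂ qq) (subst (λ z → Q ∣ P * z) (sym P+1) (∣-factorʳ Q P)) k)
          (subst (G P (suc (k ℕ.+ k)) ∣_) (proj₂ rs) (∣-*ʳ _ g∣)))

        Q-odd : ∀ k → G Q (suc (k ℕ.+ k)) ∣ σ** Q b → k ≡ 0
        Q-odd k g∣ = G-odd-∣1 qq k (∣N⇒∣1 _
          (∤-G-odd (proj₂ pp) (subst (λ z → P ∣ Q * z) (sym Q+1) (∣-factorʳ P Q)) k)
          (∤-G-odd (proj₂ qq) (∣-factorˡ Q _) k)
          (subst (G Q (suc (k ℕ.+ k)) ∣_) (proj₂ rs) (∣-*ˡ _ g∣)))

        σP = σ**-plain P a P-odd
        σQ = σ**-plain Q b Q-odd

        a≡b : a ≡ b
        a≡b = proj₁ (exponent-unique (proj₂ pp) a b (Q ^ b) (Q ^ a) (∤-^ (proj₂ pp) Q b P∤Q) (∤-^ (proj₂ pp) Q a P∤Q) (begin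
          P ^ a * Q ^ b  ≡⟨ proj₂ rs ⟨
          σ** P a * σ** Q b  ≡⟨ cong₂ _*_ (trans (proj₂ σP) (cong (_^ a) P+1)) (trans (proj₂ σQ) (cong (_^ b) Q+1)) ⟩
          Q ^ a * P ^ b  ≡⟨ *-comm _ _ ⟩
          P ^ b * Q ^ a                     ∎))
          where
          P∤Q : P ∤ Q
          P∤Q = ≢⇒∤ pp qq P≢Q

      twoPairs : a ≡ b × c ≡ d × TwoOrMersenne a × TwoOrMersenne c
      twoPairs = a≡b , proj₁ rs , proj₁ σP , proj₁ σR

-- Arithmetic of the exponents of A.

module ExponentArithmetic (𝓟 : PolynomialRing) where

  open Geometric 𝓟 using (mersenne; suc-mersenne; n+n≢suc[m+m]; n+n-injective)
  open Shapes 𝓟 using (TwoOrMersenne; Shape; plain; double; single)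
  open import Data.Nat.Base using (_+_; _*_; _^_)
  open import Data.Nat.Coprimality using (coprime?; coprime-divisor)
  open import Data.Nat.Divisibility using (_∣_; _∤_; ∣-refl; ∣⇒≤; ∣n⇒∣m*n; ∣m∣n⇒∣m+n; m∣m*n; n∣m*n)
  open import Data.Nat.Properties
  open +-*-Solver using (solve; _:+_; _:*_; _:=_; con)

  2^suc≡ : ∀ s → 2 ^ suc s ≡ 2 ^ s + 2 ^ s
  2^suc≡ s = cong (2 ^ s +_) (+-identityʳ (2 ^ s))

  even-twoOrMersenne : ∀ {e} m → 0 < m → TwoOrMersenne e → e ≡ m + m → e ≡ 2
  even-twoOrMersenne m       _ (inj₁ e≡2) _ = e≡2
  even-twoOrMersenne (suc m) _ (inj₂ (suc n , e≡)) e = contradiction (trans (sym e) e≡) (n+n≢suc[m+m] (suc m) (mersenne n))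
  even-twoOrMersenne (suc m) _ (inj₂ (zero , e≡)) e = contradiction (trans (sym e) e≡) λ ()

  -- Apart from parity, 1 + 2 ^ (r + 1) = 2 ^ n - 1 halves to make 2 ^ r a Mersenne number, hence
  -- odd.
  1+2^-twoOrMersenne : ∀ r → TwoOrMersenne (suc (2 ^ suc r)) → r ≡ 0
  1+2^-twoOrMersenne r (inj₁ e) = contradiction (trans (sym (2^suc≡ r)) (suc-injective e)) (n+n≢suc[m+m] (2 ^ r) 0)
  1+2^-twoOrMersenne r (inj₂ (suc n , e)) = odd n r (n+n-injective (2 ^ r) (mersenne n) (trans (sym (2^suc≡ r)) (suc-injective e)))
    where
    odd : ∀ n r → 2 ^ r ≡ mersenne n → r ≡ 0
    odd zero    r e = contradiction e (≢-sym (<⇒≢ (m^n>0 2 r)))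
    odd (suc n) zero    e = refl
    odd (suc n) (suc r) e = contradiction (trans (sym (2^suc≡ r)) e) (n+n≢suc[m+m] (2 ^ r) (mersenne n))

  3∤2^ : ∀ s → 3 ∤ 2 ^ s
  3∤2^ zero    d = contradiction (∣⇒≤ d) λ { (s≤s ()) }
  3∤2^ (suc s) d = 3∤2^ s (coprime-divisor (from-yes (coprime? 3 2)) d)

  -- The bounds on `x` place b + 1 strictly between 2 ^ s and 2 ^ (s + 1), so `b` is not Mersenne;
  -- and b > 2 ^ s ≥ 4 excludes b = 2.
  ¬one-single : ∀ {U a b x s} → 5 ≤ U → suc a ≡ U + 2 ^ s → suc U ≡ 2 ^ s ⊎ U ≡ suc (2 ^ s) → TwoOrMersenne b →
    a ≡ b + x → 2 ≤ x → ¬ suc (suc x) ≤ U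
  ¬one-single {U} {a} {b} {x} {s} 5≤U suc-a U≡ b∈ a≡ 2≤x x≤ = cases b∈
    where
    U≤ : U ≤ suc (2 ^ s)
    U≤ = [ (λ e → ≤-trans (n≤1+n U) (≤-trans (≤-reflexive e) (n≤1+n _))) , ≤-reflexive ]′ U≡
    4≤ : 4 ≤ 2 ^ s
    4≤ = ≤-pred (≤-trans 5≤U U≤)
    sum : suc b + x ≡ U + 2 ^ s
    sum = trans (cong suc (sym a≡)) suc-a
    lower : suc (suc (2 ^ s)) ≤ suc b
    lower = +-cancelʳ-≤ x _ _ (≤-trans (≤-reflexive (cong (λ z → suc (suc z)) (+-comm (2 ^ s) x)))
      (≤-trans (+-monoˡ-≤ (2 ^ s) x≤) (≤-reflexive (sym sum))))
    upper : suc (suc b) ≤ 2 ^ suc s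
    upper = ≤-pred (≤-trans (≤-trans (≤-reflexive (+-comm 2 (suc b))) (+-monoʳ-≤ (suc b) 2≤x))
      (≤-trans (≤-reflexive sum) (≤-trans (+-monoˡ-≤ (2 ^ s) U≤) (≤-reflexive (cong suc (sym (2^suc≡ s)))))))
    cases : ¬ TwoOrMersenne b
    cases (inj₁ refl) = contradiction (≤-trans (s≤s (s≤s 4≤)) lower) λ { (s≤s (s≤s (s≤s ()))) }
    cases (inj₂ (n , refl)) = contradiction (<-≤-trans (s≤s (≤-reflexive (sym (suc-mersenne n)))) upper)
      (≤⇒≯ (^-monoʳ-≤ 2 {suc s} {n} (≰⇒> λ n≤s → contradiction (≤-trans lower (≤-trans (≤-reflexive (suc-mersenne n)) (^-monoʳ-≤ 2 {n} {s} n≤s)))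
        (<⇒≱ (n<1+n _) ∘ ≤-trans (n≤1+n _)))))

  -- Eliminating `b` gives U + 1 = m + 3 in the first case of `U≡` and U = m in the second. With 3 ∣
  -- m these contradict 3 ∤ 2 ^ s and 3 ∤ U respectively.
  ¬single-double : ∀ {U b m s} → suc U ≡ 2 ^ s ⊎ U ≡ suc (2 ^ s) → 3 ∤ U → suc b ≡ 2 * U → b ≡ 2 ^ s + m → ¬ 3 ∣ m
  ¬single-double {U} {b} {m} {s} U≡ 3∤U suc-b b≡ 3∣m with U≡
  ... | inj₁ e = 3∤2^ s (subst (3 ∣_) e (subst (λ z → 3 ∣ suc z) (sym U≡2+m) (∣m∣n⇒∣m+n (∣-refl {3}) 3∣m)))
    where
    U≡2+m : U ≡ 2 + m
    U≡2+m = +-cancelˡ-≡ U _ _ (trans (cong (U +_) (sym (+-identityʳ U))) (trans (sym suc-b) (trans (cong suc (trans b≡ (cong (_+ m) (sym e))))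
      (solve 2 (λ u m → con 2 :+ u :+ m := u :+ (con 2 :+ m)) refl U m))))
  ... | inj₂ e = 3∤U (subst (3 ∣_) (sym U≡m) 3∣m)
    where
    U≡m : U ≡ m
    U≡m = +-cancelˡ-≡ U _ _ (trans (cong (U +_) (sym (+-identityʳ U))) (trans (sym suc-b) (trans (cong suc b≡) (cong (_+ m) (sym e)))))

  private
    twos : ∀ {c d t} → d ≡ 2 → TwoOrMersenne c → c ≡ d + t * d → t ≡ 0 × c ≡ 2 × d ≡ 2
    twos {c} {_} {t} refl c∈ c≡ = t≡0 t (trans (sym c≡2) c≡) , c≡2 , refl
      where
      c≡2 = even-twoOrMersenne (suc t) (s≤s z≤n) c∈ (trans c≡ (solve 1 (λ t → con 2 :+ t :* con 2 := (con 1 :+ t) :+ (con 1 :+ t)) refl t))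
      t≡0 : ∀ t → 2 ≡ 2 + t * 2 → t ≡ 0
      t≡0 zero _ = refl

    4≤2^+2^ : ∀ s r → 4 ≤ 2 ^ suc s + 2 ^ suc r
    4≤2^+2^ s r = +-mono-≤ (*-monoʳ-≤ 2 (m^n>0 2 s)) (*-monoʳ-≤ 2 (m^n>0 2 r))

    -- With d = 1 and c = 1 + t, the amount i c + k d stays at least 2 below `U` because `j` is
    -- positive.
    one : ∀ {U a b c d s i j k l t N} → 5 ≤ U → U ≡ suc N → N ≡ i + j + (k + l + t * (i + j)) → 0 < i → 0 < j → 0 < k →
      suc a ≡ U + 2 ^ s → suc U ≡ 2 ^ s ⊎ U ≡ suc (2 ^ s) → TwoOrMersenne b →
      c ≡ 1 + t * 1 → d ≡ 1 → ¬ a ≡ b + (i * c + k * d)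
    one {s = s} {suc i} {suc j} {suc k} {l} {t} 5≤U refl refl _ _ _ sa U≡ b∈ refl refl a≡ = ¬one-single {s = s} 5≤U sa U≡ b∈ a≡
      (+-mono-≤ (s≤s z≤n) (s≤s z≤n))
      (s≤s (≤-trans (m≤m+n _ (j + (l + t * suc j))) (≤-reflexive
        (solve 5 (λ i j k l t → con 1 :+ ((con 1 :+ i) :* (con 1 :+ t :* con 1) :+ (con 1 :+ k) :* con 1) :+ (j :+ (l :+ t :* (con 1 :+ j)))
          := (con 1 :+ i) :+ (con 1 :+ j) :+ (con 1 :+ k :+ l :+ t :* ((con 1 :+ i) :+ (con 1 :+ j)))) refl i j k l t))))

    -- Being of the form 1 + 2 ^ (r + 1), the exponent `d` is 3, so `c` and i c + k d are multiples
    -- of 3.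
    three : ∀ {U a c d s r i k t} → suc U ≡ 2 ^ s ⊎ U ≡ suc (2 ^ s) → 3 ∤ U → TwoOrMersenne d → d ≡ suc (2 ^ suc r) →
      suc a ≡ 2 ^ suc r * U → c ≡ d + t * d → ¬ a ≡ 2 ^ s + (i * c + k * d)
    three {d = d} {s} {r} {i} {k} {t} U≡ 3∤U d∈ d≡ sa c≡ a≡ with 1+2^-twoOrMersenne r (subst TwoOrMersenne d≡ d∈)
    ... | refl with d≡
    ... | refl with c≡
    ... | refl = ¬single-double {s = s} U≡ 3∤U sa a≡ (∣m∣n⇒∣m+n (∣n⇒∣m*n i (n∣m*n (suc t))) (n∣m*n k))

  -- The shapes determine d = p + q. An even positive `d` must be 2, and then c = 2 (1 + t) is even
  -- too, so c = 2 and t = 0. The odd values are d = 1, refuted by size, and d = 1 + 2 ^ (r + 1),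
  -- refuted modulo 3.
  exponents-are-2 : ∀ {U N a b c d α β p q i j k l t} → 5 ≤ U → U ≡ suc N → N ≡ i + j + (k + l + t * (i + j)) → 3 ∤ U →
    0 < i → 0 < j → 0 < k → 0 < l → Shape U a α p → Shape U b β q → TwoOrMersenne c → TwoOrMersenne d → 0 < d →
    d ≡ p + q → c ≡ d + t * d → a ≡ β + (i * c + k * d) → b ≡ α + (j * c + l * d) → t ≡ 0 × c ≡ 2 × d ≡ 2
  exponents-are-2 5≤U U≡ N≡ 3∤U 0<i 0<j 0<k 0<l (plain _) (plain _) c∈ d∈ 0<d d≡ c≡ a≡ b≡ =
    contradiction 0<d (≤⇒≯ (≤-reflexive d≡))
  exponents-are-2 5≤U U≡ N≡ 3∤U 0<i 0<j 0<k 0<l (plain _) (double r _) c∈ d∈ 0<d d≡ c≡ a≡ b≡ =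
    twos (even-twoOrMersenne (2 ^ r) (m^n>0 2 r) d∈ (trans d≡ (2^suc≡ r))) c∈ c≡
  exponents-are-2 5≤U U≡ N≡ 3∤U 0<i 0<j 0<k 0<l (double s _) (plain _) c∈ d∈ 0<d d≡ c≡ a≡ b≡ =
    twos (even-twoOrMersenne (2 ^ s) (m^n>0 2 s) d∈ (trans d≡ (trans (+-identityʳ _) (2^suc≡ s)))) c∈ c≡
  exponents-are-2 5≤U U≡ N≡ 3∤U 0<i 0<j 0<k 0<l (double s _) (double r _) c∈ d∈ 0<d d≡ c≡ a≡ b≡ = contradiction
    (≤-trans (4≤2^+2^ s r) (≤-reflexive (trans (sym d≡) (even-twoOrMersenne (2 ^ s + 2 ^ r) (+-mono-≤ (m^n>0 2 s) z≤n) d∈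
      (trans d≡ (trans (cong₂ _+_ (2^suc≡ s) (2^suc≡ r)) (solve 2 (λ x y → (x :+ x) :+ (y :+ y) := (x :+ y) :+ (x :+ y)) refl (2 ^ s) (2 ^ r))))))))
    λ { (s≤s (s≤s ())) }
  exponents-are-2 5≤U U≡ N≡ 3∤U 0<i 0<j 0<k 0<l (single _ _ _) (single _ _ _) c∈ d∈ 0<d d≡ c≡ a≡ b≡ = twos d≡ c∈ c≡
  exponents-are-2 {i = i} {j} {k} {l} {t} 5≤U U≡ N≡ 3∤U 0<i 0<j 0<k 0<l (single s sa U≡₂) (plain b∈) c∈ d∈ 0<d d≡ c≡ a≡ b≡ =
    contradiction a≡ (one {s = s} {i} {j} {k} {l} {t} 5≤U U≡ N≡ 0<i 0<j 0<k sa U≡₂ b∈ (trans c≡ (cong (λ d → d + t * d) d≡)) d≡)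
  exponents-are-2 {i = i} {j} {k} {l} {t} 5≤U U≡ N≡ 3∤U 0<i 0<j 0<k 0<l (plain a∈) (single s sb U≡₂) c∈ d∈ 0<d d≡ c≡ a≡ b≡ =
    contradiction b≡ (one {s = s} {j} {i} {l} {k} {t} 5≤U U≡
      (trans N≡ (solve 5 (λ i j k l t → i :+ j :+ (k :+ l :+ t :* (i :+ j)) := j :+ i :+ (l :+ k :+ t :* (j :+ i))) refl i j k l t))
      0<j 0<i 0<l sb U≡₂ a∈ (trans c≡ (cong (λ d → d + t * d) d≡)) d≡)
  exponents-are-2 {i = i} {j} {k} {l} {t} 5≤U U≡ N≡ 3∤U 0<i 0<j 0<k 0<l (single s _ U≡₂) (double r sb) c∈ d∈ 0<d d≡ c≡ a≡ b≡ =
    contradiction b≡ (three {s = s} {r} {j} {l} {t} U≡₂ 3∤U d∈ d≡ sb c≡)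
  exponents-are-2 {i = i} {j} {k} {l} {t} 5≤U U≡ N≡ 3∤U 0<i 0<j 0<k 0<l (double r sa) (single s _ U≡₂) c∈ d∈ 0<d d≡ c≡ a≡ b≡ =
    contradiction a≡ (three {s = s} {r} {i} {k} {t} U≡₂ 3∤U d∈ (trans d≡ (+-comm _ 1)) sa c≡)

  private
    2^≡6⇒⊥ : ∀ s → 7 ≢ suc (2 ^ s)
    2^≡6⇒⊥ s e = 3∤2^ s (subst (3 ∣_) (suc-injective e) (m∣m*n {3} 2))

    single-7 : ∀ {a s} → suc a ≡ 7 + 2 ^ s → 8 ≡ 2 ^ s ⊎ 7 ≡ suc (2 ^ s) → a ≡ 14
    single-7 {s = s} sa (inj₂ e) = contradiction e (2^≡6⇒⊥ s)
    single-7 {s = s} sa (inj₁ e) = suc-injective (trans sa (cong (7 +_) (sym e)))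

    2^suc≡2⇒0 : ∀ s → 2 ^ suc s ≡ 2 → s ≡ 0
    2^suc≡2⇒0 zero    _ = refl
    2^suc≡2⇒0 (suc s) e = contradiction (≤-trans (*-monoʳ-≤ 2 (*-monoʳ-≤ 2 (m^n>0 2 s))) (≤-reflexive e)) λ { (s≤s (s≤s ())) }

    double-7 : ∀ {a} s → 2 ^ suc s ≡ 2 → suc a ≡ 2 ^ suc s * 7 → a ≡ 13 × mersenne (suc s) ≡ 1
    double-7 s e sa with 2^suc≡2⇒0 s e
    ... | refl = suc-injective sa , refl

  -- The factor R S occurs twice in all. Either one prime supplies both, with exponent 2 · 7 - 1 =
  -- 13, and the other has 1 + 6 = 7; or each supplies one, with exponent 7 + 8 - 1 = 14.
  exponents-for-7 : ∀ {a b α β p q} → Shape 7 a α p → Shape 7 b β q → p + q ≡ 2 → a ≡ β + 6 → b ≡ α + 6 →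
    (a ≡ 7 × b ≡ 13) ⊎ (a ≡ 13 × b ≡ 7) ⊎ (a ≡ 14 × b ≡ 14)
  exponents-for-7 (plain _) (double r sb) 2≡ a≡ b≡ =
    let b≡13 , β≡1 = double-7 r 2≡ sb in inj₁ (trans a≡ (cong (_+ 6) β≡1) , b≡13)
  exponents-for-7 (double s sa) (plain _) 2≡ a≡ b≡ =
    let a≡13 , α≡1 = double-7 s (trans (sym (+-identityʳ _)) 2≡) sa in inj₂ (inj₁ (a≡13 , trans b≡ (cong (_+ 6) α≡1)))
  exponents-for-7 (single s sa U≡) (single r sb V≡) _ _ _ = inj₂ (inj₂ (single-7 {s = s} sa U≡ , single-7 {s = r} sb V≡))
  exponents-for-7 (double s _) (double r _) 2≡ _ _ = contradiction (≤-trans (4≤2^+2^ s r) (≤-reflexive 2≡)) λ { (s≤s (s≤s ())) }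
  exponents-for-7 (double s _) (single _ _ _) 2≡ _ _ = contradiction
    (≤-trans (+-monoˡ-≤ 1 (*-monoʳ-≤ 2 (m^n>0 2 s))) (≤-reflexive 2≡)) λ { (s≤s (s≤s ())) }
  exponents-for-7 (single _ _ _) (double s _) 2≡ _ _ = contradiction
    (≤-trans (s≤s (*-monoʳ-≤ 2 (m^n>0 2 s))) (≤-reflexive 2≡)) λ { (s≤s (s≤s ())) }

-- Primes whose successor involves only smaller primes.

module SmoothSuccessor (𝓟 : PolynomialRing) where

  open PolynomialRing 𝓟
  open Primes 𝓟
  open Geometric 𝓟
  open Derivation 𝓟
  open Reducibility 𝓟
  open Shapes 𝓟
  open FactorIdentity 𝓟
  open PairedPrimes 𝓟
  open ExponentArithmetic 𝓟
  import Data.Nat.Divisibility as ℕ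

  open ≡-Reasoning

  ∣-^-pos : ∀ x n → 0 < n → x ∣ x ^ n
  ∣-^-pos x (suc n) _ = ∣-factorˡ x (x ^ n)

  P∣Q^n+1 : ∀ {P Q} → P + 1# ≡ Q → ∀ n → P ∣ Q ^ n + 1#
  P∣Q^n+1 {P} {Q} P+1 n = factorˡ P (G Q n) (trans (cong (_* G Q n) (sym (+1-swap P+1))) (G-telescope Q n))

  module Prime-with-smooth-successor
    {P Q R : Carrier} (P+1 : P + 1# ≡ Q)
    (pp : MonicIrreducible P) (qq : MonicIrreducible Q) (rr : MonicIrreducible R)
    (P≢R : P ≢ R) (Q≢R : Q ≢ R)
    (i j : ℕ) (R+1 : R + 1# ≡ P ^ i * Q ^ j)
    where

    -- Otherwise R = Q ^ j + 1, which is divisible by `P`.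
    0<i : 0 < i
    0<i = ℕ.n≢0⇒n>0 λ i≡0 → P≢R (∣⇒≡ pp rr (subst (P ∣_)
      (trans (cong (_+ 1#) (sym (trans R+1 (trans (cong (λ n → P ^ n * Q ^ j) i≡0) (*-identityˡ _))))) (+-cancelʳ R 1#)) (P∣Q^n+1 P+1 j)))

    0<j : 0 < j
    0<j = ℕ.n≢0⇒n>0 λ j≡0 → Q≢R (∣⇒≡ qq rr (subst (Q ∣_)
      (trans (cong (_+ 1#) (sym (trans R+1 (trans (cong (λ n → P ^ i * Q ^ n) j≡0) (*-identityʳ _))))) (+-cancelʳ R 1#)) (P∣Q^n+1 (+1-swap P+1) i)))

    P∤G : ∀ x → P ∤ G P (suc (x ℕ.+ x))
    P∤G = ∤-G-odd (proj₂ pp) (∣-factorˡ P _)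

    Q∤G : ∀ x → Q ∤ G P (suc (x ℕ.+ x))
    Q∤G = ∤-G-odd (proj₂ qq) (subst (λ z → Q ∣ P * z) (sym P+1) (∣-factorʳ Q P))

    -- Otherwise `G-prime-+1` yields another odd sum of `P`, of length above 1, inside R + 1; but
    -- the only primes there are `P` and `Q`, which do not divide it.
    G≢R : ∀ x → G P (suc (suc x ℕ.+ suc x)) ≢ R
    G≢R x e = let
        w , d = G-prime-+1 (proj₁ pp) (irreducible-deg (proj₂ pp)) x (subst Irreducible (sym e) (proj₂ rr))
        g = G P (suc (suc w ℕ.+ suc w))
        g∣ = subst (g ∣_) (trans (cong (_+ 1#) e) (trans R+1 (cong (P ^ i *_) (sym (*-identityʳ _))))) d
      in contradiction (G-odd-∣1 pp (suc w) (strip (proj₂ qq) g j 1# (Q∤G (suc w)) (strip (proj₂ pp) g i _ (P∤G (suc w)) g∣))) λ ()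

    G≢R^ : deg P ≤ deg R → ∀ x e → G P (suc (suc x ℕ.+ suc x)) ≢ R ^ e
    G≢R^ P≤R x e eq = ≤1 e eq (exponent≤1 pp rr P≢R P≤R (suc x) e (subst (R ^ e ∣_) (sym eq) ∣-refl))
      where
      ≤1 : ∀ e → G P (suc (suc x ℕ.+ suc x)) ≡ R ^ e → ¬ e ≤ 1
      ≤1 zero          eq _ = contradiction (G-odd-∣1 pp (suc x) (subst (_∣ 1#) (sym eq) ∣-refl)) λ ()
      ≤1 (suc zero)    eq _ = G≢R x (trans eq (*-identityʳ R))
      ≤1 (suc (suc _)) _ (s≤s ())

    deg-R : deg R ≡ (i ℕ.+ j) ℕ.* deg P
    deg-R = begin
      deg R  ≡⟨ deg-+1 (proj₁ rr) (irreducible-deg (proj₂ rr)) ⟨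
      deg (R + 1#)  ≡⟨ cong deg R+1 ⟩
      deg (P ^ i * Q ^ j)  ≡⟨ deg-* _ _ (^-≢0 i P≢0) (^-≢0 j Q≢0) ⟩
      deg (P ^ i) ℕ.+ deg (Q ^ j)  ≡⟨ cong₂ ℕ._+_ (deg-^ P i P≢0) (trans (deg-^ Q j Q≢0) (cong (j ℕ.*_) deg-Q)) ⟩
      i ℕ.* deg P ℕ.+ j ℕ.* deg P  ≡⟨ ℕ.*-distribʳ-+ (deg P) i j ⟨
      (i ℕ.+ j) ℕ.* deg P                ∎
      where
      P≢0 = irreducible≢0 (proj₂ pp)
      Q≢0 = irreducible≢0 (proj₂ qq)
      deg-Q : deg Q ≡ deg P
      deg-Q = trans (cong deg (sym P+1)) (deg-+1 (proj₁ pp) (irreducible-deg (proj₂ pp)))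

  ∤-σ**-self : ∀ {R} → Irreducible R → ∀ a → R ∤ σ** R a
  ∤-σ**-self {R} ir a = helper (half a)
    where
    ∤G : ∀ n → R ∤ G R (suc n)
    ∤G n d = Irreducible.p∤1 ir (∣-+⁻ʳ d (∣-factorˡ R _))
    helper : ∀ {a} (h : Halved a) → R ∤ σ**ᴴ R h
    helper zero     = Irreducible.p∤1 ir
    helper (odd m)  = ∤-* ir _ _ (∤-+1 ir) (∤-* ir _ _ (∤G m) (∤G m))
    helper (even m) = ∤-* ir _ _ (∤-+1 ir) (∤-* ir _ _ (∤G (suc m)) (∤G m))

  module ThreePrimes
    (P Q R : Carrier) (pp : MonicIrreducible P) (qq : MonicIrreducible Q) (rr : MonicIrreducible R)
    (P+1 : P + 1# ≡ Q) (P≢R : P ≢ R) (Q≢R : Q ≢ R) (P≤R : deg P ≤ deg R)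
    (a b c : ℕ) (0<c : 0 < c)
    where

    private
      A = P ^ a * (Q ^ b * (R ^ c * 1#))

      Q≤R : deg Q ≤ deg R
      Q≤R = subst (_≤ deg R) (trans (sym (deg-+1 (proj₁ pp) (irreducible-deg (proj₂ pp)))) (cong deg P+1)) P≤R

      R∤^ : ∀ {X} → MonicIrreducible X → X ≢ R → ∀ n → R ∤ X ^ n
      R∤^ xx X≢R n = ∤-^ (proj₂ rr) _ n (≢⇒∤ rr xx (≢-sym X≢R))

    -- `R` would have to come from some σ**. It does not divide its own, and since no odd sum of `P`
    -- or `Q` is a power of `R`, the other two are powers of `Q` and of `P`.
    ¬perfect : σ** P a * (σ** Q b * (σ** R c * 1#)) ≢ A
    ¬perfect perfect = contradiction R∣A (subst (R ∤_) perfect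
      (∤-* (proj₂ rr) _ _ R∤σP (∤-* (proj₂ rr) _ _ R∤σQ (∤-* (proj₂ rr) _ _ (∤-σ**-self (proj₂ rr) c) (Irreducible.p∤1 (proj₂ rr))))))
      where
      R∣A : R ∣ A
      R∣A = ∣-*ˡ _ (∣-*ˡ _ (∣-*ʳ _ (∣-^-pos R c 0<c)))
      R+1∣A : R + 1# ∣ A
      R+1∣A = ∣-trans (σ**-+1-∣ R c 0<c) (subst (σ** R c ∣_) perfect (∣-*ˡ _ (∣-*ˡ _ (∣-factorˡ _ _))))
      successor : ∃[ i ] ∃[ j ] R + 1# ≡ P ^ i * Q ^ j
      successor = ∣-two-powers pp qq (monic-+1 (proj₁ rr) (irreducible-deg (proj₂ rr))) a b
        (strip (proj₂ rr) (R + 1#) c _ (∤-+1 (proj₂ rr)) (subst (R + 1# ∣_)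
          (solve 3 (λ p q r → p :* (q :* (r :* con 1₄)) := r :* (p :* (q :* con 1₄))) refl (P ^ a) (Q ^ b) (R ^ c)) R+1∣A))
      i = proj₁ successor
      j = proj₁ (proj₂ successor)
      R+1 = proj₂ (proj₂ successor)

      no-odd : ∀ {X Y} → MonicIrreducible X → MonicIrreducible Y → X + 1# ≡ Y → X ≢ R → Y ≢ R → deg X ≤ deg R →
        ∀ m n i j → A ≡ X ^ m * (Y ^ n * (R ^ c * 1#)) → R + 1# ≡ X ^ i * Y ^ j → ∀ x → G X (suc (x ℕ.+ x)) ∣ A → x ≡ 0
      no-odd xx yy X+1 X≢R Y≢R X≤R m n i j A≡ R+1 zero    _  = refl
      no-odd {X} {Y} xx yy X+1 X≢R Y≢R X≤R m n i j A≡ R+1 (suc x) g∣ = let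
          open Prime-with-smooth-successor X+1 xx yy rr X≢R Y≢R i j R+1
          g = G X (suc (suc x ℕ.+ suc x))
          e , g≡ = ∣-power rr (monic-G-odd xx (suc x)) c
            (strip (proj₂ yy) g n _ (Q∤G (suc x)) (strip (proj₂ xx) g m _ (P∤G (suc x)) (subst (g ∣_) A≡ g∣)))
        in contradiction g≡ (G≢R^ X≤R x e)

      R∤σP : R ∤ σ** P a
      R∤σP = subst (R ∤_) (sym (trans (proj₂ (σ**-plain P a λ x d → no-odd pp qq P+1 P≢R Q≢R P≤R a b i j refl R+1 x
          (∣-trans d (subst (σ** P a ∣_) perfect (∣-factorˡ _ _))))) (cong (_^ a) P+1)))
        (R∤^ qq Q≢R a)

      R∤σQ : R ∤ σ** Q b
      R∤σQ = subst (R ∤_) (sym (trans (proj₂ (σ**-plain Q b λ x d → no-odd qq pp (+1-swap P+1) Q≢R P≢R Q≤R b a j i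
          (solve 3 (λ p q r → p :* (q :* r) := q :* (p :* r)) refl (P ^ a) (Q ^ b) (R ^ c * 1#)) (trans R+1 (*-comm _ _)) x
          (∣-trans d (subst (σ** Q b ∣_) perfect (∣-*ˡ _ (∣-factorˡ _ _)))))) (cong (_^ b) (+1-swap P+1))))
        (R∤^ pp P≢R b)

  -- The odd sums of `P` and of `Q` need the same analysis; the second instance exchanges `P` with
  -- `Q` and their exponents.
  module Side
    {P Q R S : Carrier} (P+1 : P + 1# ≡ Q)
    (pp : MonicIrreducible P) (qq : MonicIrreducible Q) (rr : MonicIrreducible R) (ss : MonicIrreducible S)
    (P≢R : P ≢ R) (P≢S : P ≢ S) (Q≢R : Q ≢ R) (Q≢S : Q ≢ S) (R≢S : R ≢ S) (P≤R : deg P ≤ deg R) (P≤S : deg P ≤ deg S)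
    (i j k l t : ℕ) (R+1 : R + 1# ≡ P ^ i * Q ^ j) (S+1 : S + 1# ≡ P ^ k * (Q ^ l * R ^ t))
    where

    open Prime-with-smooth-successor P+1 pp qq rr P≢R Q≢R i j R+1

    private
      N = i ℕ.+ j ℕ.+ (k ℕ.+ l ℕ.+ t ℕ.* (i ℕ.+ j))
      P≢0 = irreducible≢0 (proj₂ pp)
      Q≢0 = irreducible≢0 (proj₂ qq)
      R≢0 = irreducible≢0 (proj₂ rr)

    -- As in `G≢R`, except that S + 1 may contain `R`: the smaller sum is then a power of `R`,
    -- against `G≢R^`.
    G≢S : ∀ x → G P (suc (suc x ℕ.+ suc x)) ≢ S
    G≢S x e = let
        w , d = G-prime-+1 (proj₁ pp) (irreducible-deg (proj₂ pp)) x (subst Irreducible (sym e) (proj₂ ss))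
        g = G P (suc (suc w ℕ.+ suc w))
        g∣ = subst (g ∣_) (trans (cong (_+ 1#) e) (trans S+1 (cong (λ z → P ^ k * (Q ^ l * z)) (sym (*-identityʳ _))))) d
        f , g≡ = ∣-power rr (monic-G-odd pp (suc w)) t
          (strip (proj₂ qq) g l _ (Q∤G (suc w)) (strip (proj₂ pp) g k _ (P∤G (suc w)) g∣))
      in G≢R^ P≤R w f g≡

    deg-S : deg S ≡ (k ℕ.+ l ℕ.+ t ℕ.* (i ℕ.+ j)) ℕ.* deg P
    deg-S = begin
      deg S  ≡⟨ deg-+1 (proj₁ ss) (irreducible-deg (proj₂ ss)) ⟨
      deg (S + 1#)  ≡⟨ cong deg S+1 ⟩
      deg (P ^ k * (Q ^ l * R ^ t))  ≡⟨ deg-* _ _ (^-≢0 k P≢0) (*-≢0 (^-≢0 l Q≢0) (^-≢0 t R≢0)) ⟩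
      deg (P ^ k) ℕ.+ deg (Q ^ l * R ^ t)  ≡⟨ cong (deg (P ^ k) ℕ.+_) (deg-* _ _ (^-≢0 l Q≢0) (^-≢0 t R≢0)) ⟩
      deg (P ^ k) ℕ.+ (deg (Q ^ l) ℕ.+ deg (R ^ t))  ≡⟨ cong₂ ℕ._+_ (deg-^ P k P≢0) (cong₂ ℕ._+_ (deg-^ Q l Q≢0) (deg-^ R t R≢0)) ⟩
      k ℕ.* deg P ℕ.+ (l ℕ.* deg Q ℕ.+ t ℕ.* deg R)  ≡⟨ cong₂ (λ y z → k ℕ.* deg P ℕ.+ (l ℕ.* y ℕ.+ t ℕ.* z)) deg-Q deg-R ⟩
      k ℕ.* deg P ℕ.+ (l ℕ.* deg P ℕ.+ t ℕ.* ((i ℕ.+ j) ℕ.* deg P))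
        ≡⟨ ℕ-solve 5 (λ k l t n p → k ⊛ p ⊹ (l ⊛ p ⊹ t ⊛ (n ⊛ p)) ≐ (k ⊹ l ⊹ t ⊛ n) ⊛ p) refl k l t (i ℕ.+ j) (deg P) ⟩
      (k ℕ.+ l ℕ.+ t ℕ.* (i ℕ.+ j)) ℕ.* deg P        ∎
      where
      deg-Q : deg Q ≡ deg P
      deg-Q = trans (cong deg (sym P+1)) (deg-+1 (proj₁ pp) (irreducible-deg (proj₂ pp)))
      open +-*-Solver using () renaming (solve to ℕ-solve; _:+_ to infixl 6 _⊹_; _:*_ to infixl 7 _⊛_; _:=_ to infix 4 _≐_)

    -- Such a sum is prime to `P` and `Q`, and contains `R` and `S` at most once; neither alone is
    -- possible. So it is R S, and `N`, the degree of R S in units of deg P, fixes its length.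
    G-factor : ∀ a b c d x → G P (suc (x ℕ.+ x)) ∣ P ^ a * (Q ^ b * (R ^ c * (S ^ d * 1#))) →
      x ≡ 0 ⊎ (x ℕ.+ x ≡ N × G P (suc (x ℕ.+ x)) ≡ R * S)
    G-factor a b c d zero    _  = inj₁ refl
    G-factor a b c d (suc x) g∣ = let
        e , f , g≡ = ∣-two-powers rr ss (monic-G-odd pp (suc x)) c d
          (strip (proj₂ qq) g b _ (Q∤G (suc x)) (strip (proj₂ pp) g a _ (P∤G (suc x)) g∣))
      in inj₂ (cases e f g≡
        (exponent≤1 pp rr P≢R P≤R (suc x) e (factorˡ _ _ (sym g≡)))
        (exponent≤1 pp ss P≢S P≤S (suc x) f (factorʳ _ _ (sym g≡))))
      where
      g = G P (suc (suc x ℕ.+ suc x))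
      degrees : g ≡ R * S → suc x ℕ.+ suc x ≡ N
      degrees g≡ = ℕ.*-cancelʳ-≡ _ _ (deg P) {{ℕ.>-nonZero (irreducible-deg (proj₂ pp))}} (begin
        (suc x ℕ.+ suc x) ℕ.* deg P ≡⟨ proj₂ (monic-deg-G (proj₁ pp) (irreducible-deg (proj₂ pp)) (suc x ℕ.+ suc x)) ⟨
        deg g  ≡⟨ cong deg g≡ ⟩
        deg (R * S)  ≡⟨ deg-* R S R≢0 (irreducible≢0 (proj₂ ss)) ⟩
        deg R ℕ.+ deg S  ≡⟨ cong₂ ℕ._+_ deg-R deg-S ⟩
        (i ℕ.+ j) ℕ.* deg P ℕ.+ (k ℕ.+ l ℕ.+ t ℕ.* (i ℕ.+ j)) ℕ.* deg P ≡⟨ ℕ.*-distribʳ-+ (deg P) (i ℕ.+ j) _ ⟨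
        N ℕ.* deg P                 ∎)
      cases : ∀ e f → g ≡ R ^ e * S ^ f → e ≤ 1 → f ≤ 1 → suc x ℕ.+ suc x ≡ N × g ≡ R * S
      cases e          zero       g≡ _ _ = contradiction (trans g≡ (*-identityʳ _)) (G≢R^ P≤R x e)
      cases zero       (suc zero) g≡ _ _ = contradiction (trans g≡ (trans (*-identityˡ _) (*-identityʳ S))) (G≢S x)
      cases (suc zero) (suc zero) g≡ _ _ = degrees g≡′ , g≡′
        where
        g≡′ = trans g≡ (cong₂ _*_ (*-identityʳ R) (*-identityʳ S))
      cases (suc (suc _)) _ _ (s≤s ()) _
      cases _ (suc (suc _)) _ _ (s≤s ())

    -- G P U and R are 1 modulo P and modulo Q, hence so is S.
    k-l-positive : ∀ x → G P (suc (x ℕ.+ x)) ≡ R * S → 0 < k × 0 < l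
    k-l-positive x g≡ =
      ℕ.n≢0⇒n>0 (λ k≡0 → contradiction (∣S+1 pp P≢R (∣-*ʳ _ (∣-factorˡ P _)) (subst (P ∣_) (sym R+1) (∣-*ʳ _ (∣-^-pos P i 0<i))))
        (subst (P ∤_) (sym (trans S+1 (trans (cong (λ n → P ^ n * (Q ^ l * R ^ t)) k≡0) (*-identityˡ _))))
          (∤-* (proj₂ pp) _ _ (∤-^ (proj₂ pp) Q l (≢⇒∤ pp qq P≢Q)) (∤-^ (proj₂ pp) R t (≢⇒∤ pp rr P≢R))))) ,
      ℕ.n≢0⇒n>0 (λ l≡0 → contradiction (∣S+1 qq Q≢R (∣-*ʳ _ (subst (λ z → Q ∣ P * z) (sym P+1) (∣-factorʳ Q P))) (subst (Q ∣_) (sym R+1) (∣-*ˡ _ (∣-^-pos Q j 0<j))))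
        (subst (Q ∤_) (sym (trans S+1 (cong (P ^ k *_) (trans (cong (λ n → Q ^ n * R ^ t) l≡0) (*-identityˡ _)))))
          (∤-* (proj₂ qq) _ _ (∤-^ (proj₂ qq) P k (≢⇒∤ qq pp (≢-sym P≢Q))) (∤-^ (proj₂ qq) R t (≢⇒∤ qq rr Q≢R)))))
      where
      P≢Q : P ≢ Q
      P≢Q e = ∤-+1 (proj₂ pp) (subst (P ∣_) (trans e (sym P+1)) ∣-refl)
      ∣S+1 : ∀ {X} → MonicIrreducible X → X ≢ R → X ∣ P * (P + 1#) * (G P x * G P x) → X ∣ R + 1# → X ∣ S + 1#
      ∣S+1 {X} xx X≢R d X∣R+1 = from-product (euclid (proj₂ xx) R (S + 1#) (∣-+⁻ʳ (subst (X ∣_) eq d) X∣R+1))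
        where
        eq : P * (P + 1#) * (G P x * G P x) ≡ R * (S + 1#) + (R + 1#)
        eq = begin
          P * (P + 1#) * (G P x * G P x)  ≡⟨ +-cancelʳ _ 1# ⟨
          (P * (P + 1#) * (G P x * G P x) + 1#) + 1# ≡⟨ cong (_+ 1#) (trans (sym (G-odd P x)) g≡) ⟩
          R * S + 1#  ≡⟨ solve 2 (λ r s → r :* s :+ con 1₄ := r :* (s :+ con 1₄) :+ (r :+ con 1₄)) refl R S ⟩
          R * (S + 1#) + (R + 1#)                    ∎
        from-product : X ∣ R ⊎ X ∣ S + 1# → X ∣ S + 1#
        from-product (inj₁ X∣R) = contradiction (∣⇒≡ xx rr X∣R) X≢R
        from-product (inj₂ d)   = d

  factor-exponents : ∀ {P Q R S} → P + 1# ≡ Q → MonicIrreducible P → MonicIrreducible Q → ∀ i j k l ν → 0 < i → 0 < k → 0 < ν →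
    i ℕ.+ j ℕ.+ (k ℕ.+ l) ≡ ν ℕ.+ ν → R + 1# ≡ P ^ i * Q ^ j → S + 1# ≡ P ^ k * Q ^ l → G P (suc (ν ℕ.+ ν)) ≡ R * S →
    (i ≡ 1 × j ≡ 2 × k ≡ 2 × l ≡ 1) ⊎ (i ≡ 2 × j ≡ 1 × k ≡ 1 × l ≡ 2)
  factor-exponents {P} {R = R} {S} refl pp qq (suc i) j (suc k) l ν _ _ 0<ν n R+1 S+1 g≡ =
    shift (Consecutive.exponents-of-factors pp qq i j k l ν 0<ν n
      (trans (cong₂ (λ y z → (y + 1#) * (z + 1#)) (sym R+1) (sym S+1)) (trans (cong₂ _*_ (+-cancelʳ R 1#) (+-cancelʳ S 1#)) (sym g≡))))
    where
    shift : (i ≡ 0 × j ≡ 2 × k ≡ 1 × l ≡ 1) ⊎ (i ≡ 1 × j ≡ 1 × k ≡ 0 × l ≡ 2) →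
      (suc i ≡ 1 × j ≡ 2 × suc k ≡ 2 × l ≡ 1) ⊎ (suc i ≡ 2 × j ≡ 1 × suc k ≡ 1 × l ≡ 2)
    shift (inj₁ (i≡ , j≡ , k≡ , l≡)) = inj₁ (cong suc i≡ , j≡ , cong suc k≡ , l≡)
    shift (inj₂ (i≡ , j≡ , k≡ , l≡)) = inj₂ (cong suc i≡ , j≡ , cong suc k≡ , l≡)

-- Four primes of which only P and Q form a pair.

module UnpairedPrimes (𝓟 : PolynomialRing) where

  open PolynomialRing 𝓟
  open Primes 𝓟
  open Geometric 𝓟
  open Derivation 𝓟
  open Reducibility 𝓟
  open Shapes 𝓟
  open PairedPrimes 𝓟
  open ExponentArithmetic 𝓟
  open SmoothSuccessor 𝓟
  import Data.Nat.Divisibility as ℕ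

  open ≡-Reasoning

  module _ {P Q R S : Carrier}
    (pp : MonicIrreducible P) (qq : MonicIrreducible Q) (rr : MonicIrreducible R) (ss : MonicIrreducible S)
    (P≢Q : P ≢ Q) (P≢R : P ≢ R) (P≢S : P ≢ S) (Q≢R : Q ≢ R) (Q≢S : Q ≢ S) (R≢S : R ≢ S)
    where

    exponents-unique : ∀ a b c d a′ b′ c′ d′ → P ^ a * (Q ^ b * (R ^ c * S ^ d)) ≡ P ^ a′ * (Q ^ b′ * (R ^ c′ * S ^ d′)) →
      a ≡ a′ × b ≡ b′ × c ≡ c′ × d ≡ d′
    exponents-unique a b c d a′ b′ c′ d′ e = let
        a≡ , e₁ = exponent-unique (proj₂ pp) a a′ _ _ (P∤ b c d) (P∤ b′ c′ d′) e
        b≡ , e₂ = exponent-unique (proj₂ qq) b b′ _ _ (Q∤ c d) (Q∤ c′ d′) e₁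
        c≡ , e₃ = exponent-unique (proj₂ rr) c c′ _ _ (R∤ d) (R∤ d′) e₂
        d≡ , _  = exponent-unique (proj₂ ss) d d′ 1# 1# (Irreducible.p∤1 (proj₂ ss)) (Irreducible.p∤1 (proj₂ ss))
          (trans (*-identityʳ _) (trans e₃ (sym (*-identityʳ _))))
      in a≡ , b≡ , c≡ , d≡
      where
      P∤ : ∀ b c d → P ∤ Q ^ b * (R ^ c * S ^ d)
      P∤ b c d = ∤-* (proj₂ pp) _ _ (∤-^ (proj₂ pp) Q b (≢⇒∤ pp qq P≢Q))
        (∤-* (proj₂ pp) _ _ (∤-^ (proj₂ pp) R c (≢⇒∤ pp rr P≢R)) (∤-^ (proj₂ pp) S d (≢⇒∤ pp ss P≢S)))
      Q∤ : ∀ c d → Q ∤ R ^ c * S ^ d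
      Q∤ c d = ∤-* (proj₂ qq) _ _ (∤-^ (proj₂ qq) R c (≢⇒∤ qq rr Q≢R)) (∤-^ (proj₂ qq) S d (≢⇒∤ qq ss Q≢S))
      R∤ : ∀ d → R ∤ S ^ d
      R∤ d = ∤-^ (proj₂ rr) S d (≢⇒∤ rr ss R≢S)

  *-distrib-^³ : ∀ x y z k l t d → (x ^ k * (y ^ l * z ^ t)) ^ d ≡ x ^ (k ℕ.* d) * (y ^ (l ℕ.* d) * z ^ (t ℕ.* d))
  *-distrib-^³ x y z k l t d = begin
    (x ^ k * (y ^ l * z ^ t)) ^ d  ≡⟨ ^-distrib-* (x ^ k) _ d ⟩
    (x ^ k) ^ d * (y ^ l * z ^ t) ^ d  ≡⟨ cong ((x ^ k) ^ d *_) (^-distrib-* (y ^ l) _ d) ⟩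
    (x ^ k) ^ d * ((y ^ l) ^ d * (z ^ t) ^ d)  ≡⟨ cong₂ _*_ (^-assocʳ x k d) (cong₂ _*_ (^-assocʳ y l d) (^-assocʳ z t d)) ⟩
    x ^ (k ℕ.* d) * (y ^ (l ℕ.* d) * z ^ (t ℕ.* d)) ∎

  *-distrib-^² : ∀ x y i j c → (x ^ i * y ^ j) ^ c ≡ x ^ (i ℕ.* c) * y ^ (j ℕ.* c)
  *-distrib-^² x y i j c = trans (^-distrib-* (x ^ i) _ c) (cong₂ _*_ (^-assocʳ x i c) (^-assocʳ y j c))

  monomial : ∀ P Q R S α β p q i j k l t c d →
    (Q ^ α * (R * S) ^ p) * ((P ^ β * (R * S) ^ q) * ((P ^ i * Q ^ j) ^ c * ((P ^ k * (Q ^ l * R ^ t)) ^ d * 1#))) ≡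
    P ^ (β ℕ.+ (i ℕ.* c ℕ.+ k ℕ.* d)) * (Q ^ (α ℕ.+ (j ℕ.* c ℕ.+ l ℕ.* d)) * (R ^ (p ℕ.+ q ℕ.+ t ℕ.* d) * S ^ (p ℕ.+ q)))
  monomial P Q R S α β p q i j k l t c d = begin
    (Q ^ α * (R * S) ^ p) * ((P ^ β * (R * S) ^ q) * ((P ^ i * Q ^ j) ^ c * ((P ^ k * (Q ^ l * R ^ t)) ^ d * 1#)))
      ≡⟨ cong₂ (λ y z → (Q ^ α * y) * ((P ^ β * z) * ((P ^ i * Q ^ j) ^ c * ((P ^ k * (Q ^ l * R ^ t)) ^ d * 1#))))
           (^-distrib-* R S p) (^-distrib-* R S q) ⟩
    (Q ^ α * (R ^ p * S ^ p)) * ((P ^ β * (R ^ q * S ^ q)) * ((P ^ i * Q ^ j) ^ c * ((P ^ k * (Q ^ l * R ^ t)) ^ d * 1#)))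
      ≡⟨ cong₂ (λ y z → (Q ^ α * (R ^ p * S ^ p)) * ((P ^ β * (R ^ q * S ^ q)) * (y * (z * 1#)))) (*-distrib-^² P Q i j c) (*-distrib-^³ P Q R k l t d) ⟩
    (Q ^ α * (R ^ p * S ^ p)) * ((P ^ β * (R ^ q * S ^ q)) * ((P ^ (i ℕ.* c) * Q ^ (j ℕ.* c)) * ((P ^ (k ℕ.* d) * (Q ^ (l ℕ.* d) * R ^ (t ℕ.* d))) * 1#)))
      ≡⟨ rearrange (Q ^ α) (R ^ p) (S ^ p) (P ^ β) (R ^ q) (S ^ q) (P ^ (i ℕ.* c)) (Q ^ (j ℕ.* c)) (P ^ (k ℕ.* d)) (Q ^ (l ℕ.* d)) (R ^ (t ℕ.* d)) ⟩
    (P ^ β * (P ^ (i ℕ.* c) * P ^ (k ℕ.* d))) * ((Q ^ α * (Q ^ (j ℕ.* c) * Q ^ (l ℕ.* d))) * (((R ^ p * R ^ q) * R ^ (t ℕ.* d)) * (S ^ p * S ^ q)))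
      ≡⟨ cong₂ _*_ (power³ P β (i ℕ.* c) (k ℕ.* d)) (cong₂ _*_ (power³ Q α (j ℕ.* c) (l ℕ.* d))
           (cong₂ _*_ (trans (cong (_* R ^ (t ℕ.* d)) (sym (^-homo-* R p q))) (sym (^-homo-* R (p ℕ.+ q) (t ℕ.* d)))) (sym (^-homo-* S p q)))) ⟩
    P ^ (β ℕ.+ (i ℕ.* c ℕ.+ k ℕ.* d)) * (Q ^ (α ℕ.+ (j ℕ.* c ℕ.+ l ℕ.* d)) * (R ^ (p ℕ.+ q ℕ.+ t ℕ.* d) * S ^ (p ℕ.+ q))) ∎
    where
    power³ : ∀ x k l m → x ^ k * (x ^ l * x ^ m) ≡ x ^ (k ℕ.+ (l ℕ.+ m))
    power³ x k l m = trans (cong (x ^ k *_) (sym (^-homo-* x l m))) (sym (^-homo-* x k (l ℕ.+ m)))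
    rearrange : ∀ qα rp sp pβ rq sq pi qj pk ql rt →
      (qα * (rp * sp)) * ((pβ * (rq * sq)) * ((pi * qj) * ((pk * (ql * rt)) * 1#))) ≡
      (pβ * (pi * pk)) * ((qα * (qj * ql)) * (((rp * rq) * rt) * (sp * sq)))
    rearrange = solve 11 (λ qα rp sp pβ rq sq pi qj pk ql rt →
      (qα :* (rp :* sp)) :* ((pβ :* (rq :* sq)) :* ((pi :* qj) :* ((pk :* (ql :* rt)) :* con 1₄))) :=
      (pβ :* (pi :* pk)) :* ((qα :* (qj :* ql)) :* (((rp :* rq) :* rt) :* (sp :* sq)))) refl

  -- With deg R ≤ deg S, the assumption S ∤ R + 1 says that R + 1 is not `S`; it leaves `P` and `Q`
  -- as the only primes of R + 1.
  module FourPrimes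
    (P Q R S : Carrier)
    (pp : MonicIrreducible P) (qq : MonicIrreducible Q) (rr : MonicIrreducible R) (ss : MonicIrreducible S)
    (P+1 : P + 1# ≡ Q) (P≢R : P ≢ R) (P≢S : P ≢ S) (Q≢R : Q ≢ R) (Q≢S : Q ≢ S) (R≢S : R ≢ S)
    (P≤R : deg P ≤ deg R) (R≤S : deg R ≤ deg S) (S∤R+1 : S ∤ R + 1#)
    (a b c d : ℕ) (0<a : 0 < a) (0<b : 0 < b) (0<c : 0 < c) (0<d : 0 < d)
    where

    private
      A = P ^ a * (Q ^ b * (R ^ c * (S ^ d * 1#)))

    module _ (nc : NoCubes A) (perfect : σ** P a * (σ** Q b * (σ** R c * (σ** S d * 1#))) ≡ A) where
      private
        Q+1 = +1-swap P+1
        P≢Q : P ≢ Q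
        P≢Q e = ∤-+1 (proj₂ pp) (subst (P ∣_) (trans e (sym P+1)) ∣-refl)
        deg-Q : deg Q ≡ deg P
        deg-Q = trans (cong deg (sym P+1)) (deg-+1 (proj₁ pp) (irreducible-deg (proj₂ pp)))
        P≤S = ℕ.≤-trans P≤R R≤S
        Q≤R = subst (_≤ deg R) (sym deg-Q) P≤R
        Q≤S = subst (_≤ deg S) (sym deg-Q) P≤S

        σP∣A : σ** P a ∣ A
        σP∣A = subst (σ** P a ∣_) perfect (∣-factorˡ _ _)
        σQ∣A : σ** Q b ∣ A
        σQ∣A = subst (σ** Q b ∣_) perfect (∣-*ˡ _ (∣-factorˡ _ _))
        σR∣A : σ** R c ∣ A
        σR∣A = subst (σ** R c ∣_) perfect (∣-*ˡ _ (∣-*ˡ _ (∣-factorˡ _ _)))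
        σS∣A : σ** S d ∣ A
        σS∣A = subst (σ** S d ∣_) perfect (∣-*ˡ _ (∣-*ˡ _ (∣-*ˡ _ (∣-factorˡ _ _))))

        P∣A : P ∣ A
        P∣A = ∣-*ʳ _ (∣-^-pos P a 0<a)
        Q∣A : Q ∣ A
        Q∣A = ∣-*ˡ _ (∣-*ʳ _ (∣-^-pos Q b 0<b))
        S∣A : S ∣ A
        S∣A = ∣-*ˡ _ (∣-*ˡ _ (∣-*ˡ _ (∣-*ʳ _ (∣-^-pos S d 0<d))))

        abstract
          successor-R : ∃[ i ] ∃[ j ] R + 1# ≡ P ^ i * Q ^ j
          successor-R = ∣-two-powers pp qq (monic-+1 (proj₁ rr) (irreducible-deg (proj₂ rr))) a b
            (strip (proj₂ ss) (R + 1#) d _ S∤R+1 (strip (proj₂ rr) (R + 1#) c _ (∤-+1 (proj₂ rr))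
              (subst (R + 1# ∣_) (solve 4 (λ p q r s → p :* (q :* (r :* (s :* con 1₄))) := r :* (s :* (p :* (q :* con 1₄)))) refl (P ^ a) (Q ^ b) (R ^ c) (S ^ d))
                (∣-trans (σ**-+1-∣ R c 0<c) σR∣A))))
        i = proj₁ successor-R
        j = proj₁ (proj₂ successor-R)
        R+1 = proj₂ (proj₂ successor-R)

        abstract
          successor-S : ∃[ k ] ∃[ l ] ∃[ t ] S + 1# ≡ P ^ k * (Q ^ l * R ^ t)
          successor-S = ∣-three-powers pp qq rr (monic-+1 (proj₁ ss) (irreducible-deg (proj₂ ss))) a b c
            (strip (proj₂ ss) (S + 1#) d _ (∤-+1 (proj₂ ss))
              (subst (S + 1# ∣_) (solve 4 (λ p q r s → p :* (q :* (r :* (s :* con 1₄))) := s :* (p :* (q :* (r :* con 1₄)))) refl (P ^ a) (Q ^ b) (R ^ c) (S ^ d))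
                (∣-trans (σ**-+1-∣ S d 0<d) σS∣A)))
        k = proj₁ successor-S
        l = proj₁ (proj₂ successor-S)
        t = proj₁ (proj₂ (proj₂ successor-S))
        S+1 = proj₂ (proj₂ (proj₂ successor-S))

        module P-side = Side P+1 pp qq rr ss P≢R P≢S Q≢R Q≢S R≢S P≤R P≤S i j k l t R+1 S+1
        module Q-side = Side Q+1 qq pp rr ss Q≢R Q≢S P≢R P≢S R≢S Q≤R Q≤S j i l k t (trans R+1 (*-comm _ _))
          (trans S+1 (solve 3 (λ p q r → p :* (q :* r) := q :* (p :* r)) refl (P ^ k) (Q ^ l) (R ^ t)))
        module P-prime = Prime-with-smooth-successor P+1 pp qq rr P≢R Q≢R i j R+1

        -- S + 1 is not constant, so one of `P`, `Q`, `R` divides it. That prime plays the part of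
        -- `Y` in `large-prime`, for the largest prime `S`.
        S-odd : ∀ x → G S (suc (x ℕ.+ x)) ∣ σ** S d → x ≡ 0
        S-odd x g∣ = by-divisor-of-S+1 k l t S+1
          where
          S+1∣A = ∣-trans (σ**-+1-∣ S d 0<d) σS∣A
          by-divisor-of-S+1 : ∀ k l t → S + 1# ≡ P ^ k * (Q ^ l * R ^ t) → x ≡ 0
          by-divisor-of-S+1 (suc k) l t e = large-prime A nc S P Q R ss pp qq rr (≢-sym Q≢S) (≢-sym R≢S) Q≢R
            (∣-*ˡ S (subst (P ∣_) (sym e) (∣-*ʳ _ (∣-factorˡ P _)))) Q≤S R≤S d a b c
            (solve 4 (λ p q r s → p :* (q :* (r :* (s :* con 1₄))) := s :* (p :* (q :* (r :* con 1₄)))) refl (P ^ a) (Q ^ b) (R ^ c) (S ^ d))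
            S∣A S+1∣A x (∣-trans g∣ σS∣A)
          by-divisor-of-S+1 zero (suc l) t e = large-prime A nc S Q P R ss qq pp rr (≢-sym P≢S) (≢-sym R≢S) P≢R
            (∣-*ˡ S (subst (Q ∣_) (sym e) (∣-*ˡ _ (∣-*ʳ _ (∣-factorˡ Q _))))) P≤S R≤S d b a c
            (solve 4 (λ p q r s → p :* (q :* (r :* (s :* con 1₄))) := s :* (q :* (p :* (r :* con 1₄)))) refl (P ^ a) (Q ^ b) (R ^ c) (S ^ d))
            S∣A S+1∣A x (∣-trans g∣ σS∣A)
          by-divisor-of-S+1 zero zero (suc t) e = large-prime A nc S R P Q ss rr pp qq (≢-sym P≢S) (≢-sym Q≢S) P≢Q
            (∣-*ˡ S (subst (R ∣_) (sym e) (∣-*ˡ _ (∣-*ˡ _ (∣-factorˡ R _))))) P≤S Q≤S d c a b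
            (solve 4 (λ p q r s → p :* (q :* (r :* (s :* con 1₄))) := s :* (r :* (p :* (q :* con 1₄)))) refl (P ^ a) (Q ^ b) (R ^ c) (S ^ d))
            S∣A S+1∣A x (∣-trans g∣ σS∣A)
          by-divisor-of-S+1 zero zero zero e = contradiction
            (trans (sym (deg-+1 (proj₁ ss) (irreducible-deg (proj₂ ss)))) (trans (cong deg (trans e (trans (*-identityˡ _) (*-identityˡ _)))) deg-1))
            (≢-sym (ℕ.<⇒≢ (irreducible-deg (proj₂ ss))))

        P∣R+1 : P ∣ R + 1#
        P∣R+1 = subst (P ∣_) (sym R+1) (∣-*ʳ _ (∣-^-pos P i P-prime.0<i))
        Q∣R+1 : Q ∣ R + 1#
        Q∣R+1 = subst (Q ∣_) (sym R+1) (∣-*ˡ _ (∣-^-pos Q j P-prime.0<j))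

        P∤GR : ∀ x → P ∤ G R (suc (x ℕ.+ x))
        P∤GR = ∤-G-odd (proj₂ pp) (∣-*ˡ R P∣R+1)
        Q∤GR : ∀ x → Q ∤ G R (suc (x ℕ.+ x))
        Q∤GR = ∤-G-odd (proj₂ qq) (∣-*ˡ R Q∣R+1)
        R∤GR : ∀ x → R ∤ G R (suc (x ℕ.+ x))
        R∤GR = ∤-G-odd (proj₂ rr) (∣-factorˡ R _)

        -- Otherwise S + 1 would contain a shorter odd sum of `R`; but all primes of S + 1 divide R
        -- (R + 1) and so none divides that sum.
        GR≢S : ∀ x → G R (suc (suc x ℕ.+ suc x)) ≢ S
        GR≢S x e = let
            w , div = G-prime-+1 (proj₁ rr) (irreducible-deg (proj₂ rr)) x (subst Irreducible (sym e) (proj₂ ss))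
            g = G R (suc (suc w ℕ.+ suc w))
            g∣ = subst (g ∣_) (trans (cong (_+ 1#) e) (trans S+1 (cong (λ z → P ^ k * (Q ^ l * z)) (sym (*-identityʳ _))))) div
          in contradiction (G-odd-∣1 rr (suc w) (strip (proj₂ rr) g t 1# (R∤GR (suc w))
               (strip (proj₂ qq) g l _ (Q∤GR (suc w)) (strip (proj₂ pp) g k _ (P∤GR (suc w)) g∣)))) λ ()

        -- `P` and `Q` divide R + 1, so only `S` can occur in an odd sum of `R`, and at most once
        -- because R ≠ S and deg R ≤ deg S.
        R-odd : ∀ x → G R (suc (x ℕ.+ x)) ∣ σ** R c → x ≡ 0
        R-odd zero    _  = refl
        R-odd (suc x) g∣ = let
            e , g≡ = ∣-power ss (monic-G-odd rr (suc x)) d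
              (strip (proj₂ rr) g c _ (R∤GR (suc x)) (strip (proj₂ qq) g b _ (Q∤GR (suc x)) (strip (proj₂ pp) g a _ (P∤GR (suc x)) (∣-trans g∣ σR∣A))))
          in contradiction (exponent≤1 rr ss R≢S R≤S (suc x) e (subst (S ^ e ∣_) (sym g≡) ∣-refl)) (≰1 e g≡)
          where
          g = G R (suc (suc x ℕ.+ suc x))
          ≰1 : ∀ e → g ≡ S ^ e → ¬ e ≤ 1
          ≰1 zero          g≡ _ = contradiction (G-odd-∣1 rr (suc x) (subst (_∣ 1#) (sym g≡) ∣-refl)) λ ()
          ≰1 (suc zero)    g≡ _ = GR≢S x (trans g≡ (*-identityʳ S))
          ≰1 (suc (suc _)) _ (s≤s ())

        abstract
          σR : TwoOrMersenne c × σ** R c ≡ (R + 1#) ^ c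
          σR = σ**-plain R c R-odd
          σS : TwoOrMersenne d × σ** S d ≡ (S + 1#) ^ d
          σS = σ**-plain S d S-odd

        N = i ℕ.+ j ℕ.+ (k ℕ.+ l ℕ.+ t ℕ.* (i ℕ.+ j))
        abstract
          -- Half of `N` if some odd sum of length above 3 occurs. The maximum with 2 gives a value
          -- before this is known, and keeps U ≥ 5 as `Shapes` requires.
          ν : ℕ
          ν = 2 ⊔ ⌊ N /2⌋

          2≤ν : 2 ≤ ν
          2≤ν = ℕ.m≤m⊔n 2 ⌊ N /2⌋

          x≡ν : ∀ x → 2 ≤ x → x ℕ.+ x ≡ N → x ≡ ν
          x≡ν x 2≤x e = sym (trans (cong (2 ⊔_) (trans (cong ⌊_/2⌋ (sym e)) (sym (ℕ.n≡⌊n+n/2⌋ x)))) (ℕ.m≤n⇒m⊔n≡n 2≤x))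

        U = suc (ν ℕ.+ ν)

        odd-part : ∀ X → MonicIrreducible X → X ∣ A → X + 1# ∣ A →
          (∀ x → G X (suc (x ℕ.+ x)) ∣ A → x ≡ 0 ⊎ (x ℕ.+ x ≡ N × G X (suc (x ℕ.+ x)) ≡ R * S)) →
          ∀ x → G X (suc (x ℕ.+ x)) ∣ A → x ≡ 0 ⊎ (x ≡ ν × G X (suc (x ℕ.+ x)) ≡ R * S)
        odd-part X xx X∣A X+1∣A factor zero          g∣ = inj₁ refl
        odd-part X xx X∣A X+1∣A factor (suc zero)    g∣ = contradiction g∣ (nc X xx X∣A X+1∣A)
        odd-part X xx X∣A X+1∣A factor (suc (suc x)) g∣ =
          [ (λ ()) , (λ (e , g≡) → inj₂ (x≡ν (suc (suc x)) (s≤s (s≤s z≤n)) e , g≡)) ]′ (factor (suc (suc x)) g∣)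

        P+1∣A : P + 1# ∣ A
        P+1∣A = subst (_∣ A) (sym P+1) Q∣A
        Q+1∣A : Q + 1# ∣ A
        Q+1∣A = subst (_∣ A) (sym Q+1) P∣A

        P-factor : ∀ x → G P (suc (x ℕ.+ x)) ∣ A → x ≡ 0 ⊎ (x ℕ.+ x ≡ N × G P (suc (x ℕ.+ x)) ≡ R * S)
        P-factor = P-side.G-factor a b c d

        Q-factor : ∀ x → G Q (suc (x ℕ.+ x)) ∣ A → x ≡ 0 ⊎ (x ℕ.+ x ≡ N × G Q (suc (x ℕ.+ x)) ≡ R * S)
        Q-factor x g∣ = [ inj₁ , (λ (e , g≡) → inj₂ (trans e
            (cong₂ ℕ._+_ (ℕ.+-comm j i) (cong₂ ℕ._+_ (ℕ.+-comm l k) (cong (t ℕ.*_) (ℕ.+-comm j i)))) , g≡)) ]′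
          (Q-side.G-factor b a c d x (subst (G Q (suc (x ℕ.+ x)) ∣_)
            (solve 4 (λ p q r s → p :* (q :* (r :* (s :* con 1₄))) := q :* (p :* (r :* (s :* con 1₄)))) refl (P ^ a) (Q ^ b) (R ^ c) (S ^ d)) g∣))

        abstract
          shape-P : ∃[ α ] ∃[ p ] Shape U a α p × σ** P a ≡ (P + 1#) ^ α * (R * S) ^ p × (0 < p → G P U ≡ R * S × G P U ∣ σ** P a)
          shape-P = σ**-shape P ν 2≤ν (R * S) a λ x g∣ → odd-part P pp P∣A P+1∣A P-factor x (∣-trans g∣ σP∣A)

          shape-Q : ∃[ β ] ∃[ q ] Shape U b β q × σ** Q b ≡ (Q + 1#) ^ β * (R * S) ^ q × (0 < q → G Q U ≡ R * S × G Q U ∣ σ** Q b)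
          shape-Q = σ**-shape Q ν 2≤ν (R * S) b λ x g∣ → odd-part Q qq Q∣A Q+1∣A Q-factor x (∣-trans g∣ σQ∣A)

        α = proj₁ shape-P
        p = proj₁ (proj₂ shape-P)
        β = proj₁ shape-Q
        q = proj₁ (proj₂ shape-Q)

        exponents≡ : a ≡ β ℕ.+ (i ℕ.* c ℕ.+ k ℕ.* d) × b ≡ α ℕ.+ (j ℕ.* c ℕ.+ l ℕ.* d) × c ≡ p ℕ.+ q ℕ.+ t ℕ.* d × d ≡ p ℕ.+ q
        exponents≡ = exponents-unique pp qq rr ss P≢Q P≢R P≢S Q≢R Q≢S R≢S a b c d _ _ _ _ (begin
          P ^ a * (Q ^ b * (R ^ c * S ^ d))
            ≡⟨ cong (λ z → P ^ a * (Q ^ b * (R ^ c * z))) (*-identityʳ _) ⟨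
          A
            ≡⟨ perfect ⟨
          σ** P a * (σ** Q b * (σ** R c * (σ** S d * 1#)))
            ≡⟨ cong₂ _*_ (trans (proj₁ (proj₂ (proj₂ (proj₂ shape-P)))) (cong (λ z → z ^ α * (R * S) ^ p) P+1))
                (cong₂ _*_ (trans (proj₁ (proj₂ (proj₂ (proj₂ shape-Q)))) (cong (λ z → z ^ β * (R * S) ^ q) Q+1))
                (cong₂ _*_ (trans (proj₂ σR) (cong (_^ c) R+1)) (cong (_* 1#) (trans (proj₂ σS) (cong (_^ d) S+1))))) ⟩
          (Q ^ α * (R * S) ^ p) * ((P ^ β * (R * S) ^ q) * ((P ^ i * Q ^ j) ^ c * ((P ^ k * (Q ^ l * R ^ t)) ^ d * 1#)))
            ≡⟨ monomial P Q R S α β p q i j k l t c d ⟩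
          P ^ (β ℕ.+ (i ℕ.* c ℕ.+ k ℕ.* d)) * (Q ^ (α ℕ.+ (j ℕ.* c ℕ.+ l ℕ.* d)) * (R ^ (p ℕ.+ q ℕ.+ t ℕ.* d) * S ^ (p ℕ.+ q))) ∎)

        -- What the occurrence of R S as an odd sum implies, stated so that it can be obtained from
        -- the side of `P` or from that of `Q`.
        record Facts : Set where
          field
            0<k : 0 < k
            0<l : 0 < l
            N≡  : ν ℕ.+ ν ≡ N
            3∤U : 3 ℕ.∤ U
            G≡  : G P U ≡ R * S ⊎ G Q U ≡ R * S

        no-third : ∀ X → MonicIrreducible X → X ∣ A → X + 1# ∣ A → G X U ∣ A → 3 ℕ.∤ U
        no-third X xx X∣A X+1∣A g∣ (ℕ.divides m U≡) =
          nc X xx X∣A X+1∣A (∣-trans (subst (λ n → G X 3 ∣ G X n) (sym U≡) (G-∣ X m 3)) g∣)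

        ν-occurs : ∀ {X Y : Set} → ν ≡ 0 ⊎ (X × Y) → X
        ν-occurs (inj₁ ν≡0)     = contradiction (subst (2 ≤_) ν≡0 2≤ν) λ ()
        ν-occurs (inj₂ (x , _)) = x

        facts-P : 0 < p → Facts
        facts-P 0<p = let
            g≡ , g∣ = proj₂ (proj₂ (proj₂ (proj₂ shape-P))) 0<p
            0<k , 0<l = P-side.k-l-positive ν g≡
          in record { 0<k = 0<k ; 0<l = 0<l ; N≡ = ν-occurs (P-factor ν (∣-trans g∣ σP∣A))
                    ; 3∤U = no-third P pp P∣A P+1∣A (∣-trans g∣ σP∣A) ; G≡ = inj₁ g≡ }

        facts-Q : 0 < q → Facts
        facts-Q 0<q = let
            g≡ , g∣ = proj₂ (proj₂ (proj₂ (proj₂ shape-Q))) 0<q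
            0<l , 0<k = Q-side.k-l-positive ν g≡
          in record { 0<k = 0<k ; 0<l = 0<l ; N≡ = ν-occurs (Q-factor ν (∣-trans g∣ σQ∣A))
                    ; 3∤U = no-third Q qq Q∣A Q+1∣A (∣-trans g∣ σQ∣A) ; G≡ = inj₂ g≡ }

        -- The factors `S` of `A` can only come from the sums equal to R S: since d = p + q is
        -- positive, `p` or `q` is.
        facts : Facts
        facts = positive p q refl refl (subst (0 <_) (proj₂ (proj₂ (proj₂ exponents≡))) 0<d)
          where
          positive : ∀ p′ q′ → p′ ≡ p → q′ ≡ q → 0 < p′ ℕ.+ q′ → Facts
          positive (suc _) q′ e _ _  = facts-P (subst (0 <_) e (s≤s z≤n))
          positive zero    q′ _ e 0<q = facts-Q (subst (0 <_) e 0<q)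

        open Facts facts

        a≡ = proj₁ exponents≡
        b≡ = proj₁ (proj₂ exponents≡)
        c≡ = proj₁ (proj₂ (proj₂ exponents≡))
        d≡ = proj₂ (proj₂ (proj₂ exponents≡))

        twos : t ≡ 0 × c ≡ 2 × d ≡ 2
        twos = exponents-are-2 {i = i} {j} {k} {l} {t} (s≤s (ℕ.+-mono-≤ 2≤ν 2≤ν)) (cong suc N≡) refl 3∤U
          P-prime.0<i P-prime.0<j 0<k 0<l (proj₁ (proj₂ (proj₂ shape-P))) (proj₁ (proj₂ (proj₂ shape-Q))) (proj₁ σR) (proj₁ σS) 0<d
          d≡ (trans c≡ (cong (λ n → n ℕ.+ t ℕ.* d) (sym d≡))) a≡ b≡

        t≡0 = proj₁ twos
        c≡2 = proj₁ (proj₂ twos)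
        d≡2 = proj₂ (proj₂ twos)

        S+1′ : S + 1# ≡ P ^ k * Q ^ l
        S+1′ = trans S+1 (cong (P ^ k *_) (trans (cong (λ n → Q ^ l * R ^ n) t≡0) (*-identityʳ _)))

        N≡′ : i ℕ.+ j ℕ.+ (k ℕ.+ l) ≡ ν ℕ.+ ν
        N≡′ = sym (trans N≡ (cong (i ℕ.+ j ℕ.+_) (trans (cong (λ n → k ℕ.+ l ℕ.+ n ℕ.* (i ℕ.+ j)) t≡0) (ℕ.+-identityʳ _))))

        -- The sum equal to R S may be one of `P` or of `Q`; exchanging `P` and `Q` exchanges the
        -- two solutions.
        ijkl : (i ≡ 1 × j ≡ 2 × k ≡ 2 × l ≡ 1) ⊎ (i ≡ 2 × j ≡ 1 × k ≡ 1 × l ≡ 2)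
        ijkl = [ factor-exponents P+1 pp qq i j k l ν P-prime.0<i 0<k 0<ν N≡′ R+1 S+1′
               , (λ g≡ → swapped (factor-exponents Q+1 qq pp j i l k ν P-prime.0<j 0<l 0<ν
                   (trans (cong₂ ℕ._+_ (ℕ.+-comm j i) (ℕ.+-comm l k)) N≡′) (trans R+1 (*-comm _ _)) (trans S+1′ (*-comm _ _)) g≡)) ]′ G≡
          where
          0<ν = ℕ.≤-trans (s≤s z≤n) 2≤ν
          swapped : (j ≡ 1 × i ≡ 2 × l ≡ 2 × k ≡ 1) ⊎ (j ≡ 2 × i ≡ 1 × l ≡ 1 × k ≡ 2) →
            (i ≡ 1 × j ≡ 2 × k ≡ 2 × l ≡ 1) ⊎ (i ≡ 2 × j ≡ 1 × k ≡ 1 × l ≡ 2)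
          swapped (inj₁ (j≡ , i≡ , l≡ , k≡)) = inj₂ (i≡ , j≡ , k≡ , l≡)
          swapped (inj₂ (j≡ , i≡ , l≡ , k≡)) = inj₁ (i≡ , j≡ , k≡ , l≡)

        i+k≡3 : i ℕ.+ k ≡ 3
        i+k≡3 = [ (λ (i≡ , _ , k≡ , _) → cong₂ ℕ._+_ i≡ k≡) , (λ (i≡ , _ , k≡ , _) → cong₂ ℕ._+_ i≡ k≡) ]′ ijkl
        j+l≡3 : j ℕ.+ l ≡ 3
        j+l≡3 = [ (λ (_ , j≡ , _ , l≡) → cong₂ ℕ._+_ j≡ l≡) , (λ (_ , j≡ , _ , l≡) → cong₂ ℕ._+_ j≡ l≡) ]′ ijkl

        -- Both solutions have i + k = j + l = 3, so 2ν = 6.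
        U≡7 : U ≡ 7
        U≡7 = cong suc (trans (sym N≡′) (trans (interchange i j k l) (cong₂ ℕ._+_ i+k≡3 j+l≡3)))
          where open import Algebra.Properties.CommutativeSemigroup ℕ.+-commutativeSemigroup using (interchange)

        6≡ : ∀ i k → i ℕ.+ k ≡ 3 → i ℕ.* c ℕ.+ k ℕ.* d ≡ 6
        6≡ i k e = trans (cong₂ (λ c d → i ℕ.* c ℕ.+ k ℕ.* d) c≡2 d≡2) (trans (sym (ℕ.*-distribʳ-+ 2 i k)) (cong (ℕ._* 2) e))

      ab : (a ≡ 7 × b ≡ 13) ⊎ (a ≡ 13 × b ≡ 7) ⊎ (a ≡ 14 × b ≡ 14)
      ab = exponents-for-7 (subst (λ u → Shape u a α p) U≡7 (proj₁ (proj₂ (proj₂ shape-P)))) (subst (λ u → Shape u b β q) U≡7 (proj₁ (proj₂ (proj₂ shape-Q))))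
        (trans (sym d≡) d≡2) (trans a≡ (cong (β ℕ.+_) (6≡ i k i+k≡3))) (trans b≡ (cong (α ℕ.+_) (6≡ j l j+l≡3)))

      cd : c ≡ 2 × d ≡ 2
      cd = c≡2 , d≡2

      RS : (R ≡ P ^ 3 + P + 1# × S ≡ P ^ 3 + P ^ 2 + 1#) ⊎ (R ≡ P ^ 3 + P ^ 2 + 1# × S ≡ P ^ 3 + P + 1#)
      RS = [ (λ (i≡ , j≡ , k≡ , l≡) → inj₁ (value₁ i≡ j≡ R+1 , value₂ k≡ l≡ S+1′))
           , (λ (i≡ , j≡ , k≡ , l≡) → inj₂ (value₂ i≡ j≡ R+1 , value₁ k≡ l≡ S+1′)) ]′ ijkl
        where
        value₁ : ∀ {X i j} → i ≡ 1 → j ≡ 2 → X + 1# ≡ P ^ i * Q ^ j → X ≡ P ^ 3 + P + 1#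
        value₁ {X} refl refl e = trans (sym (+-cancelʳ X 1#)) (trans (cong (_+ 1#) (trans e (cong (λ z → P ^ 1 * z ^ 2) (sym P+1))))
          (solve 1 (λ p → (p :* con 1₄) :* ((p :+ con 1₄) :* ((p :+ con 1₄) :* con 1₄)) :+ con 1₄ := p :* (p :* (p :* con 1₄)) :+ p :+ con 1₄) refl P))
        value₂ : ∀ {X i j} → i ≡ 2 → j ≡ 1 → X + 1# ≡ P ^ i * Q ^ j → X ≡ P ^ 3 + P ^ 2 + 1#
        value₂ {X} refl refl e = trans (sym (+-cancelʳ X 1#)) (trans (cong (_+ 1#) (trans e (cong (λ z → P ^ 2 * z ^ 1) (sym P+1))))
          (solve 1 (λ p → (p :* (p :* con 1₄)) :* ((p :+ con 1₄) :* con 1₄) :+ con 1₄ := p :* (p :* (p :* con 1₄)) :+ p :* (p :* con 1₄) :+ con 1₄) refl P))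

-- From perfection to the classification.

module Classify (𝓟 : PolynomialRing) where

  open PolynomialRing 𝓟
  open Primes 𝓟 hiding (_,_)
  open Geometric 𝓟
  open BiUnitary 𝓟
  open Derivation 𝓟
  open Shapes 𝓟
  open PairedPrimes 𝓟
  open SmoothSuccessor 𝓟
  open UnpairedPrimes 𝓟
  open import Defs using (α; α+1)

  open ≡-Reasoning

  Splits : Carrier → Set
  Splits A = ∃[ ls ] All (λ L → Monic L × deg L ≡ 1) ls × foldr _*_ 1# ls ≡ A

  AtMostFour : Carrier → Set
  AtMostFour A = ∀ (Ps : List Carrier) → Unique Ps → All (λ P → MonicIrreducible P × P ∣ A) Ps → length Ps ≤ 4

  HasExponent : (P A : Carrier) → ℕ → Set
  HasExponent P A k = ∃[ B ] P ^ k * B ≡ A × P ∤ B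

  AllExponentsOdd : Carrier → Set
  AllExponentsOdd A = ∀ P k → MonicIrreducible P → HasExponent P A k → 0 < k → k % 2 ≡ 1

  -- Ranging over all factorizations lets each case use the primes it has found, also with exponent
  -- 0.
  Perfect : Carrier → Set
  Perfect A = ∀ L → All MonicIrreducible (primes L) → Unique (primes L) → ∏^ L ≡ A → ∏σ** L ≡ A

  Ω₁ Ω₂ : Carrier → Set
  Ω₁ P = Monic P × Irreducible P × Irreducible (P + 1#)
  Ω₂ P = Monic P × Irreducible P × Irreducible (P + 1#) × Irreducible (P ^ 3 + P + 1#) × Irreducible (P ^ 3 + P ^ 2 + 1#)

  Classified : Carrier → Set
  Classified A =
    ∃[ P ] ∃[ Q ] ∃[ R ] ∃[ S ] ∃[ a ] ∃[ b ] ∃[ c ] ∃[ d ]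
      Unique (P ∷ Q ∷ R ∷ S ∷ []) ×
      All MonicIrreducible (P ∷ Q ∷ R ∷ S ∷ []) ×
      A ≡ P ^ a * Q ^ b * R ^ c * S ^ d ×
      ( ( a ≡ 2 × b ≡ 2 × c ≡ 2 × d ≡ 2 × Ω₁ P × Ω₁ R × Q ≡ P + 1# × S ≡ R + 1# )
      ⊎ ( a ≡ 2 × b ≡ 2 × (∃[ n ] c ≡ 2 ℕ.^ n ∸ 1 × d ≡ 2 ℕ.^ n ∸ 1) × Ω₁ P × Ω₁ R × Q ≡ P + 1# × S ≡ R + 1# )
      ⊎ ( (∃[ n ] a ≡ 2 ℕ.^ n ∸ 1 × b ≡ 2 ℕ.^ n ∸ 1) × c ≡ 2 × d ≡ 2 × Ω₁ P × Ω₁ R × Q ≡ P + 1# × S ≡ R + 1# )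
      ⊎ ( Ω₂ P × Q ≡ P + 1# ×
          R ∈ (P ^ 3 + P + 1# ∷ P ^ 3 + P ^ 2 + 1# ∷ []) ×
          S ∈ (P ^ 3 + P + 1# ∷ P ^ 3 + P ^ 2 + 1# ∷ []) ×
          (a , b , c , d) ∈ ((7 , 13 , 2 , 2) ∷ (13 , 7 , 2 , 2) ∷ (14 , 14 , 2 , 2) ∷ []) ) )

  prime∈ : ∀ {X} → MonicIrreducible X → ∀ L → All MonicIrreducible (primes L) → X ∣ ∏^ L → X ∈ primes L
  prime∈ xx [] _ d = contradiction d (Irreducible.p∤1 (proj₂ xx))
  prime∈ {X} xx ((p , a) ∷ L) (pp ∷ ps) d = [ here ∘ base a , there ∘ prime∈ xx L ps ]′ (euclid (proj₂ xx) (p ^ a) (∏^ L) d)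
    where
    base : ∀ a → X ∣ p ^ a → X ≡ p
    base zero    d = contradiction d (Irreducible.p∤1 (proj₂ xx))
    base (suc a) d = [ ∣⇒≡ xx pp , base a ]′ (euclid (proj₂ xx) p (p ^ a) d)

  ∏^≢0 : ∀ L → All MonicIrreducible (primes L) → ∏^ L ≢ 0#
  ∏^≢0 []            _         = 1≢0
  ∏^≢0 ((p , a) ∷ L) (pp ∷ ps) = *-≢0 (^-≢0 a (irreducible≢0 (proj₂ pp))) (∏^≢0 L ps)

  -- Matches the exponents in `AllExponentsOdd` with those of a given factorization; a positive one
  -- must be listed there.
  exponent∈ : ∀ {X k} → MonicIrreducible X → ∀ L → All MonicIrreducible (primes L) → Unique (primes L) →
    HasExponent X (∏^ L) k → 0 < k → (X , k) ∈ L
  exponent∈ {X} {k} xx L ps us (B , e , X∤B) 0<k = go L ps us (prime∈ xx L ps (∣-trans (∣-^-pos X k 0<k) (factorˡ _ B e))) B e X∤B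
    where
    go : ∀ L → All MonicIrreducible (primes L) → Unique (primes L) → X ∈ primes L → ∀ B → X ^ k * B ≡ ∏^ L → X ∤ B → (X , k) ∈ L
    go ((p , a) ∷ L) (pp ∷ ps) (≢s ∷ _) (here refl) B e X∤B =
      here (cong (X ,_) (proj₁ (exponent-unique (proj₂ xx) k a B (∏^ L) X∤B (∤-∏^ pp L ps ≢s) e)))
    go ((p , a) ∷ L) (pp ∷ ps) (≢s ∷ us) (there X∈) B e X∤B = let
        k′ , B′ , e′ , X∤B′ = extract (proj₂ xx) (∏^ L) (∏^≢0 L ps)
        k≡k′ = proj₁ (exponent-unique (proj₂ xx) k k′ B (p ^ a * B′) X∤B
          (∤-* (proj₂ xx) _ _ (∤-^ (proj₂ xx) p a (≢⇒∤ xx pp (≢-sym (All.lookup ≢s X∈)))) X∤B′)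
          (trans e (trans (cong (p ^ a *_) (sym e′)) (solve 3 (λ p x b → p :* (x :* b) := x :* (p :* b)) refl (p ^ a) (X ^ k′) B′))))
      in there (go L ps us X∈ B′ (trans (cong (λ n → X ^ n * B′) k≡k′) e′) X∤B′)

  mersenne-odd : ∀ {k} n → k ≡ mersenne n → 0 < k → k % 2 ≡ 1
  mersenne-odd zero    refl ()
  mersenne-odd (suc s) refl _ = trans (cong (λ n → suc n % 2) (trans (cong (mersenne s ℕ.+_) (sym (ℕ.+-identityʳ _))) (ℕ.*-comm 2 (mersenne s))))
    ([m+kn]%n≡m%n 1 (mersenne s) 2)

  linear-irreducible : ∀ c → MonicIrreducible (linear c)
  linear-irreducible c = monic-linear c , mkIrred
    (λ d → contradiction (trans (sym deg-linear) (∣1⇒deg≡0 d)) λ ())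
    λ {x} {y} e →
      let x≢0 : x ≢ 0#
          x≢0 = λ x≡0 → monic≢0 (monic-linear c) (trans e (trans (cong (_* y) x≡0) (zeroˡ y)))
          y≢0 : y ≢ 0#
          y≢0 = λ y≡0 → monic≢0 (monic-linear c) (trans e (trans (cong (x *_) y≡0) (zeroʳ x)))
      in small-sum x y x≢0 y≢0 (trans (sym (deg-* x y x≢0 y≢0)) (trans (cong deg (sym e)) deg-linear))
    where
    deg-linear : deg (linear c) ≡ 1
    deg-linear = cong (_∸ 1) (size-linear c)
    small-sum : ∀ x y → x ≢ 0# → y ≢ 0# → deg x ℕ.+ deg y ≡ 1 → x ∣ 1# ⊎ y ∣ 1#
    small-sum x y x≢0 y≢0 e = cases (deg x) refl
      where
      cases : ∀ n → n ≡ deg x → x ∣ 1# ⊎ y ∣ 1#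
      cases zero    n≡ = inj₁ (deg≡0⇒∣1 x≢0 (sym n≡))
      cases (suc n) n≡ = inj₂ (deg≡0⇒∣1 y≢0 (ℕ.n≤0⇒n≡0 (ℕ.≤-pred (ℕ.≤-trans (ℕ.+-monoˡ-≤ (deg y) (subst (1 ≤_) n≡ (s≤s z≤n))) (ℕ.≤-reflexive e)))))

  Nonlinear : Carrier → Set
  Nonlinear A = ∃[ Y ] MonicIrreducible Y × Y ∣ A × deg Y ≢ 1

  ∏-splits : ∀ L → All MonicIrreducible (primes L) → All ((_≡ 1) ∘ deg) (primes L) → Splits (∏^ L)
  ∏-splits []            _         _         = [] , [] , refl
  ∏-splits ((p , a) ∷ L) (pp ∷ ps) (dp ∷ ds) = prepend a (∏-splits L ps ds)
    where
    prepend : ∀ a {B} → Splits B → Splits (p ^ a * B)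
    prepend zero    {B} (ls , all , e) = ls , all , trans e (sym (*-identityˡ B))
    prepend (suc a) {B} s = let ls , all , e = prepend a s in
      p ∷ ls , (proj₁ pp , dp) ∷ all , trans (cong (p *_) e) (sym (*-assoc p _ B))

  abstract
    nonlinear : ∀ A → Monic A → ¬ Splits A → Nonlinear A
    nonlinear A mA ¬s = let L , ps , us , ds , _ , e = factorize A mA in search L ps ds (λ all → ¬s (subst Splits e (∏-splits L ps all)))
      where
      search : ∀ L → All MonicIrreducible (primes L) → All (_∣ A) (primes L) → ¬ All ((_≡ 1) ∘ deg) (primes L) → Nonlinear A
      search []            _         _         ¬all = contradiction [] ¬all
      search ((p , a) ∷ L) (pp ∷ ps) (d ∷ ds) ¬all with deg p ℕ.≟ 1
      ... | no ≢1 = p , pp , d , ≢1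
      ... | yes ≡1 = search L ps ds (λ all → ¬all (≡1 ∷ all))

  -- One of X, X + 1, X + ω, X + ω + 1 vanishes at each point of 𝔽₄, so A would
  -- have four linear factors besides its nonlinear one.
  noCubes : ∀ A → Nonlinear A → AtMostFour A → NoCubes A
  noCubes A (Y , yy , Y∣A , dY) four X _ X∣A X+1∣A g∣A = contradiction
    (four (Y ∷ linear 0₄ ∷ linear 1₄ ∷ linear α ∷ linear α+1 ∷ [])
      ((≢Y 0₄ ∷ ≢Y 1₄ ∷ ≢Y α ∷ ≢Y α+1 ∷ []) ∷ (≢ (λ ()) ∷ ≢ (λ ()) ∷ ≢ (λ ()) ∷ []) ∷ (≢ (λ ()) ∷ ≢ (λ ()) ∷ []) ∷ (≢ (λ ()) ∷ []) ∷ [] ∷ [])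
      ((yy , Y∣A) ∷ ℓ∣A 0₄ ∷ ℓ∣A 1₄ ∷ ℓ∣A α ∷ ℓ∣A α+1 ∷ []))
    λ { (s≤s (s≤s (s≤s (s≤s ())))) }
    where
    ≢Y : ∀ c → Y ≢ linear c
    ≢Y c e = dY (trans (cong deg e) (cong (_∸ 1) (size-linear c)))
    ≢ : ∀ {b c} → b ≢ c → linear b ≢ linear c
    ≢ b≢c = b≢c ∘ linear-injective
    G₃ : G X 3 ≡ (X + ω) * (X + (ω + 1#))
    G₃ = solve 1 (λ x → con 1₄ :+ x :* (con 1₄ :+ x :* (con 1₄ :+ x :* con 0₄)) := (x :+ con α) :* (x :+ con α+1)) refl X
    ℓ∣A : ∀ c → MonicIrreducible (linear c) × linear c ∣ A
    ℓ∣A c = linear-irreducible c , divides (root-shift c X)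
      where
      divides : ∃[ s ] (s * linear c ≡ X ⊎ s * linear c ≡ X + 1# ⊎ s * linear c ≡ X + ω ⊎ s * linear c ≡ X + (ω + 1#)) → linear c ∣ A
      divides (s , inj₁ e)               = ∣-trans (factorʳ s _ e) X∣A
      divides (s , inj₂ (inj₁ e))        = ∣-trans (factorʳ s _ e) X+1∣A
      divides (s , inj₂ (inj₂ (inj₁ e))) = ∣-trans (factorʳ s _ e) (∣-trans (factorˡ _ _ (sym G₃)) g∣A)
      divides (s , inj₂ (inj₂ (inj₂ e))) = ∣-trans (factorʳ s _ e) (∣-trans (factorʳ _ _ (sym G₃)) g∣A)

  minimal : ∀ x xs → ∃[ m ] m ∈ x ∷ xs × All (λ y → deg m ≤ deg y) (x ∷ xs)
  minimal x []       = x , here refl , ℕ.≤-refl ∷ []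
  minimal x (y ∷ xs) = let m , m∈ , m≤ = minimal y xs in choose m m∈ m≤ (deg x ℕ.≤? deg m)
    where
    choose : ∀ m → m ∈ y ∷ xs → All (λ z → deg m ≤ deg z) (y ∷ xs) → Dec (deg x ≤ deg m) →
      ∃[ m ] m ∈ x ∷ y ∷ xs × All (λ z → deg m ≤ deg z) (x ∷ y ∷ xs)
    choose m m∈ m≤ (yes x≤m) = x , here refl , ℕ.≤-refl ∷ All.map (ℕ.≤-trans x≤m) m≤
    choose m m∈ m≤ (no x≰m)  = m , there m∈ , ℕ.<⇒≤ (ℕ.≰⇒> x≰m) ∷ m≤

  abstract
    smallestPrime : ∀ A → Monic A → Nonlinear A →
      ∃[ P ] MonicIrreducible P × P ∣ A × (∀ X → MonicIrreducible X → X ∣ A → deg P ≤ deg X)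
    smallestPrime A mA (Y , yy , Y∣A , _) = let L , ps , us , ds , _ , e = factorize A mA in
      from L ps ds e (prime∈ yy L ps (subst (Y ∣_) (sym e) Y∣A))
      where
      from : ∀ L → All MonicIrreducible (primes L) → All (_∣ A) (primes L) → ∏^ L ≡ A → Y ∈ primes L →
        ∃[ P ] MonicIrreducible P × P ∣ A × (∀ X → MonicIrreducible X → X ∣ A → deg P ≤ deg X)
      from ((p , a) ∷ L) ps ds e _ = let P , P∈ , P≤ = minimal p (primes L) in
        P , All.lookup ps P∈ , All.lookup ds P∈ ,
        λ X xx X∣A → All.lookup P≤ (prime∈ xx ((p , a) ∷ L) ps (subst (X ∣_) (sym e) X∣A))

  abstract
    split-off : ∀ {X A} → MonicIrreducible X → Monic A → X ∣ A → ∃[ m ] ∃[ B ] 0 < m × X ^ m * B ≡ A × X ∤ B × Monic B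
    split-off {X} {A} xx mA X∣A = let m , B , e , X∤B = extract (proj₂ xx) A (monic≢0 mA) in
      m , B , positive m B e X∤B , e , X∤B , monic-cancelˡ (X ^ m) B (monic-^ m (proj₁ xx)) (subst Monic (sym e) mA)
      where
      positive : ∀ m B → X ^ m * B ≡ A → X ∤ B → 0 < m
      positive zero    B e X∤B = contradiction (subst (X ∣_) (trans (sym e) (*-identityˡ B)) X∣A) X∤B
      positive (suc m) _ _ _   = s≤s z≤n

  left-assoc : ∀ p q r s → p * (q * (r * (s * 1#))) ≡ p * q * r * s
  left-assoc = solve 4 (λ p q r s → p :* (q :* (r :* (s :* con 1₄))) := p :* q :* r :* s) refl

  module Classification (A : Carrier) (nl : Nonlinear A) (four : AtMostFour A) (¬odd : ¬ AllExponentsOdd A) (perfect : Perfect A) where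

    private
      nc : NoCubes A
      nc = noCubes A nl four

    classify-twoPairs : ∀ P Q R S → MonicIrreducible P → MonicIrreducible Q → MonicIrreducible R → MonicIrreducible S →
      P + 1# ≡ Q → R + 1# ≡ S → Unique (P ∷ Q ∷ R ∷ S ∷ []) → deg P ≤ deg R →
      ∀ a b c d → P ^ a * (Q ^ b * (R ^ c * (S ^ d * 1#))) ≡ A → Classified A
    classify-twoPairs P Q R S pp qq rr ss P+1 R+1 uniq@((P≢Q ∷ P≢R ∷ P≢S ∷ []) ∷ (Q≢R ∷ Q≢S ∷ []) ∷ (R≢S ∷ []) ∷ [] ∷ []) P≤R a b c d A≡ =
      let a≡b , c≡d , a∈ , c∈ = TwoPairs.twoPairs P Q R S pp qq rr ss P+1 R+1 P≢R P≢S Q≢R Q≢S P≤R a b c d (subst NoCubes (sym A≡) nc)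
            (trans (perfect L (pp ∷ qq ∷ rr ∷ ss ∷ []) uniq A≡) (sym A≡))
      in P , Q , R , S , a , b , c , d , uniq , pp ∷ qq ∷ rr ∷ ss ∷ [] , trans (sym A≡) (left-assoc (P ^ a) (Q ^ b) (R ^ c) (S ^ d)) , cases a≡b c≡d a∈ c∈
      where
      L : Factorization
      L = (P , a) ∷ (Q , b) ∷ (R , c) ∷ (S , d) ∷ []
      ωP : Ω₁ P
      ωP = proj₁ pp , proj₂ pp , subst Irreducible (sym P+1) (proj₂ qq)
      ωR : Ω₁ R
      ωR = proj₁ rr , proj₂ rr , subst Irreducible (sym R+1) (proj₂ ss)
      all-odd : ∀ {m n} → a ≡ b → c ≡ d → a ≡ mersenne m → c ≡ mersenne n → AllExponentsOdd A
      all-odd {m} {n} a≡b c≡d a≡ c≡ X k xx has 0<k = is-odd (exponent∈ xx L (pp ∷ qq ∷ rr ∷ ss ∷ []) uniq (subst (λ B → HasExponent X B k) (sym A≡) has) 0<k)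
        where
        is-odd : (X , k) ∈ L → k % 2 ≡ 1
        is-odd (here e)                         = mersenne-odd m (trans (cong proj₂ e) a≡) 0<k
        is-odd (there (here e))                 = mersenne-odd m (trans (cong proj₂ e) (trans (sym a≡b) a≡)) 0<k
        is-odd (there (there (here e)))         = mersenne-odd n (trans (cong proj₂ e) c≡) 0<k
        is-odd (there (there (there (here e)))) = mersenne-odd n (trans (cong proj₂ e) (trans (sym c≡d) c≡)) 0<k
      cases : a ≡ b → c ≡ d → TwoOrMersenne a → TwoOrMersenne c → _
      cases a≡b c≡d (inj₁ a≡2) (inj₁ c≡2) =
        inj₁ (a≡2 , trans (sym a≡b) a≡2 , c≡2 , trans (sym c≡d) c≡2 , ωP , ωR , sym P+1 , sym R+1)
      cases a≡b c≡d (inj₁ a≡2) (inj₂ (n , c≡)) =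
        inj₂ (inj₁ (a≡2 , trans (sym a≡b) a≡2 , (n , trans c≡ (mersenne≡ n) , trans (sym c≡d) (trans c≡ (mersenne≡ n))) , ωP , ωR , sym P+1 , sym R+1))
      cases a≡b c≡d (inj₂ (n , a≡)) (inj₁ c≡2) =
        inj₂ (inj₂ (inj₁ ((n , trans a≡ (mersenne≡ n) , trans (sym a≡b) (trans a≡ (mersenne≡ n))) , c≡2 , trans (sym c≡d) c≡2 , ωP , ωR , sym P+1 , sym R+1)))
      -- A positive Mersenne exponent is odd, so this case contradicts the hypothesis on exponents.
      cases a≡b c≡d (inj₂ (m , a≡)) (inj₂ (n , c≡)) = contradiction (all-odd a≡b c≡d a≡ c≡) ¬odd

    classify-fourPrimes : ∀ P Q R S → MonicIrreducible P → MonicIrreducible Q → MonicIrreducible R → MonicIrreducible S →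
      P + 1# ≡ Q → Unique (P ∷ Q ∷ R ∷ S ∷ []) → deg P ≤ deg R → deg R ≤ deg S →
      ∀ a b c d → 0 < a → 0 < b → 0 < c → 0 < d → P ^ a * (Q ^ b * (R ^ c * (S ^ d * 1#))) ≡ A → Classified A
    classify-fourPrimes P Q R S pp qq rr ss P+1 uniq@((P≢Q ∷ P≢R ∷ P≢S ∷ []) ∷ (Q≢R ∷ Q≢S ∷ []) ∷ (R≢S ∷ []) ∷ [] ∷ []) P≤R R≤S
      a b c d 0<a 0<b 0<c 0<d A≡ = cases ((S ∣? (R + 1#)) (irreducible≢0 (proj₂ ss)))
      where
      module F (S∤R+1 : S ∤ R + 1#) = FourPrimes P Q R S pp qq rr ss P+1 P≢R P≢S Q≢R Q≢S R≢S P≤R R≤S S∤R+1 a b c d 0<a 0<b 0<c 0<d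
      mR+1 = monic-+1 (proj₁ rr) (irreducible-deg (proj₂ rr))
      cases : Dec (S ∣ R + 1#) → Classified A
      -- deg (R + 1) = deg R ≤ deg S, so `S` is all of R + 1 and the primes form two pairs.
      cases (yes S∣R+1) = classify-twoPairs P Q R S pp qq rr ss P+1
        (sym (∣-deg≥⇒≡ (R + 1#) S mR+1 (proj₁ ss) S∣R+1 (subst (_≤ deg S) (sym (deg-+1 (proj₁ rr) (irreducible-deg (proj₂ rr)))) R≤S)))
        uniq P≤R a b c d A≡
      cases (no S∤R+1) = P , Q , R , S , a , b , c , d , uniq , pp ∷ qq ∷ rr ∷ ss ∷ [] , trans (sym A≡) (left-assoc (P ^ a) (Q ^ b) (R ^ c) (S ^ d)) ,
        inj₂ (inj₂ (inj₂ (fourth (F.RS S∤R+1 nc′ perf) , sym P+1 , R∈ (F.RS S∤R+1 nc′ perf) , S∈ (F.RS S∤R+1 nc′ perf) , exps (F.ab S∤R+1 nc′ perf) (F.cd S∤R+1 nc′ perf))))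
        where
        perf = trans (perfect ((P , a) ∷ (Q , b) ∷ (R , c) ∷ (S , d) ∷ []) (pp ∷ qq ∷ rr ∷ ss ∷ []) uniq A≡) (sym A≡)
        nc′ = subst NoCubes (sym A≡) nc
        Q-irr = subst Irreducible (sym P+1) (proj₂ qq)
        T₁ = P ^ 3 + P + 1#
        T₂ = P ^ 3 + P ^ 2 + 1#
        fourth : (R ≡ T₁ × S ≡ T₂) ⊎ (R ≡ T₂ × S ≡ T₁) → Ω₂ P
        fourth (inj₁ (R≡ , S≡)) = proj₁ pp , proj₂ pp , Q-irr , subst Irreducible R≡ (proj₂ rr) , subst Irreducible S≡ (proj₂ ss)
        fourth (inj₂ (R≡ , S≡)) = proj₁ pp , proj₂ pp , Q-irr , subst Irreducible S≡ (proj₂ ss) , subst Irreducible R≡ (proj₂ rr)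
        R∈ : (R ≡ T₁ × S ≡ T₂) ⊎ (R ≡ T₂ × S ≡ T₁) → R ∈ (T₁ ∷ T₂ ∷ [])
        R∈ (inj₁ (R≡ , _)) = here R≡
        R∈ (inj₂ (R≡ , _)) = there (here R≡)
        S∈ : (R ≡ T₁ × S ≡ T₂) ⊎ (R ≡ T₂ × S ≡ T₁) → S ∈ (T₁ ∷ T₂ ∷ [])
        S∈ (inj₁ (_ , S≡)) = there (here S≡)
        S∈ (inj₂ (_ , S≡)) = here S≡
        exps : (a ≡ 7 × b ≡ 13) ⊎ (a ≡ 13 × b ≡ 7) ⊎ (a ≡ 14 × b ≡ 14) → c ≡ 2 × d ≡ 2 →
          (a , b , c , d) ∈ ((7 , 13 , 2 , 2) ∷ (13 , 7 , 2 , 2) ∷ (14 , 14 , 2 , 2) ∷ [])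
        exps (inj₁ (refl , refl))        (refl , refl) = here refl
        exps (inj₂ (inj₁ (refl , refl))) (refl , refl) = there (here refl)
        exps (inj₂ (inj₂ (refl , refl))) (refl , refl) = there (there (here refl))

    module _ (mA : Monic A) where
      private
        smallest = smallestPrime A mA nl
        P = proj₁ smallest
        pp = proj₁ (proj₂ smallest)
        P∣A = proj₁ (proj₂ (proj₂ smallest))
        P≤ = proj₂ (proj₂ (proj₂ smallest))
        Q = P + 1#
        dP = irreducible-deg (proj₂ pp)
        mQ = monic-+1 (proj₁ pp) dP
        deg-Q = deg-+1 (proj₁ pp) dP

        -- P + 1 divides σ** (P ^ a), which is a factor of σ** (A) = A.
        Q∣A : Q ∣ A
        Q∣A = let
            a , A₁ , 0<a , e , P∤A₁ , mA₁ = split-off pp mA P∣A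
            L , ps , us , ds , _ , eL = factorize A₁ mA₁
          in ∣-trans (σ**-+1-∣ P a 0<a) (factorˡ _ _ (perfect ((P , a) ∷ L) (pp ∷ ps)
               (All.map (λ d P≡q → P∤A₁ (subst (_∣ A₁) (sym P≡q) d)) ds ∷ us) (trans (cong (P ^ a *_) eL) e)))

        -- A prime factor of P + 1 divides `A`, so its degree is at least deg P = deg (P + 1) and it
        -- is the whole of P + 1.
        qq : MonicIrreducible Q
        qq = let Z , zz , Z∣Q = irreducibleFactor Q (monic≢0 mQ) (λ d → contradiction (trans (sym deg-Q) (∣1⇒deg≡0 d)) (≢-sym (ℕ.<⇒≢ dP)))
             in subst MonicIrreducible (∣-deg≥⇒≡ Q Z mQ (proj₁ zz) Z∣Q
                  (subst (_≤ deg Z) (sym deg-Q) (P≤ Z zz (∣-trans Z∣Q Q∣A)))) zz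

        P≢Q : P ≢ Q
        P≢Q e = ∤-+1 (proj₂ pp) (subst (P ∣_) e ∣-refl)

        -- The missing pair is taken to be x, x + 1 with exponent 0 = 2⁰ - 1. A nonlinear prime of
        -- `A` is `P` or `Q`, which have the same degree; so both differ from the linear ones.
        one-pair : ∀ a b → P ^ a * (Q ^ b * 1#) ≡ A → Classified A
        one-pair a b e = classify-twoPairs (linear 0₄) (linear 1₄) P Q (linear-irreducible 0₄) (linear-irreducible 1₄) pp qq linear-1 refl
          (((λ ()) ∘ linear-injective ∷ ≢-linear 0₄ dP≢1 ∷ ≢-linear 0₄ dQ≢1 ∷ []) ∷ (≢-linear 1₄ dP≢1 ∷ ≢-linear 1₄ dQ≢1 ∷ []) ∷ (P≢Q ∷ []) ∷ [] ∷ [])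
          (subst (_≤ deg P) (sym (cong (_∸ 1) (size-linear 0₄))) dP) 0 0 a b (trans (*-identityˡ _) (trans (*-identityˡ _) e))
          where
          Y = proj₁ nl
          dY≢1 : deg Y ≢ 1
          dY≢1 = proj₂ (proj₂ (proj₂ nl))
          deg-Y : deg Y ≡ deg P
          deg-Y = from (prime∈ (proj₁ (proj₂ nl)) ((P , a) ∷ (Q , b) ∷ []) (pp ∷ qq ∷ []) (subst (Y ∣_) (sym e) (proj₁ (proj₂ (proj₂ nl)))))
            where
            from : Y ∈ P ∷ Q ∷ [] → deg Y ≡ deg P
            from (here Y≡P)         = cong deg Y≡P
            from (there (here Y≡Q)) = trans (cong deg Y≡Q) deg-Q
          dP≢1 : deg P ≢ 1
          dP≢1 = dY≢1 ∘ trans deg-Y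
          dQ≢1 : deg Q ≢ 1
          dQ≢1 = dP≢1 ∘ trans (sym deg-Q)
          ≢-linear : ∀ c {X} → deg X ≢ 1 → linear c ≢ X
          ≢-linear c d≢1 ℓ≡X = d≢1 (trans (cong deg (sym ℓ≡X)) (cong (_∸ 1) (size-linear c)))

        others : ∀ a b L → 0 < a → 0 < b → All MonicIrreducible (primes L) → Unique (P ∷ Q ∷ primes L) → All (_∣ A) (primes L) →
          All ((0 <_) ∘ proj₂) L → P ^ a * (Q ^ b * ∏^ L) ≡ A → Classified A
        others a b [] _ _ _ _ _ _ e = one-pair a b e
        others a b ((R , c) ∷ []) _ _ (rr ∷ []) uniq@((_ ∷ P≢R ∷ []) ∷ (Q≢R ∷ []) ∷ [] ∷ []) (R∣A ∷ []) (0<c ∷ []) e = contradiction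
          (trans (perfect ((P , a) ∷ (Q , b) ∷ (R , c) ∷ []) (pp ∷ qq ∷ rr ∷ []) uniq e) (sym e))
          (ThreePrimes.¬perfect P Q R pp qq rr refl P≢R Q≢R (P≤ R rr R∣A) a b c 0<c)
        others a b ((R , c) ∷ (S , d) ∷ []) 0<a 0<b (rr ∷ ss ∷ []) uniq@((_ ∷ P≢R ∷ P≢S ∷ []) ∷ (Q≢R ∷ Q≢S ∷ []) ∷ (R≢S ∷ []) ∷ [] ∷ [])
          (R∣A ∷ S∣A ∷ []) (0<c ∷ 0<d ∷ []) e = [
            (λ R≤S → classify-fourPrimes P Q R S pp qq rr ss refl uniq (P≤ R rr R∣A) R≤S a b c d 0<a 0<b 0<c 0<d e) ,
            (λ S≤R → classify-fourPrimes P Q S R pp qq ss rr refl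
              ((P≢Q ∷ P≢S ∷ P≢R ∷ []) ∷ (Q≢S ∷ Q≢R ∷ []) ∷ (≢-sym R≢S ∷ []) ∷ [] ∷ []) (P≤ S ss S∣A) S≤R a b d c 0<a 0<b 0<d 0<c
              (trans (solve 4 (λ p q r s → p :* (q :* (s :* (r :* con 1₄))) := p :* (q :* (r :* (s :* con 1₄)))) refl (P ^ a) (Q ^ b) (R ^ c) (S ^ d)) e)) ]′
          (ℕ.≤-total (deg R) (deg S))
        others a b ((R , _) ∷ (S , _) ∷ (T , _) ∷ L) _ _ ps@(rr ∷ ss ∷ tt ∷ _) ((P≢Q ∷ P≢R ∷ P≢S ∷ P≢T ∷ _) ∷ (Q≢R ∷ Q≢S ∷ Q≢T ∷ _) ∷ (R≢S ∷ R≢T ∷ _) ∷ (S≢T ∷ _) ∷ _)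
          (R∣A ∷ S∣A ∷ T∣A ∷ _) _ e = contradiction
          (four (P ∷ Q ∷ R ∷ S ∷ T ∷ [])
            ((P≢Q ∷ P≢R ∷ P≢S ∷ P≢T ∷ []) ∷ (Q≢R ∷ Q≢S ∷ Q≢T ∷ []) ∷ (R≢S ∷ R≢T ∷ []) ∷ (S≢T ∷ []) ∷ [] ∷ [])
            ((pp , P∣A) ∷ (qq , Q∣A) ∷ (rr , R∣A) ∷ (ss , S∣A) ∷ (tt , T∣A) ∷ []))
          λ { (s≤s (s≤s (s≤s (s≤s ())))) }

        module Cofactor (a b : ℕ) (A₁ A₂ : Carrier) (0<a : 0 < a) (0<b : 0 < b)
          (e₁ : P ^ a * A₁ ≡ A) (e₂ : Q ^ b * A₂ ≡ A₁) (P∤A₁ : P ∤ A₁) (Q∤A₂ : Q ∤ A₂) where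
          A₂∣A₁ : A₂ ∣ A₁
          A₂∣A₁ = factorʳ (Q ^ b) A₂ e₂
          A₂∣A : A₂ ∣ A
          A₂∣A = ∣-trans A₂∣A₁ (factorʳ (P ^ a) A₁ e₁)
          finish : ∀ L → All MonicIrreducible (primes L) → Unique (primes L) → All (_∣ A₂) (primes L) → All ((0 <_) ∘ proj₂) L →
            ∏^ L ≡ A₂ → Classified A
          finish L ps us ds es eL = others a b L 0<a 0<b ps
            ((P≢Q ∷ All.map (λ d P≡X → P∤A₁ (subst (_∣ A₁) (sym P≡X) (∣-trans d A₂∣A₁))) ds)
              ∷ All.map (λ d Q≡X → Q∤A₂ (subst (_∣ A₂) (sym Q≡X) d)) ds ∷ us)
            (All.map (λ d → ∣-trans d A₂∣A) ds) es
            (trans (cong (λ z → P ^ a * (Q ^ b * z)) eL) (trans (cong (P ^ a *_) e₂) e₁))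

      classify : Classified A
      classify = without-P (split-off pp mA P∣A)
        where
        without-Q : ∀ a A₁ → 0 < a → P ^ a * A₁ ≡ A → P ∤ A₁ → ∃[ b ] ∃[ A₂ ] 0 < b × Q ^ b * A₂ ≡ A₁ × Q ∤ A₂ × Monic A₂ → Classified A
        without-Q a A₁ 0<a e₁ P∤A₁ (b , A₂ , 0<b , e₂ , Q∤A₂ , mA₂) =
          let L , ps , us , ds , es , eL = factorize A₂ mA₂ in Cofactor.finish a b A₁ A₂ 0<a 0<b e₁ e₂ P∤A₁ Q∤A₂ L ps us ds es eL
        without-P : ∃[ a ] ∃[ A₁ ] 0 < a × P ^ a * A₁ ≡ A × P ∤ A₁ × Monic A₁ → Classified A
        without-P (a , A₁ , 0<a , e₁ , P∤A₁ , mA₁) = without-Q a A₁ 0<a e₁ P∤A₁ (split-off qq mA₁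
          ([ (λ Q∣P^a → contradiction Q∣P^a (∤-^ (proj₂ qq) P a (≢⇒∤ qq pp (≢-sym P≢Q)))) , (λ d → d) ]′
            (euclid (proj₂ qq) (P ^ a) A₁ (subst (Q ∣_) (sym e₁) Q∣A))))

-- The listed polynomials are perfect.

module Converse (𝓟 : PolynomialRing) where

  open PolynomialRing 𝓟
  open Primes 𝓟 hiding (_,_)
  open Geometric 𝓟
  open BiUnitary 𝓟
  open Shapes 𝓟
  open PairedPrimes 𝓟
  open Classify 𝓟

  open ≡-Reasoning

  -- `half (mersenne (suc s))` does not reduce for a variable `s`; this replaces it by the obvious
  -- halving.
  σ**ᴴ-unique : ∀ x {a b} (h : Halved a) (h′ : Halved b) → a ≡ b → σ**ᴴ x h ≡ σ**ᴴ x h′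
  σ**ᴴ-unique x zero     zero     _ = refl
  σ**ᴴ-unique x (odd m)  (odd n)  e = cong (λ k → (x + 1#) * (G x (suc k) * G x (suc k))) (n+n-injective m n (ℕ.suc-injective e))
  σ**ᴴ-unique x (even m) (even n) e = cong (λ k → (x + 1#) * (G x (suc (suc k)) * G x (suc k)))
    (n+n-injective m n (ℕ.suc-injective (ℕ.suc-injective e)))
  σ**ᴴ-unique x (odd m)  (even n) e = contradiction (ℕ.suc-injective e) (n+n≢suc[m+m] m n)
  σ**ᴴ-unique x (even m) (odd n)  e = contradiction (sym (ℕ.suc-injective e)) (n+n≢suc[m+m] n m)

  σ**-mersenne : ∀ x s → σ** x (mersenne s) ≡ (x + 1#) ^ mersenne s
  σ**-mersenne x zero    = refl
  σ**-mersenne x (suc s) = begin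
    σ** x (mersenne (suc s))  ≡⟨ σ**ᴴ-unique x (half (mersenne (suc s))) (odd (mersenne s)) refl ⟩
    (x + 1#) * (G x (suc (mersenne s)) * G x (suc (mersenne s))) ≡⟨ cong (λ g → (x + 1#) * (g * g)) (trans (cong (G x) (suc-mersenne s)) (G-2^ x s)) ⟩
    (x + 1#) * ((x + 1#) ^ mersenne s * (x + 1#) ^ mersenne s)  ≡⟨ cong ((x + 1#) *_) (^-homo-* (x + 1#) (mersenne s) (mersenne s)) ⟨
    (x + 1#) ^ mersenne (suc s)                                  ∎

  σ**-2 : ∀ x → σ** x 2 ≡ (x + 1#) ^ 2
  σ**-2 = solve 1 (λ x → (x :+ con 1₄) :* ((con 1₄ :+ x :* (con 1₄ :+ x :* con 0₄)) :* (con 1₄ :+ x :* con 0₄))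
    := (x :+ con 1₄) :* ((x :+ con 1₄) :* con 1₄)) refl

  σ**-twoOrMersenne : ∀ x {a} → TwoOrMersenne a → σ** x a ≡ (x + 1#) ^ a
  σ**-twoOrMersenne x (inj₁ refl)       = σ**-2 x
  σ**-twoOrMersenne x (inj₂ (n , refl)) = σ**-mersenne x n

  -- For this direction one factorization is enough: its bi-unitary divisors are all of them.
  ExactlyPerfect : Carrier → Set
  ExactlyPerfect A = ∃[ L ] All MonicIrreducible (primes L) × Unique (primes L) × ∏^ L ≡ A × ∏σ** L ≡ A

  twoPairs-perfect : ∀ P Q R S {a c} → P + 1# ≡ Q → R + 1# ≡ S → TwoOrMersenne a → TwoOrMersenne c →
    σ** P a * (σ** Q a * (σ** R c * (σ** S c * 1#))) ≡ P ^ a * Q ^ a * R ^ c * S ^ c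
  twoPairs-perfect P Q R S {a} {c} P+1 R+1 a∈ c∈ = begin
    σ** P a * (σ** Q a * (σ** R c * (σ** S c * 1#)))
      ≡⟨ cong₂ _*_ (value P+1 a∈) (cong₂ _*_ (value (+1-swap P+1) a∈) (cong₂ _*_ (value R+1 c∈) (cong (_* 1#) (value (+1-swap R+1) c∈)))) ⟩
    Q ^ a * (P ^ a * (S ^ c * (R ^ c * 1#)))
      ≡⟨ solve 4 (λ p q r s → q :* (p :* (s :* (r :* con 1₄))) := p :* q :* r :* s) refl (P ^ a) (Q ^ a) (R ^ c) (S ^ c) ⟩
    P ^ a * Q ^ a * R ^ c * S ^ c ∎
    where
    value : ∀ {X Y n} → X + 1# ≡ Y → TwoOrMersenne n → σ** X n ≡ Y ^ n
    value {X} {Y} {n} X+1 n∈ = trans (σ**-twoOrMersenne X n∈) (cong (_^ n) X+1)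

  module _ (P : Carrier) where
    private
      Q  = P + 1#
      T₁ = P ^ 3 + P + 1#
      T₂ = P ^ 3 + P ^ 2 + 1#

    T₁+1 : T₁ + 1# ≡ P * (Q * Q)
    T₁+1 = solve 1 (λ p → p :* (p :* (p :* con 1₄)) :+ p :+ con 1₄ :+ con 1₄ := p :* ((p :+ con 1₄) :* (p :+ con 1₄))) refl P

    T₂+1 : T₂ + 1# ≡ P * (P * Q)
    T₂+1 = solve 1 (λ p → p :* (p :* (p :* con 1₄)) :+ p :* (p :* con 1₄) :+ con 1₄ :+ con 1₄ := p :* (p :* (p :+ con 1₄))) refl P

    G-P-7 : G P 7 ≡ T₁ * T₂
    G-P-7 = solve 1 (λ p → let o = con 1₄ in o :+ p :* (o :+ p :* (o :+ p :* (o :+ p :* (o :+ p :* (o :+ p :* (o :+ p :* con 0₄))))))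
      := (p :* (p :* (p :* con 1₄)) :+ p :+ con 1₄) :* (p :* (p :* (p :* con 1₄)) :+ p :* (p :* con 1₄) :+ con 1₄)) refl P

    -- The same product as for `P`, because P ↦ P + 1 exchanges `T₁` and `T₂`. This is why R S can
    -- come from either prime of the pair.
    G-Q-7 : G Q 7 ≡ T₁ * T₂
    G-Q-7 = solve 1 (λ p → let o = con 1₄ ; q = p :+ o in o :+ q :* (o :+ q :* (o :+ q :* (o :+ q :* (o :+ q :* (o :+ q :* (o :+ q :* con 0₄))))))
      := (p :* (p :* (p :* con 1₄)) :+ p :+ con 1₄) :* (p :* (p :* (p :* con 1₄)) :+ p :* (p :* con 1₄) :+ con 1₄)) refl P

    private
      Q+1 : Q + 1# ≡ P
      Q+1 = +-cancelʳ P 1#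

    σ**-T : σ** T₁ 2 * σ** T₂ 2 ≡ P ^ 6 * Q ^ 6
    σ**-T = trans (cong₂ _*_ (trans (σ**-2 T₁) (cong (_^ 2) T₁+1)) (trans (σ**-2 T₂) (cong (_^ 2) T₂+1)))
      (solve 2 (λ p q → (p :* (q :* q)) :^ 2 :* (p :* (p :* q)) :^ 2 := p :^ 6 :* q :^ 6) refl P Q)

    -- σ** (X ^ 13) = (X + 1) (G X 7)² and σ** (X ^ 14) = (X + 1) G X 8 G X 7.
    seven-thirteen : σ** P 7 * σ** Q 13 * (σ** T₁ 2 * σ** T₂ 2) ≡ P ^ 7 * Q ^ 13 * (T₁ ^ 2 * T₂ ^ 2)
    seven-thirteen = begin
      σ** P 7 * ((Q + 1#) * (G Q 7 * G Q 7)) * (σ** T₁ 2 * σ** T₂ 2)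
        ≡⟨ cong₂ _*_ (cong₂ _*_ (σ**-mersenne P 3) (cong₂ (λ x g → x * (g * g)) Q+1 G-Q-7)) σ**-T ⟩
      Q ^ 7 * (P * ((T₁ * T₂) * (T₁ * T₂))) * (P ^ 6 * Q ^ 6)
        ≡⟨ solve 4 (λ p q r s → q :^ 7 :* (p :* ((r :* s) :* (r :* s))) :* (p :^ 6 :* q :^ 6) := p :^ 7 :* q :^ 13 :* (r :^ 2 :* s :^ 2)) refl P Q T₁ T₂ ⟩
      P ^ 7 * Q ^ 13 * (T₁ ^ 2 * T₂ ^ 2) ∎

    thirteen-seven : σ** P 13 * σ** Q 7 * (σ** T₁ 2 * σ** T₂ 2) ≡ P ^ 13 * Q ^ 7 * (T₁ ^ 2 * T₂ ^ 2)
    thirteen-seven = begin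
      (P + 1#) * (G P 7 * G P 7) * σ** Q 7 * (σ** T₁ 2 * σ** T₂ 2)
        ≡⟨ cong₂ _*_ (cong₂ _*_ (cong (λ g → Q * (g * g)) G-P-7) (trans (σ**-mersenne Q 3) (cong (_^ 7) Q+1))) σ**-T ⟩
      Q * ((T₁ * T₂) * (T₁ * T₂)) * P ^ 7 * (P ^ 6 * Q ^ 6)
        ≡⟨ solve 4 (λ p q r s → q :* ((r :* s) :* (r :* s)) :* p :^ 7 :* (p :^ 6 :* q :^ 6) := p :^ 13 :* q :^ 7 :* (r :^ 2 :* s :^ 2)) refl P Q T₁ T₂ ⟩
      P ^ 13 * Q ^ 7 * (T₁ ^ 2 * T₂ ^ 2) ∎

    fourteen-fourteen : σ** P 14 * σ** Q 14 * (σ** T₁ 2 * σ** T₂ 2) ≡ P ^ 14 * Q ^ 14 * (T₁ ^ 2 * T₂ ^ 2)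
    fourteen-fourteen = begin
      (P + 1#) * (G P 8 * G P 7) * ((Q + 1#) * (G Q 8 * G Q 7)) * (σ** T₁ 2 * σ** T₂ 2)
        ≡⟨ cong₂ _*_ (cong₂ _*_ (cong₂ (λ y g → Q * (y * g)) (G-2^ P 3) G-P-7)
             (cong₂ _*_ Q+1 (cong₂ _*_ (trans (G-2^ Q 3) (cong (_^ 7) Q+1)) G-Q-7))) σ**-T ⟩
      Q * (Q ^ 7 * (T₁ * T₂)) * (P * (P ^ 7 * (T₁ * T₂))) * (P ^ 6 * Q ^ 6)
        ≡⟨ solve 4 (λ p q r s → q :* (q :^ 7 :* (r :* s)) :* (p :* (p :^ 7 :* (r :* s))) :* (p :^ 6 :* q :^ 6) := p :^ 14 :* q :^ 14 :* (r :^ 2 :* s :^ 2)) refl P Q T₁ T₂ ⟩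
      P ^ 14 * Q ^ 14 * (T₁ ^ 2 * T₂ ^ 2) ∎

  classified⇒perfect : ∀ A → Classified A → ExactlyPerfect A
  classified⇒perfect A (P , Q , R , S , a , b , c , d , uniq , irr , A≡ , cases) =
    (P , a) ∷ (Q , b) ∷ (R , c) ∷ (S , d) ∷ [] , irr , uniq ,
    trans (left-assoc (P ^ a) (Q ^ b) (R ^ c) (S ^ d)) (sym A≡) , trans (perfect cases) (sym A≡)
    where
    Value = σ** P a * (σ** Q b * (σ** R c * (σ** S d * 1#))) ≡ P ^ a * Q ^ b * R ^ c * S ^ d

    R≢S : R ≢ S
    R≢S = distinct uniq
      where
      distinct : Unique (P ∷ Q ∷ R ∷ S ∷ []) → R ≢ S
      distinct (_ ∷ _ ∷ (R≢S ∷ []) ∷ _) = R≢S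

    pairs : ∀ {a b c d} → Q ≡ P + 1# → S ≡ R + 1# → TwoOrMersenne a → TwoOrMersenne c → a ≡ b → c ≡ d →
      σ** P a * (σ** Q b * (σ** R c * (σ** S d * 1#))) ≡ P ^ a * Q ^ b * R ^ c * S ^ d
    pairs Q≡ S≡ a∈ c∈ refl refl = twoPairs-perfect P Q R S (sym Q≡) (sym S≡) a∈ c∈

    mersenne∈ : ∀ {k} n → k ≡ 2 ℕ.^ n ∸ 1 → TwoOrMersenne k
    mersenne∈ n e = inj₂ (n , trans e (sym (mersenne≡ n)))

    regroup₁ : ∀ p q r s → p * (q * (r * (s * 1#))) ≡ p * q * (r * s)
    regroup₁ = solve 4 (λ p q r s → p :* (q :* (r :* (s :* con 1₄))) := p :* q :* (r :* s)) refl
    regroup₂ : ∀ p q r s → p * (q * (r * (s * 1#))) ≡ p * q * (s * r)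
    regroup₂ = solve 4 (λ p q r s → p :* (q :* (r :* (s :* con 1₄))) := p :* q :* (s :* r)) refl

    -- `R` and `S` are distinct, so they are the two cubics in one of the two orders, and both have
    -- exponent 2.
    fourth : (∀ T₁ T₂ → T₁ ≡ P ^ 3 + P + 1# → T₂ ≡ P ^ 3 + P ^ 2 + 1# → σ** P a * σ** Q b * (σ** T₁ 2 * σ** T₂ 2) ≡ P ^ a * Q ^ b * (T₁ ^ 2 * T₂ ^ 2)) →
      c ≡ 2 → d ≡ 2 → R ∈ (P ^ 3 + P + 1# ∷ P ^ 3 + P ^ 2 + 1# ∷ []) → S ∈ (P ^ 3 + P + 1# ∷ P ^ 3 + P ^ 2 + 1# ∷ []) → Value
    fourth h refl refl (here R≡)         (there (here S≡)) = trans (regroup₁ (σ** P a) (σ** Q b) (σ** R 2) (σ** S 2))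
      (trans (h R S R≡ S≡) (trans (sym (regroup₁ _ _ _ _)) (left-assoc (P ^ a) (Q ^ b) (R ^ 2) (S ^ 2))))
    fourth h refl refl (there (here R≡)) (here S≡)         = trans (regroup₂ (σ** P a) (σ** Q b) (σ** R 2) (σ** S 2))
      (trans (h S R S≡ R≡) (trans (sym (regroup₂ _ _ _ _)) (left-assoc (P ^ a) (Q ^ b) (R ^ 2) (S ^ 2))))
    fourth h _ _ (here R≡)         (here S≡)         = contradiction (trans R≡ (sym S≡)) R≢S
    fourth h _ _ (there (here R≡)) (there (here S≡)) = contradiction (trans R≡ (sym S≡)) R≢S

    perfect : _ → Value
    perfect (inj₁ (a≡ , b≡ , c≡ , d≡ , _ , _ , Q≡ , S≡)) =
      pairs Q≡ S≡ (inj₁ a≡) (inj₁ c≡) (trans a≡ (sym b≡)) (trans c≡ (sym d≡))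
    perfect (inj₂ (inj₁ (a≡ , b≡ , (n , c≡ , d≡) , _ , _ , Q≡ , S≡))) =
      pairs Q≡ S≡ (inj₁ a≡) (mersenne∈ n c≡) (trans a≡ (sym b≡)) (trans c≡ (sym d≡))
    perfect (inj₂ (inj₂ (inj₁ ((n , a≡ , b≡) , c≡ , d≡ , _ , _ , Q≡ , S≡)))) =
      pairs Q≡ S≡ (mersenne∈ n a≡) (inj₁ c≡) (trans a≡ (sym b≡)) (trans c≡ (sym d≡))
    perfect (inj₂ (inj₂ (inj₂ (_ , Q≡ , R∈ , S∈ , exps)))) = by-exponents exps
      where
      value : ∀ {a′ b′} → a ≡ a′ → b ≡ b′ →
        (let T₁ = P ^ 3 + P + 1# ; T₂ = P ^ 3 + P ^ 2 + 1# in
          σ** P a′ * σ** (P + 1#) b′ * (σ** T₁ 2 * σ** T₂ 2) ≡ P ^ a′ * (P + 1#) ^ b′ * (T₁ ^ 2 * T₂ ^ 2)) →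
        ∀ T₁ T₂ → T₁ ≡ P ^ 3 + P + 1# → T₂ ≡ P ^ 3 + P ^ 2 + 1# → σ** P a * σ** Q b * (σ** T₁ 2 * σ** T₂ 2) ≡ P ^ a * Q ^ b * (T₁ ^ 2 * T₂ ^ 2)
      value refl refl e T₁ T₂ T₁≡ T₂≡ = trans
        (cong₂ _*_ (cong (λ q → σ** P a * σ** q b) Q≡) (cong₂ (λ t u → σ** t 2 * σ** u 2) T₁≡ T₂≡))
        (trans e (sym (cong₂ _*_ (cong (λ q → P ^ a * q ^ b) Q≡) (cong₂ (λ t u → t ^ 2 * u ^ 2) T₁≡ T₂≡))))
      by-exponents : (a , b , c , d) ∈ ((7 , 13 , 2 , 2) ∷ (13 , 7 , 2 , 2) ∷ (14 , 14 , 2 , 2) ∷ []) → Value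
      by-exponents (here e) = fourth (value (cong proj₁ e) (cong (λ t → proj₁ (proj₂ t)) e) (seven-thirteen P))
        (cong (λ t → proj₁ (proj₂ (proj₂ t))) e) (cong (λ t → proj₂ (proj₂ (proj₂ t))) e) R∈ S∈
      by-exponents (there (here e)) = fourth (value (cong proj₁ e) (cong (λ t → proj₁ (proj₂ t)) e) (thirteen-seven P))
        (cong (λ t → proj₁ (proj₂ (proj₂ t))) e) (cong (λ t → proj₂ (proj₂ (proj₂ t))) e) R∈ S∈
      by-exponents (there (there (here e))) = fourth (value (cong proj₁ e) (cong (λ t → proj₁ (proj₂ t)) e) (fourteen-fourteen P))
        (cong (λ t → proj₁ (proj₂ (proj₂ t))) e) (cong (λ t → proj₂ (proj₂ (proj₂ t))) e) R∈ S∈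

-- Transfer to the given definitions and the theorem.

open Coefficients using (𝔽₄[x])

open import Defs
open import Data.List.Membership.Propositional.Properties.WithK using (unique∧set⇒bag)
open import Data.List.Relation.Binary.BagAndSetEquality using (∼bag⇒↭)
open import Data.List.Relation.Binary.Permutation.Propositional using (_↭_; ↭⇒↭ₛ)
open import Data.List.Relation.Binary.Permutation.Setoid.Properties using (foldr-commMonoid)
open import Function.Bundles using (_⇔_; mk⇔; Equivalence)

module Pr = Primes 𝔽₄[x]
module Bi = BiUnitary 𝔽₄[x]
module Ma = Classify 𝔽₄[x]
module Co = Converse 𝔽₄[x]

-- The `greatest` field is the maximality clause of `BiUnitary`, as 1ᴾ has degree 0 by computation.
isBiUnitary⇔ : ∀ {D S} → IsBiUnitaryDivisor D S ⇔ Bi.BiUnitary D S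
isBiUnitary⇔ {D} {S} = mk⇔
  (λ (mD , E , e , gcd) → mD , E , e , λ {C} u v → IsGcdᵤ.greatest gcd u v)
  (λ (mD , E , e , gcd) → mD , E , e , record { divides₁ = unitary-1 D ; divides₂ = unitary-1 E ; greatest = gcd })
  where
  unitary-1 : ∀ D → IsUnitaryDivisor 1ᴾ D
  unitary-1 D = refl , D , Pr.*-identityˡ D , λ z∣1 _ → z∣1

sumᴾ-↭ : ∀ {xs ys} → xs ↭ ys → sumᴾ xs ≡ sumᴾ ys
sumᴾ-↭ xs↭ys = foldr-commMonoid (setoid Poly) (CommutativeRing.+-isCommutativeMonoid Pr.commutativeRing) (↭⇒↭ₛ xs↭ys)

-- The given enumeration and `biUnitaryDivisors L` are duplicate-free with the same members, hence
-- permutations of each other, and have the same sum.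
biUnitaryPerfect⇒perfect : ∀ A → BiUnitaryPerfect A → Ma.Perfect A
biUnitaryPerfect⇒perfect A (Ds , uDs , Ds⇔ , ΣDs≡A) L ps us refl =
  trans (sym (Bi.∑-biUnitaryDivisors L)) (trans (sym (sumᴾ-↭ (∼bag⇒↭ (unique∧set⇒bag uDs (Bi.unique-biUnitaryDivisors L ps us) same)))) ΣDs≡A)
  where
  same : ∀ {D} → D ∈ Ds ⇔ D ∈ Bi.biUnitaryDivisors L
  same {D} = mk⇔
    (λ D∈ → Bi.∈-biUnitaryDivisors⁺ L ps us (Equivalence.to (isBiUnitary⇔ {D} {A}) (Equivalence.to (Ds⇔ D) D∈)))
    (λ D∈ → Equivalence.from (Ds⇔ D) (Equivalence.from (isBiUnitary⇔ {D} {A}) (Bi.∈-biUnitaryDivisors⁻ L ps us D∈)))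

perfect⇒biUnitaryPerfect : ∀ A → Co.ExactlyPerfect A → BiUnitaryPerfect A
perfect⇒biUnitaryPerfect A (L , ps , us , refl , perfect) =
  Bi.biUnitaryDivisors L , Bi.unique-biUnitaryDivisors L ps us ,
  (λ D → mk⇔ (λ D∈ → Equivalence.from (isBiUnitary⇔ {D} {A}) (Bi.∈-biUnitaryDivisors⁻ L ps us D∈))
             (λ u → Bi.∈-biUnitaryDivisors⁺ L ps us (Equivalence.to (isBiUnitary⇔ {D} {A}) u))) ,
  trans (Bi.∑-biUnitaryDivisors L) perfect

theorem1p2 : ∀ (A : Poly) →
    Monic A →
    ¬ Splits A →
    AtMostFourIrreducibleFactors A →
    ¬ AllExponentsOdd A →
    BiUnitaryPerfect A ⇔
    (∃[ P ] ∃[ Q ] ∃[ R ] ∃[ S ] ∃[ a ] ∃[ b ] ∃[ c ] ∃[ d ]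
    Unique (P ∷ Q ∷ R ∷ S ∷ []) ×
    All MonicIrreducible (P ∷ Q ∷ R ∷ S ∷ []) ×
    A ≡ P ^ a * Q ^ b * R ^ c * S ^ d ×
    ( ( a ≡ 2 × b ≡ 2 × c ≡ 2 × d ≡ 2 ×
    Ω₁ P × Ω₁ R × Q ≡ P + 1ᴾ × S ≡ R + 1ᴾ )
    ⊎ ( a ≡ 2 × b ≡ 2 ×
    (∃[ n ] c ≡ 2 ℕ.^ n ∸ 1 × d ≡ 2 ℕ.^ n ∸ 1) ×
    Ω₁ P × Ω₁ R × Q ≡ P + 1ᴾ × S ≡ R + 1ᴾ )
    ⊎ ( (∃[ n ] a ≡ 2 ℕ.^ n ∸ 1 × b ≡ 2 ℕ.^ n ∸ 1) ×
    c ≡ 2 × d ≡ 2 ×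
    Ω₁ P × Ω₁ R × Q ≡ P + 1ᴾ × S ≡ R + 1ᴾ )
    ⊎ ( Ω₂ P × Q ≡ P + 1ᴾ ×
    R ∈ (P ^ 3 + P + 1ᴾ ∷ P ^ 3 + P ^ 2 + 1ᴾ ∷ []) ×
    S ∈ (P ^ 3 + P + 1ᴾ ∷ P ^ 3 + P ^ 2 + 1ᴾ ∷ []) ×
    (a , b , c , d) ∈
    ((7 , 13 , 2 , 2) ∷ (13 , 7 , 2 , 2) ∷ (14 , 14 , 2 , 2) ∷ []) )
    ))
theorem1p2 A mA ¬splits four ¬odd = mk⇔
  (λ bup → Ma.Classification.classify A (Ma.nonlinear A mA ¬splits) four ¬odd (biUnitaryPerfect⇒perfect A bup) mA)
  (λ classified → perfect⇒biUnitaryPerfect A (Co.classified⇒perfect A classified))
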